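{- Fix $\varepsilon>0$ and $\gamma\in(0,1)$, and let $d_N=(1-\gamma)\sqrt{\frac{\log N}{2\log\log N}}$. Let $n\in\mathbb{N}$, $G=\mathbb{Z}_2^n$ and $N=2^n=|G|$, and let $d$ be an integer with $2\leqslant d\leqslant d_N$. If $\Gamma\in\mathcal{G}(G,p)$ with $p\leqslant\sqrt[d]{d!(1-\varepsilon)\frac{\log N}{N^{d-1}}}$, then with high probability the diameter of $\Gamma$ is greater than $d$; that is, $\Pr(\operatorname{diam}(\Gamma)\leqslant d)\to0$ as $n\to\infty$, uniformly over all such $d$ and $p$.
   Context: For a group $G$ and a subset $S\subseteq G$, the (undirected) Cayley graph $\Gamma(G;S)$ has vertex set $G$ and an edge between $g\neq h$ iff $g^{ -1}h\in S$ or $h^{ -1}g\in S$ (loops and multiple edges ignored). The model $\mathcal{G}(G,p)$ is the probability space of Cayley graphs $\Gamma(G;S)$ where each element of $G$ is put in $S$ independently with probability $p$. The diameter of a disconnected graph is infinite. -}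

module Defs where

open import Algebra.Bundles using (Group)
open import Data.Fin.Base as Fin using (Fin)
import Data.Fin.Properties as Fin
open import Data.Fin.Subset using (Subset; inside; outside; _∈_; ∣_∣)
open import Data.Fin.Subset.Properties using (_∈?_)
open import Data.Integer.Base using (+_)
open import Data.Nat.Base as ℕ using (ℕ; zero; suc; _!; s≤s)
import Data.Nat.Properties as ℕ
open import Data.Parity.Base as ℙ using (Parity; 0ℙ; 1ℙ)
import Data.Parity.Properties as ℙ
open import Data.Product.Base using (_×_; _,_; ∃-syntax; Σ-syntax; uncurry)
open import Data.Product.Function.NonDependent.Propositional using (_×-↔_)
open import Data.Rational.Base as ℚ using (ℚ; 0ℚ; 1ℚ; ½)
import Data.Rational.Properties as ℚ
open import Data.Rational.Solver using (module +-*-Solver)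
open import Data.Sum.Base using (_⊎_; inj₁; inj₂)
open import Data.Vec.Base using (Vec; []; _∷_; zipWith; replicate; map)
import Data.Vec.Properties as Vec
open import Data.Bool.Base using (if_then_else_)
open import Function.Base using (id)
open import Function.Bundles using (Inverse; _↔_; mk↔ₛ′)
open import Function.Construct.Composition using (_↔-∘_)
open import Function.Construct.Symmetry using (↔-sym)
open import Level using (0ℓ)
open import Relation.Binary.Core using (Rel)
open import Relation.Binary.PropositionalEquality as ≡ using (_≡_; refl; sym; trans; cong; cong₂; subst)
open import Relation.Nullary.Decidable using (Dec; does; map′; _×-dec_; _⊎-dec_; ¬?)
open import Relation.Nullary.Negation using (¬_)
open import Relation.Unary using (Pred; Decidable)

------------------------------------------------------------------------
-- Real numbers: Cauchy sequences of rationals carrying a modulus, with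
-- equality as an equivalence relation.

record ℝ : Set where
  constructor mkℝ
  field
    seq    : ℕ → ℚ
    cauchy : ∀ e → 0ℚ ℚ.< e →
             ∃[ M ] ∀ m n → M ℕ.≤ m → M ℕ.≤ n → ℚ.∣ seq m ℚ.- seq n ∣ ℚ.< e

open ℝ public

infix 4 _≤ℝ_ _<ℝ_ _≃ℝ_

_≤ℝ_ : ℝ → ℝ → Set
x ≤ℝ y = ∀ e → 0ℚ ℚ.< e → ∃[ M ] ∀ n → M ℕ.≤ n → seq x n ℚ.≤ seq y n ℚ.+ e

_<ℝ_ : ℝ → ℝ → Set
x <ℝ y = Σ[ e ∈ ℚ ] 0ℚ ℚ.< e × ∃[ M ] ∀ n → M ℕ.≤ n → seq x n ℚ.+ e ℚ.≤ seq y n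

_≃ℝ_ : ℝ → ℝ → Set
x ≃ℝ y = x ≤ℝ y × y ≤ℝ x

fromℚ : ℚ → ℝ
fromℚ q .seq _ = q
fromℚ q .cauchy e 0<e = 0 , λ _ _ _ _ →
  subst (λ r → ℚ.∣ r ∣ ℚ.< e) (sym (ℚ.+-inverseʳ q)) 0<e

fromℕ : ℕ → ℝ
fromℕ n = fromℚ (+ n ℚ./ 1)

0ℝ 1ℝ : ℝ
0ℝ = fromℚ 0ℚ
1ℝ = fromℚ 1ℚ

half+half : ∀ e → ½ ℚ.* e ℚ.+ ½ ℚ.* e ≡ e
half+half e = trans (sym (ℚ.*-distribʳ-+ e ½ ½)) (ℚ.*-identityˡ e)

0<half : ∀ e → 0ℚ ℚ.< e → 0ℚ ℚ.< ½ ℚ.* e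
0<half e 0<e = subst (ℚ._< ½ ℚ.* e) (ℚ.*-zeroʳ ½) (ℚ.*-monoʳ-<-pos ½ 0<e)

infixl 6 _+ℝ_ _-ℝ_
infixl 7 _*ℝ_ _/ℕ_
infixr 8 _^ℝ_

_+ℝ_ : ℝ → ℝ → ℝ
(x +ℝ y) .seq n = seq x n ℚ.+ seq y n
(x +ℝ y) .cauchy e 0<e
  with cauchy x (½ ℚ.* e) (0<half e 0<e) | cauchy y (½ ℚ.* e) (0<half e 0<e)
... | M , hx | M′ , hy = M ℕ.⊔ M′ , λ m n M≤m M≤n →
  let a = seq x m ; b = seq x n ; c = seq y m ; d = seq y n in
  begin-strict
    ℚ.∣ (a ℚ.+ c) ℚ.- (b ℚ.+ d) ∣         ≡⟨ cong ℚ.∣_∣ (regroup a b c d) ⟩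
    ℚ.∣ (a ℚ.- b) ℚ.+ (c ℚ.- d) ∣         ≤⟨ ℚ.∣p+q∣≤∣p∣+∣q∣ (a ℚ.- b) (c ℚ.- d) ⟩
    ℚ.∣ a ℚ.- b ∣ ℚ.+ ℚ.∣ c ℚ.- d ∣       <⟨ ℚ.+-mono-<
                                               (hx m n (ℕ.m⊔n≤o⇒m≤o M M′ M≤m) (ℕ.m⊔n≤o⇒m≤o M M′ M≤n))
                                               (hy m n (ℕ.m⊔n≤o⇒n≤o M M′ M≤m) (ℕ.m⊔n≤o⇒n≤o M M′ M≤n)) ⟩
    ½ ℚ.* e ℚ.+ ½ ℚ.* e                   ≡⟨ half+half e ⟩
    e                                     ∎
  where
  open ℚ.≤-Reasoning
  open +-*-Solver
  regroup : ∀ a b c d → (a ℚ.+ c) ℚ.- (b ℚ.+ d) ≡ (a ℚ.- b) ℚ.+ (c ℚ.- d)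
  regroup = solve 4 (λ a b c d → (a :+ c) :- (b :+ d) := (a :- b) :+ (c :- d)) refl

-ℝ_ : ℝ → ℝ
(-ℝ x) .seq n = ℚ.- seq x n
(-ℝ x) .cauchy e 0<e with cauchy x e 0<e
... | M , h = M , λ m n M≤m M≤n →
  subst (ℚ._< e)
    (trans (sym (ℚ.∣-p∣≡∣p∣ (seq x m ℚ.- seq x n))) (cong ℚ.∣_∣ (flip (seq x m) (seq x n))))
    (h m n M≤m M≤n)
  where
  open +-*-Solver
  flip : ∀ a b → ℚ.- (a ℚ.- b) ≡ (ℚ.- a) ℚ.- (ℚ.- b)
  flip = solve 2 (λ a b → :- (a :- b) := (:- a) :- (:- b)) refl

_-ℝ_ : ℝ → ℝ → ℝ
x -ℝ y = x +ℝ (-ℝ y)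

bounded : ∀ x → Σ[ B ∈ ℚ ] 0ℚ ℚ.< B × ∃[ M ] ∀ n → M ℕ.≤ n → ℚ.∣ seq x n ∣ ℚ.≤ B
bounded x with cauchy x 1ℚ (ℚ.positive⁻¹ 1ℚ)
... | M , h = B , 0<B , M , λ n M≤n → let a = seq x n in begin
    ℚ.∣ a ∣                         ≡⟨ cong ℚ.∣_∣ (split a c) ⟩
    ℚ.∣ (a ℚ.- c) ℚ.+ c ∣           ≤⟨ ℚ.∣p+q∣≤∣p∣+∣q∣ (a ℚ.- c) c ⟩
    ℚ.∣ a ℚ.- c ∣ ℚ.+ ℚ.∣ c ∣       ≤⟨ ℚ.+-monoˡ-≤ ℚ.∣ c ∣ (ℚ.<⇒≤ (h n M M≤n ℕ.≤-refl)) ⟩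
    B                               ∎
  where
  open ℚ.≤-Reasoning
  open +-*-Solver
  c = seq x M
  B = 1ℚ ℚ.+ ℚ.∣ c ∣
  0<B : 0ℚ ℚ.< B
  0<B = ℚ.+-mono-<-≤ (ℚ.positive⁻¹ 1ℚ) (ℚ.0≤∣p∣ c)
  split : ∀ a c → a ≡ (a ℚ.- c) ℚ.+ c
  split = solve 2 (λ a c → a := (a :- c) :+ c) refl

shrink : ∀ B e → 0ℚ ℚ.< B → 0ℚ ℚ.< e → Σ[ r ∈ ℚ ] 0ℚ ℚ.< r × B ℚ.* r ≡ e
shrink B e 0<B 0<e = e ℚ.* ℚ.1/ B , 0<r , B*r≡e
  where
  instance
    B-pos : ℚ.Positive B
    B-pos = ℚ.positive 0<B
    B-nz : ℚ.NonZero B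
    B-nz = ℚ.pos⇒nonZero B
    1/B-pos : ℚ.Positive (ℚ.1/ B)
    1/B-pos = ℚ.1/pos⇒pos B
  0<r : 0ℚ ℚ.< e ℚ.* ℚ.1/ B
  0<r = subst (ℚ._< e ℚ.* ℚ.1/ B) (ℚ.*-zeroˡ (ℚ.1/ B)) (ℚ.*-monoˡ-<-pos (ℚ.1/ B) 0<e)
  open ≡.≡-Reasoning
  B*r≡e : B ℚ.* (e ℚ.* ℚ.1/ B) ≡ e
  B*r≡e = begin
    B ℚ.* (e ℚ.* ℚ.1/ B)   ≡⟨ cong (B ℚ.*_) (ℚ.*-comm e (ℚ.1/ B)) ⟩
    B ℚ.* (ℚ.1/ B ℚ.* e)   ≡⟨ ℚ.*-assoc B (ℚ.1/ B) e ⟨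
    (B ℚ.* ℚ.1/ B) ℚ.* e   ≡⟨ cong (ℚ._* e) (ℚ.*-inverseʳ B) ⟩
    1ℚ ℚ.* e               ≡⟨ ℚ.*-identityˡ e ⟩
    e                      ∎

product-bound : ∀ {B r u v} → 0ℚ ℚ.< B → ℚ.∣ u ∣ ℚ.≤ B → ℚ.∣ v ∣ ℚ.< r →
                ℚ.∣ u ℚ.* v ∣ ℚ.< B ℚ.* r
product-bound {B} {r} {u} {v} 0<B u≤B v<r = begin-strict
  ℚ.∣ u ℚ.* v ∣          ≡⟨ ℚ.∣p*q∣≡∣p∣*∣q∣ u v ⟩
  ℚ.∣ u ∣ ℚ.* ℚ.∣ v ∣    ≤⟨ ℚ.*-monoʳ-≤-nonNeg ℚ.∣ v ∣ {{ℚ.∣-∣-nonNeg v}} u≤B ⟩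
  B ℚ.* ℚ.∣ v ∣          <⟨ ℚ.*-monoʳ-<-pos B {{ℚ.positive 0<B}} v<r ⟩
  B ℚ.* r                ∎
  where open ℚ.≤-Reasoning

product-close : ∀ {B C r s e} a b c d →
                0ℚ ℚ.< B → ℚ.∣ a ∣ ℚ.≤ B → ℚ.∣ c ℚ.- d ∣ ℚ.< r → B ℚ.* r ≡ ½ ℚ.* e →
                0ℚ ℚ.< C → ℚ.∣ d ∣ ℚ.≤ C → ℚ.∣ a ℚ.- b ∣ ℚ.< s → C ℚ.* s ≡ ½ ℚ.* e →
                ℚ.∣ a ℚ.* c ℚ.- b ℚ.* d ∣ ℚ.< e
product-close {B} {C} {r} {s} {e} a b c d 0<B a≤B c-d<r Br≡ 0<C d≤C a-b<s Cs≡ = begin-strict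
  ℚ.∣ a ℚ.* c ℚ.- b ℚ.* d ∣
    ≡⟨ cong ℚ.∣_∣ (regroup a b c d) ⟩
  ℚ.∣ a ℚ.* (c ℚ.- d) ℚ.+ d ℚ.* (a ℚ.- b) ∣
    ≤⟨ ℚ.∣p+q∣≤∣p∣+∣q∣ (a ℚ.* (c ℚ.- d)) (d ℚ.* (a ℚ.- b)) ⟩
  ℚ.∣ a ℚ.* (c ℚ.- d) ∣ ℚ.+ ℚ.∣ d ℚ.* (a ℚ.- b) ∣
    <⟨ ℚ.+-mono-<
         (product-bound {u = a} {v = c ℚ.- d} 0<B a≤B c-d<r)
         (product-bound {u = d} {v = a ℚ.- b} 0<C d≤C a-b<s) ⟩
  B ℚ.* r ℚ.+ C ℚ.* s
    ≡⟨ cong₂ ℚ._+_ Br≡ Cs≡ ⟩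
  ½ ℚ.* e ℚ.+ ½ ℚ.* e
    ≡⟨ half+half e ⟩
  e ∎
  where
  open ℚ.≤-Reasoning
  open +-*-Solver
  regroup : ∀ a b c d → a ℚ.* c ℚ.- b ℚ.* d ≡ a ℚ.* (c ℚ.- d) ℚ.+ d ℚ.* (a ℚ.- b)
  regroup = solve 4 (λ a b c d → a :* c :- b :* d := a :* (c :- d) :+ d :* (a :- b)) refl

_*ℝ_ : ℝ → ℝ → ℝ
(x *ℝ y) .seq n = seq x n ℚ.* seq y n
(x *ℝ y) .cauchy e 0<e =
  let (B , 0<B , M₁ , hB) = bounded x
      (C , 0<C , M₂ , hC) = bounded y
      (r , 0<r , Br≡)     = shrink B (½ ℚ.* e) 0<B (0<half e 0<e)
      (s , 0<s , Cs≡)     = shrink C (½ ℚ.* e) 0<C (0<half e 0<e)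
      (M₃ , hy)           = cauchy y r 0<r
      (M₄ , hx)           = cauchy x s 0<s
  in (M₁ ℕ.⊔ M₂) ℕ.⊔ (M₃ ℕ.⊔ M₄) , λ m n M≤m M≤n →
  let M₁₂≤m = ℕ.m⊔n≤o⇒m≤o (M₁ ℕ.⊔ M₂) (M₃ ℕ.⊔ M₄) M≤m
      M₃₄≤m = ℕ.m⊔n≤o⇒n≤o (M₁ ℕ.⊔ M₂) (M₃ ℕ.⊔ M₄) M≤m
      M₁₂≤n = ℕ.m⊔n≤o⇒m≤o (M₁ ℕ.⊔ M₂) (M₃ ℕ.⊔ M₄) M≤n
      M₃₄≤n = ℕ.m⊔n≤o⇒n≤o (M₁ ℕ.⊔ M₂) (M₃ ℕ.⊔ M₄) M≤n
  in product-close {B} {C} {r} {s} {e} (seq x m) (seq x n) (seq y m) (seq y n)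
       0<B (hB m (ℕ.m⊔n≤o⇒m≤o M₁ M₂ M₁₂≤m))
       (hy m n (ℕ.m⊔n≤o⇒m≤o M₃ M₄ M₃₄≤m) (ℕ.m⊔n≤o⇒m≤o M₃ M₄ M₃₄≤n)) Br≡
       0<C (hC n (ℕ.m⊔n≤o⇒n≤o M₁ M₂ M₁₂≤n))
       (hx m n (ℕ.m⊔n≤o⇒n≤o M₃ M₄ M₃₄≤m) (ℕ.m⊔n≤o⇒n≤o M₃ M₄ M₃₄≤n)) Cs≡

_^ℝ_ : ℝ → ℕ → ℝ
x ^ℝ zero  = 1ℝ
x ^ℝ suc k = x *ℝ x ^ℝ k

_/ℕ_ : ℝ → (k : ℕ) → .{{ℕ.NonZero k}} → ℝ
x /ℕ k = x *ℝ fromℚ (+ 1 ℚ./ k)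

------------------------------------------------------------------------
-- Quotients, roots and logarithms are partial operations on ℝ, so each is
-- given by its graph: the last argument is the value, which is unique up
-- to _≃ℝ_ and exists exactly when the operation is defined.

IsQuotient : ℝ → ℝ → ℝ → Set
IsQuotient x y q = (y <ℝ 0ℝ ⊎ 0ℝ <ℝ y) × q *ℝ y ≃ℝ x

-- The nonnegative k-th root; meaningful for k ≥ 1.
IsRoot : ℕ → ℝ → ℝ → Set
IsRoot k x r = 0ℝ ≤ℝ r × r ^ℝ k ≃ℝ x

ConvergesTo : (ℕ → ℝ) → ℝ → Set
ConvergesTo a x = ∀ e → 0ℝ <ℝ e →
  ∃[ M ] ∀ m → M ℕ.≤ m → x -ℝ e <ℝ a m × a m <ℝ x +ℝ e

expSum : ℝ → ℕ → ℝ
expSum x zero    = 0ℝ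
expSum x (suc m) = expSum x m +ℝ ((x ^ℝ m) /ℕ (m !)) {{m ℕ.!≢0}}

IsExp : ℝ → ℝ → Set
IsExp x y = ConvergesTo (expSum x) y

IsLog : ℝ → ℝ → Set
IsLog x y = IsExp y x

------------------------------------------------------------------------

module Cayley (G : Group 0ℓ 0ℓ) (S : Pred (Group.Carrier G) 0ℓ) where
  open Group G

  infix 4 _~_
  _~_ : Rel Carrier 0ℓ
  g ~ h = ¬ (g ≈ h) × (S (g ⁻¹ ∙ h) ⊎ S (h ⁻¹ ∙ g))

  data Walk : ℕ → Rel Carrier 0ℓ where
    done : ∀ {g h} → g ≈ h → Walk 0 g h
    step : ∀ {k g w h} → g ~ w → Walk k w h → Walk (suc k) g h

  Distance≤ : ℕ → Rel Carrier 0ℓ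
  Distance≤ d g h = ∃[ k ] k ℕ.≤ d × Walk k g h

  -- The diameter is the supremum in ℕ ∪ {∞} of all distances, so in a
  -- disconnected graph this fails for every d.
  Diameter≤ : ℕ → Set
  Diameter≤ d = ∀ g h → Distance≤ d g h

record FiniteGroup : Set₁ where
  field
    group : Group 0ℓ 0ℓ
    order : ℕ
    index : Inverse (Group.setoid group) (≡.setoid (Fin order))

  open Group group public
  open Inverse index public using (to; from; to-cong; from-cong; strictlyInverseˡ; strictlyInverseʳ)

  -- A subset of the group is represented by the set of its elements' indices.
  Member : Subset order → Pred Carrier 0ℓ
  Member S g = to g ∈ S

------------------------------------------------------------------------

ΣSubset : (N : ℕ) → (Subset N → ℝ) → ℝ
ΣSubset zero    f = f []
ΣSubset (suc N) f = ΣSubset N (λ S → f (inside ∷ S)) +ℝ ΣSubset N (λ S → f (outside ∷ S))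

-- Probability of the event E for the random subset of an N-element set
-- containing each element independently with probability p.
Pr : ℝ → (N : ℕ) (E : Pred (Subset N) 0ℓ) → Decidable E → ℝ
Pr p N E E? = ΣSubset N λ S →
  if does (E? S) then p ^ℝ ∣ S ∣ *ℝ (1ℝ -ℝ p) ^ℝ (N ℕ.∸ ∣ S ∣) else 0ℝ

module RandomCayley (G : FiniteGroup) where
  open FiniteGroup G

  module Γ (S : Subset order) = Cayley group (Member S)

  module _ (S : Subset order) where
    open Γ S

    _≈?_ : ∀ g h → Dec (g ≈ h)
    g ≈? h = map′
      (λ eq → Group.trans group (Group.sym group (strictlyInverseʳ g))
                (Group.trans group (from-cong eq) (strictlyInverseʳ h)))
      to-cong
      (to g Fin.≟ to h)

    _~?_ : ∀ g h → Dec (g ~ h)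
    g ~? h = ¬? (g ≈? h) ×-dec ((to (g ⁻¹ ∙ h) ∈? S) ⊎-dec (to (h ⁻¹ ∙ g) ∈? S))

    ~-resp : ∀ {g g′ h h′} → g ≈ g′ → h ≈ h′ → g ~ h → g′ ~ h′
    ~-resp {g} {g′} {h} {h′} p q (g≉h , e) =
      (λ g′≈h′ → g≉h (Group.trans group p (Group.trans group g′≈h′ (Group.sym group q)))) , edge e
      where
      edge : Member S (g ⁻¹ ∙ h) ⊎ Member S (h ⁻¹ ∙ g) → Member S (g′ ⁻¹ ∙ h′) ⊎ Member S (h′ ⁻¹ ∙ g′)
      edge (inj₁ s) = inj₁ (subst (_∈ S) (to-cong (∙-cong (⁻¹-cong p) q)) s)
      edge (inj₂ s) = inj₂ (subst (_∈ S) (to-cong (∙-cong (⁻¹-cong q) p)) s)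

    Walk-resp : ∀ {k g g′ h h′} → g ≈ g′ → h ≈ h′ → Walk k g h → Walk k g′ h′
    Walk-resp p q (done r) =
      done (Group.trans group (Group.sym group p) (Group.trans group r q))
    Walk-resp p q (step e w) = step (~-resp p (Group.refl group) e) (Walk-resp (Group.refl group) q w)

    walk? : ∀ k g h → Dec (Walk k g h)
    walk? zero    g h = map′ done (λ { (done p) → p }) (g ≈? h)
    walk? (suc k) g h = map′
      (λ (i , e , w) → step e w)
      (λ { (step {w = v} e w) →
           let v≈ = Group.sym group (strictlyInverseʳ v) in
           to v , ~-resp (Group.refl group) v≈ e , Walk-resp v≈ (Group.refl group) w })
      (Fin.any? λ i → (g ~? from i) ×-dec walk? k (from i) h)

    distance≤? : ∀ d g h → Dec (Distance≤ d g h)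
    distance≤? d g h = map′
      (λ (k , k<1+d , w) → k , ℕ.s≤s⁻¹ k<1+d , w)
      (λ (k , k≤d , w) → k , s≤s k≤d , w)
      (ℕ.anyUpTo? (λ k → walk? k g h) (suc d))

  diameter≤? : ∀ d → Decidable (λ S → Γ.Diameter≤ S d)
  diameter≤? d S = map′ extend (λ diam i j → diam (from i) (from j))
    (Fin.all? λ i → Fin.all? λ j → distance≤? S d (from i) (from j))
    where
    extend : (∀ i j → Γ.Distance≤ S d (from i) (from j)) → Γ.Diameter≤ S d
    extend all g h with all (to g) (to h)
    ... | k , k≤d , w = k , k≤d , Walk-resp S (strictlyInverseʳ g) (strictlyInverseʳ h) w

  Pr[diameter≤_] : ℕ → ℝ → ℝ
  Pr[diameter≤ d ] p = Pr p order (λ S → Γ.Diameter≤ S d) (diameter≤? d)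

------------------------------------------------------------------------

ℤ₂^-group : ℕ → Group 0ℓ 0ℓ
ℤ₂^-group n = record
  { Carrier = Vec Parity n
  ; _≈_     = _≡_
  ; _∙_     = zipWith ℙ._+_
  ; ε       = replicate n 0ℙ
  ; _⁻¹     = map id
  ; isGroup = record
    { isMonoid = record
      { isSemigroup = record
        { isMagma = record
          { isEquivalence = ≡.isEquivalence
          ; ∙-cong        = cong₂ (zipWith ℙ._+_)
          }
        ; assoc = Vec.zipWith-assoc ℙ.+-assoc
        }
      ; identity = Vec.zipWith-identityˡ ℙ.+-identityˡ , Vec.zipWith-identityʳ ℙ.+-identityʳ
      }
    ; inverse = Vec.zipWith-inverseˡ {⁻¹ = id} ℙ.p+p≡0ℙ , Vec.zipWith-inverseʳ {⁻¹ = id} ℙ.p+p≡0ℙ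
    ; ⁻¹-cong = cong (map id)
    }
  }

Parity↔Fin2 : Parity ↔ Fin 2
Parity↔Fin2 = mk↔ₛ′
  (λ { 0ℙ → Fin.zero ; 1ℙ → Fin.suc Fin.zero })
  (λ { Fin.zero → 0ℙ ; (Fin.suc Fin.zero) → 1ℙ })
  (λ { Fin.zero → refl ; (Fin.suc Fin.zero) → refl })
  (λ { 0ℙ → refl ; 1ℙ → refl })

Vec↔Fin : ∀ n → Vec Parity n ↔ Fin (2 ℕ.^ n)
Vec↔Fin zero    = mk↔ₛ′ (λ _ → Fin.zero) (λ _ → []) (λ { Fin.zero → refl ; (Fin.suc ()) }) (λ { [] → refl })
Vec↔Fin (suc n) =
  ↔-sym Fin.*↔× ↔-∘ ((Parity↔Fin2 ×-↔ Vec↔Fin n) ↔-∘ uncons↔)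
  where
  uncons↔ : Vec Parity (suc n) ↔ (Parity × Vec Parity n)
  uncons↔ = mk↔ₛ′ (λ { (x ∷ v) → x , v }) (uncurry _∷_) (λ _ → refl) (λ { (x ∷ v) → refl })

ℤ₂^ : ℕ → FiniteGroup
ℤ₂^ n = record { group = ℤ₂^-group n ; order = 2 ℕ.^ n ; index = Vec↔Fin n }

------------------------------------------------------------------------

-- D = (1 - γ) √(log N / (2 log log N))
record IsDegreeBound (γ : ℝ) (N : ℕ) (D : ℝ) : Set where
  field
    logN loglogN quotient root : ℝ
    isLogN     : IsLog (fromℕ N) logN
    isLoglogN  : IsLog logN loglogN
    isQuotient : IsQuotient logN (fromℕ 2 *ℝ loglogN) quotient
    isRoot     : IsRoot 2 quotient root
    isBound    : D ≃ℝ (1ℝ -ℝ γ) *ℝ root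

-- T is the d-th root of d! (1 - ε) log N / N^(d-1).
record IsThreshold (ε : ℝ) (N d : ℕ) .{{_ : ℕ.NonZero N}} (T : ℝ) : Set where
  field
    logN   : ℝ
    isLogN : IsLog (fromℕ N) logN
    isRoot : IsRoot d
      (fromℕ (d !) *ℝ (1ℝ -ℝ ε) *ℝ (logN /ℕ (N ℕ.^ (d ℕ.∸ 1))) {{ℕ.m^n≢0 N (d ℕ.∸ 1)}})
      T

{-# OPTIONS --safe #-}
module Submission where

-- Fix x ≠ 0 and let F x be the family of subsets B of G with |B| ≤ d and sum x.
-- A Cayley graph of ℤ₂ⁿ of diameter at most d has, for every x, a member of F x
-- inside its generating set S.  By correlation inequalities the probability that
-- S contains no member of F x is at least ∏ (1 - p^|B|), which by the choice of p
-- is at least of order log N / N, while Janson's inequality shows that these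
-- avoidance events are almost uncorrelated for distinct x: the total weight of
-- pairs of overlapping subsets is at most about (pN)^(2d-1) / N², which the bound
-- on d makes negligible.  Chebyshev's inequality for the number of avoided x
-- finishes the proof.  All operations on ℝ are pointwise on Cauchy sequences, so
-- the estimates are carried out for rational approximations, with exp replaced by
-- its partial sums.

open import Data.Bool.Base as Bool using (Bool; true; false; not; if_then_else_; _∧_)
open import Data.Fin.Base as Fin using (Fin)
import Data.Fin.Properties as Fin
open import Data.Fin.Subset using (Subset; inside; outside; ⊥; _∪_; _∈_) renaming (∣_∣ to ∥_∥)
import Data.Fin.Subset.Properties as Subset
import Data.Integer.Base as ℤ
import Data.Integer.Properties as ℤ
open import Data.List.Base as List using (List; []; _∷_; _++_; length; filter; allFin)
open import Data.List.Membership.Propositional using () renaming (_∈_ to _∈ˡ_)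
import Data.List.Membership.Propositional.Properties as Membership
import Data.List.Properties as List
open import Data.List.Relation.Unary.All as All using (All; []; _∷_)
import Data.List.Relation.Unary.All.Properties as All
open import Data.List.Relation.Unary.AllPairs using ([]; _∷_)
open import Data.List.Relation.Unary.Any using (here; there)
open import Data.List.Relation.Unary.Unique.Propositional using (Unique)
import Data.List.Relation.Unary.Unique.Propositional.Properties as Unique
open import Data.Nat.Base as ℕ using (ℕ; zero; suc; s≤s; z≤n; _!)
import Data.Nat.Properties as ℕ
open import Data.Parity.Base as ℙ using (Parity; 0ℙ)
import Data.Parity.Properties as ℙ
open import Data.Product.Base using (_×_; _,_; ∃-syntax; Σ-syntax; proj₁; proj₂)
open import Data.Rational.Base as ℚ using (ℚ; mkℚ; 0ℚ; 1ℚ; ½; _+_; _*_; _-_; -_; _≤_; _<_)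
open import Data.Rational.Properties as ℚ using (≤-trans; ≤-refl; ≤-reflexive; <⇒≤; *-zeroˡ; *-zeroʳ; *-identityˡ; *-identityʳ; +-identityˡ; +-identityʳ; *-assoc; *-comm; +-comm; +-mono-≤; ≤-total; 0≤∣p∣)
open import Data.Rational.Solver using (module +-*-Solver)
import Data.Rational.Unnormalised.Base as ℚᵘ
import Data.Rational.Unnormalised.Properties as ℚᵘ
open import Data.Sum.Base using (_⊎_; inj₁; inj₂)
open import Data.Unit.Base using (tt)
open import Data.Vec.Base as Vec using (Vec; []; _∷_; lookup; _[_]≔_)
import Data.Vec.Properties as Vec
open import Function.Base using (_∘_; id)
open import Relation.Binary.Definitions using (DecidableEquality)
open import Relation.Binary.PropositionalEquality using (_≡_; _≢_; refl; sym; trans; cong; cong₂; subst; subst₂; module ≡-Reasoning)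
open import Relation.Nullary using (Dec; yes; no; does)
open import Relation.Nullary.Decidable using (¬?; _×-dec_)
open import Relation.Nullary.Negation using (¬_; contradiction)
open import Relation.Unary using (Decidable)
open import Defs

open +-*-Solver using (solve; _:=_; _:+_; _:*_; _:-_; :-_; con)

-- A prescribed sum costs one element: all members of a subset but one determine the last. Hence the
-- d-subsets with sum x have total weight at most q (N q)^(d-1) / d!, which the threshold turns into
-- (1 - ε) log N; this is the origin of the d!. Two distinct overlapping subsets with prescribed
-- sums lose two elements, a common one and one lying in only one of them; this is the source of the
-- 1 / N². Half of ε pays for the smaller subsets and a factor 1 + 2q. The other half survives as a
-- factor 1 + ½ ε log N, so the mean number of avoided x is shown to grow linearly in n, which is
-- enough for Chebyshev. Logarithms and roots are known only by their defining equations, so even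
-- the sign of log log N must be extracted from a truncated series, and an approximation of p may be
-- negative. The bound on d enters as one inequality of natural numbers, (n²)^(d²) ≤ 32^(d²) 2ⁿ,
-- essentially (log N)^(2d²) ≤ N. One natural number c, chosen from ε and δ alone, measures all
-- relative errors; this makes the bound uniform in d and p.

-- Ordered-field arithmetic in ℚ

≤-by : ∀ {a b c} → 0ℚ ≤ c → b ≡ a + c → a ≤ b
≤-by {a} {b} {c} 0≤c b≡ = subst₂ _≤_ (+-identityʳ a) (sym b≡) (ℚ.+-monoʳ-≤ a 0≤c)

infixl 6 _⊞_
infixl 7 _⊠_

_⊞_ : ∀ {a b} → 0ℚ ≤ a → 0ℚ ≤ b → 0ℚ ≤ a + b
_⊞_ {a} {b} 0≤a 0≤b = ≤-trans 0≤a (≤-by 0≤b refl)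

_⊠_ : ∀ {a b} → 0ℚ ≤ a → 0ℚ ≤ b → 0ℚ ≤ a * b
_⊠_ {a} {b} 0≤a 0≤b = subst (_≤ a * b) (*-zeroʳ a) (ℚ.*-monoˡ-≤-nonNeg a {{ℚ.nonNegative 0≤a}} 0≤b)

-- Together with `≤-by`, `_⊞_` and `_⊠_` this gives certificates: the difference of the two sides of
-- a goal is written as a sum of products of slacks of known inequalities, and the ring solver
-- checks the identity.
slack : ∀ {a b} → a ≤ b → 0ℚ ≤ b - a
slack {a} {b} a≤b = subst (_≤ b - a) (ℚ.+-inverseʳ a) (ℚ.+-monoˡ-≤ (- a) a≤b)

≤-of-slack : ∀ {a b} → 0ℚ ≤ b - a → a ≤ b
≤-of-slack {a} {b} h = ≤-by h (solve 2 (λ a b → b := a :+ (b :- a)) refl a b)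

≤⇒≯ : ∀ {a b} → a ≤ b → ¬ (b < a)
≤⇒≯ a≤b b<a = ℚ.<-irrefl refl (ℚ.<-≤-trans b<a a≤b)

0≤1 : 0ℚ ≤ 1ℚ
0≤1 = ℚ.nonNegative⁻¹ 1ℚ

0≤½ : 0ℚ ≤ ½
0≤½ = ℚ.nonNegative⁻¹ ½

*-mono-≤ : ∀ {a b c d} → 0ℚ ≤ a → a ≤ b → 0ℚ ≤ c → c ≤ d → a * c ≤ b * d
*-mono-≤ {a} {b} {c} {d} 0≤a a≤b 0≤c c≤d =
  ≤-by (slack a≤b ⊠ ≤-trans 0≤c c≤d ⊞ 0≤a ⊠ slack c≤d)
    (solve 4 (λ a b c d → b :* d := a :* c :+ ((b :- a) :* d :+ a :* (d :- c))) refl a b c d)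

*-monoˡ : ∀ {a b c} → 0ℚ ≤ c → a ≤ b → c * a ≤ c * b
*-monoˡ {c = c} 0≤c = ℚ.*-monoˡ-≤-nonNeg c {{ℚ.nonNegative 0≤c}}

*-monoʳ : ∀ {a b c} → 0ℚ ≤ c → a ≤ b → a * c ≤ b * c
*-monoʳ {c = c} 0≤c = ℚ.*-monoʳ-≤-nonNeg c {{ℚ.nonNegative 0≤c}}

*-cancelˡ : ∀ {a b c} → 0ℚ < c → c * a ≤ c * b → a ≤ b
*-cancelˡ {c = c} 0<c = ℚ.*-cancelˡ-≤-pos c {{ℚ.positive 0<c}}

*-cancelʳ : ∀ {a b c} → 0ℚ < c → a * c ≤ b * c → a ≤ b
*-cancelʳ {c = c} 0<c = ℚ.*-cancelʳ-≤-pos c {{ℚ.positive 0<c}}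

*-pos : ∀ {a b} → 0ℚ < a → 0ℚ < b → 0ℚ < a * b
*-pos {a} {b} 0<a 0<b = subst (_< a * b) (*-zeroʳ a) (ℚ.*-monoʳ-<-pos a {{ℚ.positive 0<a}} 0<b)

square-nonneg : ∀ a → 0ℚ ≤ a * a
square-nonneg a with ≤-total 0ℚ a
... | inj₁ 0≤a = 0≤a ⊠ 0≤a
... | inj₂ a≤0 = subst (0ℚ ≤_) (solve 1 (λ a → (con 0ℚ :- a) :* (con 0ℚ :- a) := a :* a) refl a)
                   (slack a≤0 ⊠ slack a≤0)

-- Natural numbers as rationals

nat : ℕ → ℚ
nat n = ℤ.+ n ℚ./ 1

private
  toℚᵘ-nat : ∀ n → ℚ.toℚᵘ (nat n) ℚᵘ.≃ ℚᵘ.mkℚᵘ (ℤ.+ n) 0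
  toℚᵘ-nat n = ℚ.toℚᵘ-fromℚᵘ (ℚᵘ.mkℚᵘ (ℤ.+ n) 0)

nat-+ : ∀ m n → nat (m ℕ.+ n) ≡ nat m + nat n
nat-+ m n = ℚ.toℚᵘ-injective (begin
  ℚ.toℚᵘ (nat (m ℕ.+ n)) ≈⟨ toℚᵘ-nat (m ℕ.+ n) ⟩
  ℚᵘ.mkℚᵘ (ℤ.+ (m ℕ.+ n)) 0 ≈⟨ ℚᵘ.*≡* (cong (ℤ._* ℤ.+ 1) (cong₂ ℤ._+_ (sym (ℤ.*-identityʳ (ℤ.+ m))) (sym (ℤ.*-identityʳ (ℤ.+ n))))) ⟩
  ℚᵘ.mkℚᵘ (ℤ.+ m) 0 ℚᵘ.+ ℚᵘ.mkℚᵘ (ℤ.+ n) 0 ≈⟨ ℚᵘ.+-cong (toℚᵘ-nat m) (toℚᵘ-nat n) ⟨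
  ℚ.toℚᵘ (nat m) ℚᵘ.+ ℚ.toℚᵘ (nat n) ≈⟨ ℚ.toℚᵘ-homo-+ (nat m) (nat n) ⟨
  ℚ.toℚᵘ (nat m + nat n) ∎)
  where open ℚᵘ.≃-Reasoning

nat-* : ∀ m n → nat (m ℕ.* n) ≡ nat m * nat n
nat-* m n = ℚ.toℚᵘ-injective (begin
  ℚ.toℚᵘ (nat (m ℕ.* n)) ≈⟨ toℚᵘ-nat (m ℕ.* n) ⟩
  ℚᵘ.mkℚᵘ (ℤ.+ (m ℕ.* n)) 0 ≈⟨ ℚᵘ.*≡* (cong (ℤ._* ℤ.+ 1) (ℤ.pos-* m n)) ⟩
  ℚᵘ.mkℚᵘ (ℤ.+ m) 0 ℚᵘ.* ℚᵘ.mkℚᵘ (ℤ.+ n) 0 ≈⟨ ℚᵘ.*-cong (toℚᵘ-nat m) (toℚᵘ-nat n) ⟨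
  ℚ.toℚᵘ (nat m) ℚᵘ.* ℚ.toℚᵘ (nat n) ≈⟨ ℚ.toℚᵘ-homo-* (nat m) (nat n) ⟨
  ℚ.toℚᵘ (nat m * nat n) ∎)
  where open ℚᵘ.≃-Reasoning

nat-suc : ∀ n → nat (suc n) ≡ 1ℚ + nat n
nat-suc = nat-+ 1

recip : ∀ k → .{{ℕ.NonZero k}} → ℚ
recip k = ℤ.+ 1 ℚ./ k

recip-inverse : ∀ k .{{_ : ℕ.NonZero k}} → recip k * nat k ≡ 1ℚ
recip-inverse k@(suc k-1) = ℚ.toℚᵘ-injective (begin
  ℚ.toℚᵘ (recip k * nat k) ≈⟨ ℚ.toℚᵘ-homo-* (recip k) (nat k) ⟩
  ℚ.toℚᵘ (recip k) ℚᵘ.* ℚ.toℚᵘ (nat k) ≈⟨ ℚᵘ.*-cong (ℚ.toℚᵘ-fromℚᵘ (ℚᵘ.mkℚᵘ (ℤ.+ 1) k-1)) (toℚᵘ-nat k) ⟩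
  ℚᵘ.mkℚᵘ (ℤ.+ 1) k-1 ℚᵘ.* ℚᵘ.mkℚᵘ (ℤ.+ k) 0 ≈⟨ ℚᵘ.*≡* (trans (ℤ.*-identityʳ _) (cong (ℤ.+ 1 ℤ.*_) (sym (ℤ.*-identityʳ (ℤ.+ k))))) ⟩
  ℚᵘ.1ℚᵘ ∎)
  where open ℚᵘ.≃-Reasoning

0≤nat : ∀ n → 0ℚ ≤ nat n
0≤nat n = ℚ.nonNegative⁻¹ (nat n) {{ℚ.normalize-nonNeg n 1}}

nat-mono-≤ : ∀ {m n} → m ℕ.≤ n → nat m ≤ nat n
nat-mono-≤ {m} {n} m≤n = ≤-by (0≤nat (n ℕ.∸ m)) (trans (cong nat (sym (ℕ.m+[n∸m]≡n m≤n))) (nat-+ m (n ℕ.∸ m)))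

1+a≰a : ∀ {a} → ¬ (1ℚ + a ≤ a)
1+a≰a {a} h = contradiction (ℚ.positive⁻¹ 1ℚ)
  (≤⇒≯ (subst₂ _≤_ (solve 1 (λ a → (con 1ℚ :+ a) :- a := con 1ℚ) refl a) (ℚ.+-inverseʳ a) (ℚ.+-monoˡ-≤ (- a) h)))

nat-cancel-≤ : ∀ {m n} → nat m ≤ nat n → m ℕ.≤ n
nat-cancel-≤ {m} {n} h with m ℕ.≤? n
... | yes m≤n = m≤n
... | no m≰n = contradiction
  (≤-trans (subst (_≤ nat m) (nat-suc n) (nat-mono-≤ (ℕ.≰⇒> m≰n))) h) 1+a≰a

1≤nat : ∀ k .{{_ : ℕ.NonZero k}} → 1ℚ ≤ nat k
1≤nat (suc k) = nat-mono-≤ {1} {suc k} (s≤s z≤n)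

0<1 : 0ℚ < 1ℚ
0<1 = ℚ.positive⁻¹ 1ℚ

0<nat : ∀ k .{{_ : ℕ.NonZero k}} → 0ℚ < nat k
0<nat k = ℚ.<-≤-trans 0<1 (1≤nat k)

0<recip : ∀ k .{{_ : ℕ.NonZero k}} → 0ℚ < recip k
0<recip k = ℚ.positive⁻¹ (recip k) {{ℚ.normalize-pos 1 k}}

-- Powers

infixr 8 _^_
_^_ : ℚ → ℕ → ℚ
x ^ zero  = 1ℚ
x ^ suc k = x * x ^ k

0≤^ : ∀ {x} k → 0ℚ ≤ x → 0ℚ ≤ x ^ k
0≤^ zero    0≤x = 0≤1
0≤^ (suc k) 0≤x = 0≤x ⊠ 0≤^ k 0≤x

0<^ : ∀ {x} k → 0ℚ < x → 0ℚ < x ^ k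
0<^ zero    0<x = 0<1
0<^ (suc k) 0<x = *-pos 0<x (0<^ k 0<x)

^-mono : ∀ {x y} k → 0ℚ ≤ x → x ≤ y → x ^ k ≤ y ^ k
^-mono zero    0≤x x≤y = ≤-refl
^-mono (suc k) 0≤x x≤y = *-mono-≤ 0≤x x≤y (0≤^ k 0≤x) (^-mono k 0≤x x≤y)

1≤^ : ∀ {x} k → 1ℚ ≤ x → 1ℚ ≤ x ^ k
1≤^ zero    1≤x = ≤-refl
1≤^ (suc k) 1≤x = *-mono-≤ 0≤1 1≤x 0≤1 (1≤^ k 1≤x)

^≤1 : ∀ {x} k → 0ℚ ≤ x → x ≤ 1ℚ → x ^ k ≤ 1ℚ
^≤1 zero    0≤x x≤1 = ≤-refl
^≤1 (suc k) 0≤x x≤1 = *-mono-≤ 0≤x x≤1 (0≤^ k 0≤x) (^≤1 k 0≤x x≤1)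

^-+ : ∀ x a b → x ^ (a ℕ.+ b) ≡ x ^ a * x ^ b
^-+ x zero    b = sym (*-identityˡ _)
^-+ x (suc a) b = trans (cong (x *_) (^-+ x a b)) (sym (*-assoc x (x ^ a) (x ^ b)))

^-distrib-* : ∀ x y k → (x * y) ^ k ≡ x ^ k * y ^ k
^-distrib-* x y zero    = refl
^-distrib-* x y (suc k) = trans (cong ((x * y) *_) (^-distrib-* x y k))
  (solve 4 (λ x y u v → (x :* y) :* (u :* v) := (x :* u) :* (y :* v)) refl x y (x ^ k) (y ^ k))

1^ : ∀ k → 1ℚ ^ k ≡ 1ℚ
1^ zero    = refl
1^ (suc k) = trans (*-identityˡ _) (1^ k)

^-^ : ∀ x a b → (x ^ a) ^ b ≡ x ^ (a ℕ.* b)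
^-^ x zero    b = 1^ b
^-^ x (suc a) b = trans (^-distrib-* x (x ^ a) b) (trans (cong (x ^ b *_) (^-^ x a b)) (sym (^-+ x b (a ℕ.* b))))

^-monoʳ : ∀ {x a b} → 1ℚ ≤ x → a ℕ.≤ b → x ^ a ≤ x ^ b
^-monoʳ {x} {b = b} 1≤x z≤n = 1≤^ b 1≤x
^-monoʳ 1≤x (s≤s a≤b) = *-monoˡ (≤-trans 0≤1 1≤x) (^-monoʳ 1≤x a≤b)

^-antiʳ : ∀ {x a b} → 0ℚ ≤ x → x ≤ 1ℚ → a ℕ.≤ b → x ^ b ≤ x ^ a
^-antiʳ {b = b} 0≤x x≤1 z≤n       = ^≤1 b 0≤x x≤1
^-antiʳ         0≤x x≤1 (s≤s a≤b) = *-monoˡ 0≤x (^-antiʳ 0≤x x≤1 a≤b)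

^-mono-< : ∀ {x y} k → 0ℚ ≤ x → x < y → x ^ suc k < y ^ suc k
^-mono-< {x} {y} zero    0≤x x<y = subst₂ _<_ (sym (*-identityʳ x)) (sym (*-identityʳ y)) x<y
^-mono-< {x} {y} (suc k) 0≤x x<y = ℚ.≤-<-trans (*-monoˡ 0≤x (<⇒≤ (^-mono-< k 0≤x x<y)))
  (ℚ.*-monoˡ-<-pos (y ^ suc k) {{ℚ.positive (0<^ (suc k) (ℚ.≤-<-trans 0≤x x<y))}} x<y)

^-cancel-≤ : ∀ {x y} k .{{_ : ℕ.NonZero k}} → 0ℚ ≤ y → x ^ k ≤ y ^ k → x ≤ y
^-cancel-≤ {x} {y} (suc k) 0≤y h with ≤-total x y
... | inj₁ x≤y = x≤y
... | inj₂ y≤x = ℚ.≮⇒≥ (λ y<x → ≤⇒≯ h (^-mono-< k 0≤y y<x))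

nat-^ : ∀ m k → nat (m ℕ.^ k) ≡ nat m ^ k
nat-^ m zero    = refl
nat-^ m (suc k) = trans (nat-* m (m ℕ.^ k)) (cong (nat m *_) (nat-^ m k))

archimedean : ∀ q → ∃[ k ] q ≤ nat k
archimedean q@(mkℚ (ℤ.+ a) d _) = a , ℚ.toℚᵘ-cancel-≤ (ℚᵘ.≤-respʳ-≃ (ℚᵘ.≃-sym (ℚ.toℚᵘ-fromℚᵘ (ℚᵘ.mkℚᵘ (ℤ.+ a) 0)))
  (ℚᵘ.*≤* (subst₂ ℤ._≤_ (ℤ.pos-* a 1) (ℤ.pos-* a (suc d)) (ℤ.+≤+ (ℕ.*-monoʳ-≤ a {1} {suc d} (s≤s z≤n))))))
archimedean q@(mkℚ (ℤ.-[1+ a ]) d _) = 0 , ℚ.nonPositive⁻¹ q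

archimedean⁺ : ∀ q → ∃[ k ] q ≤ nat (suc k)
archimedean⁺ q with archimedean q
... | k , q≤k = k , ≤-trans q≤k (nat-mono-≤ (ℕ.n≤1+n k))

∣∣≤ : ∀ {a b} → a ≤ b → - a ≤ b → ℚ.∣ a ∣ ≤ b
∣∣≤ {a} {b} a≤b -a≤b with ℚ.∣p∣≡p∨∣p∣≡-p a
... | inj₁ eq = subst (_≤ b) (sym eq) a≤b
... | inj₂ eq = subst (_≤ b) (sym eq) -a≤b

≤∣∣ : ∀ a → a ≤ ℚ.∣ a ∣
≤∣∣ a with ≤-total 0ℚ a
... | inj₁ 0≤a = ≤-reflexive (sym (ℚ.0≤p⇒∣p∣≡p 0≤a))
... | inj₂ a≤0 = ≤-trans a≤0 (0≤∣p∣ a)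

-- Partial sums of the exponential series

term : ℕ → ℚ → ℚ
term k x = x ^ k * recip (k !) {{k ℕ.!≢0}}

E : ℕ → ℚ → ℚ
E zero    x = 0ℚ
E (suc m) x = E m x + term m x

recip-unique : ∀ {a} k .{{_ : ℕ.NonZero k}} → a * nat k ≡ 1ℚ → a ≡ recip k
recip-unique {a} k eq = begin
  a ≡⟨ *-identityʳ a ⟨
  a * 1ℚ ≡⟨ cong (a *_) (recip-inverse k) ⟨
  a * (recip k * nat k) ≡⟨ solve 3 (λ a r n → a :* (r :* n) := (a :* n) :* r) refl a (recip k) (nat k) ⟩
  (a * nat k) * recip k ≡⟨ cong (_* recip k) eq ⟩
  1ℚ * recip k ≡⟨ *-identityˡ (recip k) ⟩
  recip k ∎
  where open ≡-Reasoning

term-suc : ∀ k x → nat (suc k) * term (suc k) x ≡ x * term k x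
term-suc k x = begin
  nat (suc k) * ((x * x ^ k) * r′) ≡⟨ solve 4 (λ n x y r → n :* ((x :* y) :* r) := x :* (y :* (r :* n))) refl (nat (suc k)) x (x ^ k) r′ ⟩
  x * (x ^ k * (r′ * nat (suc k))) ≡⟨ cong (λ r → x * (x ^ k * r)) (recip-unique (k !) {{k ℕ.!≢0}} inverse) ⟩
  x * term k x ∎
  where
  open ≡-Reasoning
  r′ = recip (suc k !) {{suc k ℕ.!≢0}}
  inverse : r′ * nat (suc k) * nat (k !) ≡ 1ℚ
  inverse = trans (*-assoc r′ _ _) (trans (cong (r′ *_) (sym (nat-* (suc k) (k !)))) (recip-inverse (suc k !) {{suc k ℕ.!≢0}}))

0≤recip! : ∀ k → 0ℚ ≤ recip (k !) {{k ℕ.!≢0}}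
0≤recip! k = <⇒≤ (0<recip (k !) {{k ℕ.!≢0}})

0≤term : ∀ k {x} → 0ℚ ≤ x → 0ℚ ≤ term k x
0≤term k 0≤x = 0≤^ k 0≤x ⊠ 0≤recip! k

term-mono : ∀ k {x y} → 0ℚ ≤ x → x ≤ y → term k x ≤ term k y
term-mono k 0≤x x≤y = *-monoʳ (0≤recip! k) (^-mono k 0≤x x≤y)

0≤E : ∀ m {x} → 0ℚ ≤ x → 0ℚ ≤ E m x
0≤E zero    0≤x = ≤-refl
0≤E (suc m) 0≤x = 0≤E m 0≤x ⊞ 0≤term m 0≤x

E-mono : ∀ m {x y} → 0ℚ ≤ x → x ≤ y → E m x ≤ E m y
E-mono zero    0≤x x≤y = ≤-refl
E-mono (suc m) 0≤x x≤y = +-mono-≤ (E-mono m 0≤x x≤y) (term-mono m 0≤x x≤y)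

E-step : ∀ m {x} → 0ℚ ≤ x → E m x ≤ E (suc m) x
E-step m 0≤x = ≤-by (0≤term m 0≤x) refl

E-monoˡ : ∀ {m n x} → 0ℚ ≤ x → m ℕ.≤ n → E m x ≤ E n x
E-monoˡ {m} {x = x} 0≤x m≤n = go (ℕ.≤⇒≤′ m≤n)
  where
  go : ∀ {n} → m ℕ.≤′ n → E m x ≤ E n x
  go ℕ.≤′-refl     = ≤-refl
  go {suc n} (ℕ.≤′-step h) = ≤-trans (go h) (E-step n 0≤x)

cancel-suc : ∀ k {a b} → nat (suc k) * a ≤ nat (suc k) * b → a ≤ b
cancel-suc k = *-cancelˡ (0<nat (suc k))

-- `term k` is the derivative of `term (suc k)`, so this is the tangent bound of a convex function
-- at the left end point. Induction goes through `term-suc`, which trades the factor `nat (suc k)`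
-- for the argument.
term-increment-lower : ∀ k {x t} → 0ℚ ≤ x → 0ℚ ≤ t → term (suc k) x + t * term k x ≤ term (suc k) (x + t)
term-increment-lower k {x} {t} 0≤x 0≤t = cancel-suc k (≤-trans (≤-reflexive lhs) (≤-trans (main k) (≤-reflexive (sym (term-suc k (x + t))))))
  where
  lhs : nat (suc k) * (term (suc k) x + t * term k x) ≡ x * term k x + t * (nat (suc k) * term k x)
  lhs = trans (solve 4 (λ n a t b → n :* (a :+ t :* b) := n :* a :+ t :* (n :* b)) refl (nat (suc k)) (term (suc k) x) t (term k x))
              (cong (_+ t * (nat (suc k) * term k x)) (term-suc k x))
  main : ∀ k → x * term k x + t * (nat (suc k) * term k x) ≤ (x + t) * term k (x + t)
  main zero = ≤-reflexive (solve 2 (λ x t → x :* con 1ℚ :+ t :* (con 1ℚ :* con 1ℚ) := (x :+ t) :* con 1ℚ) refl x t)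
  main (suc k) = ≤-trans (≤-by {c = t * t * T₀} (0≤t ⊠ 0≤t ⊠ 0≤term k 0≤x) eq)
                   (*-monoˡ (0≤x ⊞ 0≤t) (term-increment-lower k 0≤x 0≤t))
    where
    T₀ = term k x
    T₁ = term (suc k) x
    eq : (x + t) * (T₁ + t * T₀) ≡ x * T₁ + t * (nat (suc (suc k)) * T₁) + t * t * T₀
    eq = trans (solve 4 (λ x t T₁ T₀ → (x :+ t) :* (T₁ :+ t :* T₀) := x :* T₁ :+ t :* (T₁ :+ x :* T₀) :+ t :* t :* T₀) refl x t T₁ T₀)
         (cong (λ z → x * T₁ + t * z + t * t * T₀)
           (trans (cong (T₁ +_) (sym (term-suc k x)))
             (trans (solve 2 (λ T n → T :+ n :* T := (con 1ℚ :+ n) :* T) refl T₁ (nat (suc k))) (cong (_* T₁) (sym (nat-suc (suc k)))))))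

-- The same tangent bound with the slope taken at the right end point.
term-increment-upper : ∀ k {x t} → 0ℚ ≤ x → 0ℚ ≤ t → term (suc k) (x + t) ≤ term (suc k) x + t * term k (x + t)
term-increment-upper k {x} {t} 0≤x 0≤t = cancel-suc k (≤-trans (≤-reflexive (term-suc k (x + t))) (≤-trans (main k) (≤-reflexive rhs)))
  where
  rhs : x * term k x + t * (nat (suc k) * term k (x + t)) ≡ nat (suc k) * (term (suc k) x + t * term k (x + t))
  rhs = trans (cong (_+ t * (nat (suc k) * term k (x + t))) (sym (term-suc k x)))
          (solve 4 (λ n a t b → n :* a :+ t :* (n :* b) := n :* (a :+ t :* b)) refl (nat (suc k)) (term (suc k) x) t (term k (x + t)))
  main : ∀ k → (x + t) * term k (x + t) ≤ x * term k x + t * (nat (suc k) * term k (x + t))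
  main zero = ≤-reflexive (solve 2 (λ x t → (x :+ t) :* con 1ℚ := x :* con 1ℚ :+ t :* (con 1ℚ :* con 1ℚ)) refl x t)
  main (suc k) = ≤-by (0≤x ⊠ slack (term-increment-upper k 0≤x 0≤t) ⊞ 0≤t ⊠ (0≤t ⊠ 0≤term k (0≤x ⊞ 0≤t))) eq
    where
    T₁ = term (suc k) x
    T₁′ = term (suc k) (x + t)
    T₀′ = term k (x + t)
    eq : x * T₁ + t * (nat (suc (suc k)) * T₁′) ≡ (x + t) * T₁′ + (x * (T₁ + t * T₀′ - T₁′) + t * (t * T₀′))
    eq = trans (cong (λ z → x * T₁ + t * z)
           (trans (cong (_* T₁′) (nat-suc (suc k))) (trans (solve 2 (λ T n → (con 1ℚ :+ n) :* T := T :+ n :* T) refl T₁′ (nat (suc k)))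
             (cong (T₁′ +_) (term-suc k (x + t))))))
         (solve 5 (λ x t T₁ T₁′ T₀′ → x :* T₁ :+ t :* (T₁′ :+ (x :+ t) :* T₀′) := (x :+ t) :* T₁′ :+ (x :* (T₁ :+ t :* T₀′ :- T₁′) :+ t :* (t :* T₀′))) refl x t T₁ T₁′ T₀′)

E-increment-lower : ∀ m {x t} → 0ℚ ≤ x → 0ℚ ≤ t → E (suc m) x + t * E m x ≤ E (suc m) (x + t)
E-increment-lower zero {x} {t} 0≤x 0≤t = ≤-reflexive (solve 1 (λ t → con 1ℚ :+ t :* con 0ℚ := con 1ℚ) refl t)
E-increment-lower (suc m) {x} {t} 0≤x 0≤t =
  subst (_≤ E (suc (suc m)) (x + t))
    (solve 5 (λ e e′ t a b → e :+ t :* e′ :+ (a :+ t :* b) := e :+ a :+ t :* (e′ :+ b)) refl (E (suc m) x) (E m x) t (term (suc m) x) (term m x))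
    (+-mono-≤ (E-increment-lower m 0≤x 0≤t) (term-increment-lower m 0≤x 0≤t))

E-increment-upper : ∀ m {x t} → 0ℚ ≤ x → 0ℚ ≤ t → E (suc m) (x + t) ≤ E (suc m) x + t * E m (x + t)
E-increment-upper zero {x} {t} 0≤x 0≤t = ≤-reflexive (solve 1 (λ t → con 1ℚ := con 1ℚ :+ t :* con 0ℚ) refl t)
E-increment-upper (suc m) {x} {t} 0≤x 0≤t =
  subst (E (suc (suc m)) (x + t) ≤_)
    (solve 5 (λ e e′ t a b → e :+ t :* e′ :+ (a :+ t :* b) := e :+ a :+ t :* (e′ :+ b)) refl (E (suc m) x) (E m (x + t)) t (term (suc m) x) (term m (x + t)))
    (+-mono-≤ (E-increment-upper m 0≤x 0≤t) (term-increment-upper m 0≤x 0≤t))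

-- Truncated form of exp x (1 + t) ≤ exp (x + t). The right side needs one more term because
-- differentiation lowers the number of terms by one.
E-shift-lower : ∀ m {x t} → 0ℚ ≤ x → 0ℚ ≤ t → E m x * (1ℚ + t) ≤ E (suc m) (x + t)
E-shift-lower m {x} {t} 0≤x 0≤t = ≤-trans
  (≤-by (0≤term m 0≤x) (solve 3 (λ e a t → e :+ a :+ t :* e := e :* (con 1ℚ :+ t) :+ a) refl (E m x) (term m x) t))
  (E-increment-lower m 0≤x 0≤t)

-- Truncated form of exp (x + t) (1 - t) ≤ exp x. No extra term is needed: replacing the derivative
-- by the longer sum only weakens the bound.
E-shift-upper : ∀ m {x t} → 0ℚ ≤ x → 0ℚ ≤ t → E m (x + t) * (1ℚ - t) ≤ E m x
E-shift-upper zero    {x} {t} 0≤x 0≤t = ≤-reflexive (*-zeroˡ (1ℚ - t))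
E-shift-upper (suc m) {x} {t} 0≤x 0≤t = ≤-by
  (slack (E-increment-upper m 0≤x 0≤t) ⊞ 0≤t ⊠ 0≤term m (0≤x ⊞ 0≤t))
  (solve 4 (λ e e′ a t → e := (e′ :+ a) :* (con 1ℚ :- t) :+ ((e :+ t :* e′ :- (e′ :+ a)) :+ t :* a)) refl (E (suc m) x) (E m (x + t)) (term m (x + t)) t)

E-at-0 : ∀ m → E (suc m) 0ℚ ≡ 1ℚ
E-at-0 zero    = refl
E-at-0 (suc m) = trans (cong₂ _+_ (E-at-0 m) (trans (cong (_* r) (*-zeroˡ (0ℚ ^ m))) (*-zeroˡ r))) (+-identityʳ 1ℚ)
  where r = recip (suc m !) {{suc m ℕ.!≢0}}

E-at-0≤1 : ∀ m → E m 0ℚ ≤ 1ℚ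
E-at-0≤1 zero    = 0≤1
E-at-0≤1 (suc m) = ≤-reflexive (E-at-0 m)

nat-suc-* : ∀ k t → nat k * t + t ≡ nat (suc k) * t
nat-suc-* k t = trans (solve 2 (λ n t → n :* t :+ t := (con 1ℚ :+ n) :* t) refl (nat k) t) (cong (_* t) (sym (nat-suc k)))

-- This lemma and `E*[1-t]^k≤1` enclose the exponential between (1 + t)ᵏ and (1 - t)⁻ᵏ. Every
-- comparison of `E` with powers of 2 or with powers of itself comes from this pair.
[1+t]^k≤E : ∀ k {t} → 0ℚ ≤ t → (1ℚ + t) ^ k ≤ E (suc k) (nat k * t)
[1+t]^k≤E zero    {t} 0≤t = ≤-refl
[1+t]^k≤E (suc k) {t} 0≤t = begin
  (1ℚ + t) * (1ℚ + t) ^ k ≡⟨ *-comm (1ℚ + t) _ ⟩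
  (1ℚ + t) ^ k * (1ℚ + t) ≤⟨ *-monoʳ (0≤1 ⊞ 0≤t) ([1+t]^k≤E k 0≤t) ⟩
  E (suc k) (nat k * t) * (1ℚ + t) ≤⟨ E-shift-lower (suc k) (0≤nat k ⊠ 0≤t) 0≤t ⟩
  E (suc (suc k)) (nat k * t + t) ≡⟨ cong (E (suc (suc k))) (nat-suc-* k t) ⟩
  E (suc (suc k)) (nat (suc k) * t) ∎
  where open ℚ.≤-Reasoning

E*[1-t]^k≤1 : ∀ m k {t} → 0ℚ ≤ t → t ≤ 1ℚ → E m (nat k * t) * (1ℚ - t) ^ k ≤ 1ℚ
E*[1-t]^k≤1 m zero {t} 0≤t t≤1 = subst (_≤ 1ℚ) (sym (trans (*-identityʳ _) (cong (E m) (*-zeroˡ t)))) (E-at-0≤1 m)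
E*[1-t]^k≤1 m (suc k) {t} 0≤t t≤1 = begin
  E m (nat (suc k) * t) * ((1ℚ - t) * (1ℚ - t) ^ k) ≡⟨ cong (λ z → E m z * ((1ℚ - t) * (1ℚ - t) ^ k)) (nat-suc-* k t) ⟨
  E m (nat k * t + t) * ((1ℚ - t) * (1ℚ - t) ^ k) ≡⟨ *-assoc (E m (nat k * t + t)) (1ℚ - t) ((1ℚ - t) ^ k) ⟨
  E m (nat k * t + t) * (1ℚ - t) * (1ℚ - t) ^ k ≤⟨ *-monoʳ (0≤^ k (slack t≤1)) (E-shift-upper m (0≤nat k ⊠ 0≤t) 0≤t) ⟩
  E m (nat k * t) * (1ℚ - t) ^ k ≤⟨ E*[1-t]^k≤1 m k 0≤t t≤1 ⟩
  1ℚ ∎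
  where open ℚ.≤-Reasoning

½≤1 : ½ ≤ 1ℚ
½≤1 = ≤-by 0≤½ refl

-- The case t = ½ of the preceding bound. It amounts to log 2 ≥ ½ and later yields the lower bound
-- on log N.
E-half : ∀ m k → E m (nat k * ½) ≤ nat (2 ℕ.^ k)
E-half m k = begin
  E m (nat k * ½) ≡⟨ *-identityʳ _ ⟨
  E m (nat k * ½) * 1ℚ ≡⟨ cong (E m (nat k * ½) *_) (trans (sym (^-distrib-* ½ (nat 2) k)) (1^ k)) ⟨
  E m (nat k * ½) * (½ ^ k * nat 2 ^ k) ≡⟨ *-assoc (E m (nat k * ½)) (½ ^ k) (nat 2 ^ k) ⟨
  E m (nat k * ½) * ½ ^ k * nat 2 ^ k ≤⟨ *-monoʳ (0≤^ k (0≤nat 2)) (E*[1-t]^k≤1 m k 0≤½ ½≤1) ⟩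
  1ℚ * nat 2 ^ k ≡⟨ *-identityˡ _ ⟩
  nat 2 ^ k ≡⟨ nat-^ 2 k ⟨
  nat (2 ℕ.^ k) ∎
  where open ℚ.≤-Reasoning

bernoulli : ∀ j {u} → 0ℚ ≤ u → u ≤ 1ℚ → 1ℚ - nat j * u ≤ (1ℚ - u) ^ j
bernoulli zero    {u} 0≤u u≤1 = ≤-reflexive (solve 1 (λ u → con 1ℚ :- con 0ℚ :* u := con 1ℚ) refl u)
bernoulli (suc j) {u} 0≤u u≤1 = ≤-trans
  (≤-by (0≤nat j ⊠ (0≤u ⊠ 0≤u))
    (trans (solve 2 (λ n u → (con 1ℚ :- u) :* (con 1ℚ :- n :* u) := con 1ℚ :- (con 1ℚ :+ n) :* u :+ n :* (u :* u)) refl (nat j) u)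
           (cong (λ z → 1ℚ - z * u + nat j * (u * u)) (sym (nat-suc j)))))
  (*-monoˡ (slack u≤1) (bernoulli j 0≤u u≤1))

-- With t = y / k, compare E m y ≤ (1 - t)⁻ᵏ with (1 + t)ᵏᴷ ≤ E _ (K y): the
-- quotient (1 - t²)ᵏᴷ is at least ½.
E-power : ∀ m K k .{{_ : ℕ.NonZero k}} {y} → 0ℚ ≤ y → y ≤ nat k → nat K * y * y ≤ ½ * nat k →
          E m y ^ K * ½ ≤ E (suc (k ℕ.* K)) (nat K * y)
E-power m K k {y} 0≤y y≤k Kyy≤ = begin
  A ^ K * ½ ≤⟨ *-monoˡ (0≤^ K (0≤E m 0≤y)) half ⟩
  A ^ K * (1ℚ - t * t) ^ (k ℕ.* K) ≡⟨ cong (λ z → A ^ K * z ^ (k ℕ.* K)) (solve 1 (λ t → con 1ℚ :- t :* t := (con 1ℚ :- t) :* (con 1ℚ :+ t)) refl t) ⟩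
  A ^ K * ((1ℚ - t) * (1ℚ + t)) ^ (k ℕ.* K) ≡⟨ cong (A ^ K *_) (^-distrib-* (1ℚ - t) (1ℚ + t) (k ℕ.* K)) ⟩
  A ^ K * ((1ℚ - t) ^ (k ℕ.* K) * (1ℚ + t) ^ (k ℕ.* K)) ≡⟨ *-assoc (A ^ K) ((1ℚ - t) ^ (k ℕ.* K)) ((1ℚ + t) ^ (k ℕ.* K)) ⟨
  A ^ K * (1ℚ - t) ^ (k ℕ.* K) * (1ℚ + t) ^ (k ℕ.* K) ≡⟨ cong (λ z → A ^ K * z * (1ℚ + t) ^ (k ℕ.* K)) (^-^ (1ℚ - t) k K) ⟨
  A ^ K * ((1ℚ - t) ^ k) ^ K * (1ℚ + t) ^ (k ℕ.* K) ≡⟨ cong (_* (1ℚ + t) ^ (k ℕ.* K)) (^-distrib-* A ((1ℚ - t) ^ k) K) ⟨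
  (A * (1ℚ - t) ^ k) ^ K * (1ℚ + t) ^ (k ℕ.* K) ≤⟨ *-monoʳ (0≤^ (k ℕ.* K) (0≤1 ⊞ 0≤t)) (^≤1 K (0≤E m 0≤y ⊠ 0≤^ k (slack t≤1)) base) ⟩
  1ℚ * (1ℚ + t) ^ (k ℕ.* K) ≡⟨ *-identityˡ _ ⟩
  (1ℚ + t) ^ (k ℕ.* K) ≤⟨ [1+t]^k≤E (k ℕ.* K) 0≤t ⟩
  E (suc (k ℕ.* K)) (nat (k ℕ.* K) * t) ≡⟨ cong (E (suc (k ℕ.* K))) kKt≡Ky ⟩
  E (suc (k ℕ.* K)) (nat K * y) ∎
  where
  open ℚ.≤-Reasoning
  A = E m y
  t = y * recip k
  0≤t : 0ℚ ≤ t
  0≤t = 0≤y ⊠ <⇒≤ (0<recip k)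
  kt≡y : nat k * t ≡ y
  kt≡y = trans (solve 3 (λ n y r → n :* (y :* r) := y :* (r :* n)) refl (nat k) y (recip k))
               (trans (cong (y *_) (recip-inverse k)) (*-identityʳ y))
  t≤1 : t ≤ 1ℚ
  t≤1 = *-cancelˡ (0<nat k) (subst₂ _≤_ (sym kt≡y) (sym (*-identityʳ (nat k))) y≤k)
  kKt≡Ky : nat (k ℕ.* K) * t ≡ nat K * y
  kKt≡Ky = trans (cong (_* t) (nat-* k K)) (trans (solve 3 (λ k K t → (k :* K) :* t := K :* (k :* t)) refl (nat k) (nat K) t) (cong (nat K *_) kt≡y))
  base : A * (1ℚ - t) ^ k ≤ 1ℚ
  base = subst (λ z → E m z * (1ℚ - t) ^ k ≤ 1ℚ) kt≡y (E*[1-t]^k≤1 m k 0≤t t≤1)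
  small : nat (k ℕ.* K) * (t * t) ≤ ½
  small = *-cancelˡ (0<nat k) (subst₂ _≤_ eq (*-comm ½ (nat k)) Kyy≤)
    where
    eq : nat K * y * y ≡ nat k * (nat (k ℕ.* K) * (t * t))
    eq = trans (cong (_* y) (sym kKt≡Ky)) (trans (cong (nat (k ℕ.* K) * t *_) (sym kt≡y))
      (solve 3 (λ k m t → m :* t :* (k :* t) := k :* (m :* (t :* t))) refl (nat k) (nat (k ℕ.* K)) t))
  half : ½ ≤ (1ℚ - t * t) ^ (k ℕ.* K)
  half = ≤-trans (≤-by (slack small) (solve 1 (λ m → con 1ℚ :- m := con ½ :+ (con ½ :- m)) refl (nat (k ℕ.* K) * (t * t))))
                   (bernoulli (k ℕ.* K) (0≤t ⊠ 0≤t) (*-mono-≤ 0≤t t≤1 0≤t t≤1))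

-- The exponential series at a negative argument

∣term∣≤ : ∀ k {x Y} → ℚ.∣ x ∣ ≤ Y → ℚ.∣ term k x ∣ ≤ term k Y
∣term∣≤ k {x} {Y} x≤Y = subst (_≤ term k Y)
  (sym (trans (ℚ.∣p*q∣≡∣p∣*∣q∣ (x ^ k) r) (cong₂ _*_ (abs-^ k) (ℚ.0≤p⇒∣p∣≡p (0≤recip! k)))))
  (term-mono k (0≤∣p∣ x) x≤Y)
  where
  r = recip (k !) {{k ℕ.!≢0}}
  abs-^ : ∀ k → ℚ.∣ x ^ k ∣ ≡ ℚ.∣ x ∣ ^ k
  abs-^ zero    = refl
  abs-^ (suc k) = trans (ℚ.∣p*q∣≡∣p∣*∣q∣ x (x ^ k)) (cong (ℚ.∣ x ∣ *_) (abs-^ k))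

prev : ℕ → ℚ → ℚ
prev zero    Y = 0ℚ
prev (suc k) Y = term k Y

-- The first-order Taylor remainder of `term (suc k)` at `x`, whose derivative is `term k`.
remainder : ℕ → ℚ → ℚ → ℚ
remainder k x s = term (suc k) (x + s) - term (suc k) x - s * term k x

remainder-suc : ∀ k x s → nat (suc (suc k)) * remainder (suc k) x s ≡ (x + s) * remainder k x s + s * s * term k x
remainder-suc k x s = begin
  n * (T₂′ - T₂ - s * T₁)
    ≡⟨ solve 5 (λ n a b s c → n :* (a :- b :- s :* c) := n :* a :- n :* b :- s :* (n :* c)) refl n T₂′ T₂ s T₁ ⟩
  n * T₂′ - n * T₂ - s * (n * T₁)
    ≡⟨ cong₂ (λ u v → u - v - s * (n * T₁)) (term-suc (suc k) (x + s)) (term-suc (suc k) x) ⟩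
  (x + s) * T₁′ - x * T₁ - s * (n * T₁)
    ≡⟨ cong (λ z → (x + s) * T₁′ - x * T₁ - s * z) (trans (cong (_* T₁) (nat-suc (suc k))) (trans (solve 2 (λ T n → (con 1ℚ :+ n) :* T := T :+ n :* T) refl T₁ (nat (suc k))) (cong (T₁ +_) (term-suc k x)))) ⟩
  (x + s) * T₁′ - x * T₁ - s * (T₁ + x * T₀)
    ≡⟨ solve 5 (λ x s T₁′ T₁ T₀ → (x :+ s) :* T₁′ :- x :* T₁ :- s :* (T₁ :+ x :* T₀) := (x :+ s) :* (T₁′ :- T₁ :- s :* T₀) :+ s :* s :* T₀) refl x s T₁′ T₁ T₀ ⟩
  (x + s) * (T₁′ - T₁ - s * T₀) + s * s * T₀ ∎
  where
  open ≡-Reasoning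
  n = nat (suc (suc k))
  T₀ = term k x
  T₁ = term (suc k) x
  T₂ = term (suc (suc k)) x
  T₁′ = term (suc k) (x + s)
  T₂′ = term (suc (suc k)) (x + s)

-- `prev k` is the second derivative of `term (suc k)`, and `Y` bounds the absolute value of both
-- end points. The factor ½ of the Lagrange form is given away.
remainder-bound : ∀ k {x s Y} → 0ℚ ≤ Y → ℚ.∣ x ∣ ≤ Y → ℚ.∣ x + s ∣ ≤ Y → ℚ.∣ remainder k x s ∣ ≤ s * s * prev k Y
remainder-bound zero {x} {s} {Y} 0≤Y x≤ x+s≤ = ≤-reflexive (trans (cong ℚ.∣_∣
  (solve 2 (λ x s → (x :+ s) :* con 1ℚ :* con 1ℚ :- x :* con 1ℚ :* con 1ℚ :- s :* con 1ℚ := con 0ℚ) refl x s))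
  (sym (*-zeroʳ (s * s))))
remainder-bound (suc k) {x} {s} {Y} 0≤Y x≤ x+s≤ = cancel-suc (suc k) (begin
  n * ℚ.∣ remainder (suc k) x s ∣ ≡⟨ cong (_* ℚ.∣ remainder (suc k) x s ∣) (ℚ.0≤p⇒∣p∣≡p (0≤nat (suc (suc k)))) ⟨
  ℚ.∣ n ∣ * ℚ.∣ remainder (suc k) x s ∣ ≡⟨ ℚ.∣p*q∣≡∣p∣*∣q∣ n (remainder (suc k) x s) ⟨
  ℚ.∣ n * remainder (suc k) x s ∣ ≡⟨ cong ℚ.∣_∣ (remainder-suc k x s) ⟩
  ℚ.∣ (x + s) * remainder k x s + s * s * term k x ∣ ≤⟨ ℚ.∣p+q∣≤∣p∣+∣q∣ ((x + s) * remainder k x s) (s * s * term k x) ⟩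
  ℚ.∣ (x + s) * remainder k x s ∣ + ℚ.∣ s * s * term k x ∣ ≡⟨ cong₂ _+_ (ℚ.∣p*q∣≡∣p∣*∣q∣ (x + s) (remainder k x s)) (trans (ℚ.∣p*q∣≡∣p∣*∣q∣ (s * s) (term k x)) (cong (_* ℚ.∣ term k x ∣) (ℚ.0≤p⇒∣p∣≡p 0≤ss))) ⟩
  ℚ.∣ x + s ∣ * ℚ.∣ remainder k x s ∣ + s * s * ℚ.∣ term k x ∣ ≤⟨ +-mono-≤ (*-mono-≤ (0≤∣p∣ (x + s)) x+s≤ (0≤∣p∣ (remainder k x s)) (remainder-bound k 0≤Y x≤ x+s≤)) (*-monoˡ 0≤ss (∣term∣≤ k x≤)) ⟩
  Y * (s * s * prev k Y) + s * s * term k Y ≤⟨ ≤-by (0≤ss ⊠ slack (prev-bound k)) eq ⟩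
  n * (s * s * term k Y) ∎)
  where
  open ℚ.≤-Reasoning
  n = nat (suc (suc k))
  0≤ss : 0ℚ ≤ s * s
  0≤ss = square-nonneg s
  prev-bound : ∀ k → Y * prev k Y ≤ nat (suc k) * term k Y
  prev-bound zero    = subst (_≤ nat 1 * term 0 Y) (sym (*-zeroʳ Y)) (0≤nat 1 ⊠ 0≤term 0 0≤Y)
  prev-bound (suc k) = subst (_≤ nat (suc (suc k)) * term (suc k) Y) (term-suc k Y)
    (*-monoʳ (0≤term (suc k) 0≤Y) (nat-mono-≤ (ℕ.n≤1+n (suc k))))
  eq : n * (s * s * term k Y) ≡ Y * (s * s * prev k Y) + s * s * term k Y + s * s * (nat (suc k) * term k Y - Y * prev k Y)
  eq = trans (cong (_* (s * s * term k Y)) (nat-suc (suc k)))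
    (solve 5 (λ n ss T Y P → (con 1ℚ :+ n) :* (ss :* T) := Y :* (ss :* P) :+ ss :* T :+ ss :* (n :* T :- Y :* P)) refl (nat (suc k)) (s * s) (term k Y) Y (prev k Y))

E-second-order : ∀ m {x s Y} → 0ℚ ≤ Y → ℚ.∣ x ∣ ≤ Y → ℚ.∣ x + s ∣ ≤ Y →
                 E (suc m) (x + s) ≤ E (suc m) x + s * E m x + s * s * E (ℕ.pred m) Y
E-second-order zero {x} {s} 0≤Y x≤ x+s≤ = ≤-reflexive
  (solve 1 (λ s → con 1ℚ := con 1ℚ :+ s :* con 0ℚ :+ s :* s :* con 0ℚ) refl s)
E-second-order (suc m) {x} {s} {Y} 0≤Y x≤ x+s≤ = ≤-trans
  (+-mono-≤ (E-second-order m 0≤Y x≤ x+s≤) (≤-by (slack (≤-trans (≤∣∣ (remainder m x s)) (remainder-bound m 0≤Y x≤ x+s≤)))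
    (solve 5 (λ a b s c p → b :+ s :* c :+ s :* s :* p := a :+ (s :* s :* p :- (a :- b :- s :* c))) refl (term (suc m) (x + s)) (term (suc m) x) s (term m x) (prev m Y))))
  (≤-reflexive (trans
    (solve 7 (λ e e′ s p b c q → e :+ s :* e′ :+ s :* s :* p :+ (b :+ s :* c :+ s :* s :* q) := e :+ b :+ s :* (e′ :+ c) :+ s :* s :* (p :+ q)) refl
      (E (suc m) x) (E m x) s (E (ℕ.pred m) Y) (term (suc m) x) (term m x) (prev m Y))
    (cong (λ z → E (suc m) x + term (suc m) x + s * (E m x + term m x) + s * s * z) (prev-sum m))))
  where
  prev-sum : ∀ m → E (ℕ.pred m) Y + prev m Y ≡ E m Y
  prev-sum zero    = refl
  prev-sum (suc m) = refl

term-odd : ∀ k {y} → 0ℚ ≤ y → term (suc (k ℕ.+ k)) (- y) ≤ 0ℚ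
term-odd k {y} 0≤y = ≤-of-slack (subst (0ℚ ≤_)
  (trans (cong (λ z → y * z * r) (sym (even k)))
    (solve 3 (λ y z r → y :* z :* r := con 0ℚ :- ((:- y) :* z) :* r) refl y ((- y) ^ (k ℕ.+ k)) r))
  (0≤y ⊠ 0≤^ k (0≤y ⊠ 0≤y) ⊠ 0≤recip! (suc (k ℕ.+ k))))
  where
  r = recip (suc (k ℕ.+ k) !) {{suc (k ℕ.+ k) ℕ.!≢0}}
  even : ∀ k → (- y) ^ (k ℕ.+ k) ≡ (y * y) ^ k
  even k = trans (^-+ (- y) k k) (trans (sym (^-distrib-* (- y) (- y) k))
    (cong (_^ k) (solve 1 (λ y → (:- y) :* (:- y) := y :* y) refl y)))

-- Stepping from 0 down to -y in k steps of length t = y / k: an even number of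
-- terms makes the truncation error favourable, and the k second-order errors
-- t² C add up to y² C / k.
E-negative-steps : ∀ j k-1 {y} → 0ℚ ≤ y → y + y * y * E (j ℕ.+ j) y ≤ nat (suc k-1) →
                   E (suc (suc (j ℕ.+ j))) (- y) ≤ nat 2
E-negative-steps j k-1 {y} 0≤y y+yyC≤k = ≤-trans (subst (λ z → E m′ (- z) ≤ 1ℚ + nat k * (t * t * C)) kt≡y (walk k ℕ.≤-refl)) (≤-by (slack last≤1)
    (solve 1 (λ a → con 1ℚ :+ con 1ℚ := con 1ℚ :+ a :+ (con 1ℚ :- a)) refl (nat k * (t * t * C))))
  where
  k = suc k-1
  m = suc (j ℕ.+ j)
  m′ = suc m
  C = E (j ℕ.+ j) y
  0≤C : 0ℚ ≤ C
  0≤C = 0≤E (j ℕ.+ j) 0≤y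
  t = y * recip k
  0≤t : 0ℚ ≤ t
  0≤t = 0≤y ⊠ <⇒≤ (0<recip k)
  kt≡y : nat k * t ≡ y
  kt≡y = trans (solve 3 (λ n y r → n :* (y :* r) := y :* (r :* n)) refl (nat k) y (recip k))
               (trans (cong (y *_) (recip-inverse k)) (*-identityʳ y))
  y≤k : y ≤ nat k
  y≤k = ≤-trans (≤-by (0≤y ⊠ 0≤y ⊠ 0≤C) refl) y+yyC≤k
  t≤1 : t ≤ 1ℚ
  t≤1 = *-cancelˡ (0<nat k) (subst₂ _≤_ (sym kt≡y) (sym (*-identityʳ (nat k))) y≤k)
  last≤1 : nat k * (t * t * C) ≤ 1ℚ
  last≤1 = *-cancelˡ (0<nat k) (subst₂ _≤_
    (trans (cong (λ z → z * z * C) (sym kt≡y)) (solve 3 (λ n t C → n :* t :* (n :* t) :* C := n :* (n :* (t :* t :* C))) refl (nat k) t C))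
    (sym (*-identityʳ (nat k)))
    (≤-trans (≤-by 0≤y (+-comm y (y * y * C))) y+yyC≤k))
  in-range : ∀ i → i ℕ.≤ k → ℚ.∣ - (nat i * t) ∣ ≤ y
  in-range i i≤k = subst (_≤ y) (sym (trans (ℚ.∣-p∣≡∣p∣ (nat i * t)) (ℚ.0≤p⇒∣p∣≡p (0≤nat i ⊠ 0≤t))))
    (subst (nat i * t ≤_) kt≡y (*-monoʳ 0≤t (nat-mono-≤ i≤k)))
  next : ∀ i → - (nat i * t) + - t ≡ - (nat (suc i) * t)
  next i = trans (sym (ℚ.neg-distrib-+ (nat i * t) t)) (cong -_ (nat-suc-* i t))
  walk : ∀ i → i ℕ.≤ k → E m′ (- (nat i * t)) ≤ 1ℚ + nat i * (t * t * C)
  walk zero    _   = ≤-reflexive (trans (cong (λ z → E m′ (- z)) (*-zeroˡ t)) (trans (E-at-0 m)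
    (solve 1 (λ a → con 1ℚ := con 1ℚ :+ con 0ℚ :* a) refl (t * t * C))))
  walk (suc i) i<k = ≤-trans (subst (λ z → E m′ z ≤ G + - t * E m x + - t * - t * C) (next i)
      (E-second-order m 0≤y (in-range i (ℕ.<⇒≤ i<k)) (subst (λ z → ℚ.∣ z ∣ ≤ y) (sym (next i)) (in-range (suc i) i<k))))
    (≤-by (slack t≤1 ⊠ slack (walk i (ℕ.<⇒≤ i<k)) ⊞ 0≤t ⊠ (0≤nat i ⊠ 0≤w) ⊞ 0≤t ⊠ slack (term-odd j (0≤nat i ⊠ 0≤t)) ⊞ 0≤t)
      (trans (cong (λ n → 1ℚ + n * (t * t * C)) (nat-suc i))
      (solve 5 (λ E₀ T t n C → con 1ℚ :+ (con 1ℚ :+ n) :* (t :* t :* C) :=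
                  (E₀ :+ T) :+ (:- t) :* E₀ :+ (:- t) :* (:- t) :* C :+
                  ((con 1ℚ :- t) :* (con 1ℚ :+ n :* (t :* t :* C) :- (E₀ :+ T)) :+ t :* (n :* (t :* t :* C)) :+ t :* (con 0ℚ :- T) :+ t)) refl
        (E m x) (term m x) t (nat i) C)))
    where
    x = - (nat i * t)
    G = E m′ x
    0≤w : 0ℚ ≤ t * t * C
    0≤w = 0≤t ⊠ 0≤t ⊠ 0≤C

-- Used contrapositively: a partial sum with an even number of terms whose value is at least 3 has a
-- nonnegative argument. This recovers the signs of log N and log log N, which their definitions do
-- not supply.
E-negative : ∀ j {y} → 0ℚ ≤ y → E (suc (suc (j ℕ.+ j))) (- y) ≤ nat 2
E-negative j {y} 0≤y = let k-1 , h = archimedean⁺ (y + y * y * E (j ℕ.+ j) y) in E-negative-steps j k-1 0≤y h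

-- Finite sums

∑ : ∀ {A : Set} → List A → (A → ℚ) → ℚ
∑ []       f = 0ℚ
∑ (x ∷ xs) f = f x + ∑ xs f

module _ {A : Set} where

  ∑-cong : ∀ (xs : List A) {f g} → (∀ x → f x ≡ g x) → ∑ xs f ≡ ∑ xs g
  ∑-cong []       f≡g = refl
  ∑-cong (x ∷ xs) f≡g = cong₂ _+_ (f≡g x) (∑-cong xs f≡g)

  ∑-mono : ∀ (xs : List A) {f g} → (∀ x → f x ≤ g x) → ∑ xs f ≤ ∑ xs g
  ∑-mono []       f≤g = ≤-refl
  ∑-mono (x ∷ xs) f≤g = +-mono-≤ (f≤g x) (∑-mono xs f≤g)

  0≤∑ : ∀ (xs : List A) {f} → (∀ x → 0ℚ ≤ f x) → 0ℚ ≤ ∑ xs f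
  0≤∑ []       0≤f = ≤-refl
  0≤∑ (x ∷ xs) 0≤f = 0≤f x ⊞ 0≤∑ xs 0≤f

  ∑-++ : ∀ (xs ys : List A) f → ∑ (xs ++ ys) f ≡ ∑ xs f + ∑ ys f
  ∑-++ []       ys f = sym (+-identityˡ _)
  ∑-++ (x ∷ xs) ys f = trans (cong (f x +_) (∑-++ xs ys f)) (sym (ℚ.+-assoc (f x) (∑ xs f) (∑ ys f)))

  ∑-map : ∀ {B : Set} (h : B → A) xs f → ∑ (List.map h xs) f ≡ ∑ xs (f ∘ h)
  ∑-map h []       f = refl
  ∑-map h (x ∷ xs) f = cong (f (h x) +_) (∑-map h xs f)

  ∑-zero : ∀ (xs : List A) → ∑ xs (λ _ → 0ℚ) ≡ 0ℚ
  ∑-zero []       = refl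
  ∑-zero (x ∷ xs) = trans (+-identityˡ _) (∑-zero xs)

  ∑-+ : ∀ (xs : List A) f g → ∑ xs (λ x → f x + g x) ≡ ∑ xs f + ∑ xs g
  ∑-+ []       f g = refl
  ∑-+ (x ∷ xs) f g = trans (cong ((f x + g x) +_) (∑-+ xs f g))
    (solve 4 (λ a b c d → a :+ b :+ (c :+ d) := a :+ c :+ (b :+ d)) refl (f x) (g x) (∑ xs f) (∑ xs g))

  ∑-*ˡ : ∀ c (xs : List A) f → ∑ xs (λ x → c * f x) ≡ c * ∑ xs f
  ∑-*ˡ c []       f = sym (*-zeroʳ c)
  ∑-*ˡ c (x ∷ xs) f = trans (cong (c * f x +_) (∑-*ˡ c xs f)) (sym (ℚ.*-distribˡ-+ c (f x) (∑ xs f)))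

  ∑-*ʳ : ∀ c (xs : List A) f → ∑ xs (λ x → f x * c) ≡ ∑ xs f * c
  ∑-*ʳ c xs f = trans (∑-cong xs (λ x → *-comm (f x) c)) (trans (∑-*ˡ c xs f) (*-comm c (∑ xs f)))

  ∑-const : ∀ (xs : List A) c → ∑ xs (λ _ → c) ≡ nat (length xs) * c
  ∑-const []       c = sym (*-zeroˡ c)
  ∑-const (x ∷ xs) c = trans (cong (c +_) (∑-const xs c))
    (trans (solve 2 (λ c n → c :+ n :* c := (con 1ℚ :+ n) :* c) refl c (nat (length xs))) (cong (_* c) (sym (nat-suc (length xs)))))

∑-swap : ∀ {A B : Set} (xs : List A) (ys : List B) (f : A → B → ℚ) →
         ∑ xs (λ x → ∑ ys (f x)) ≡ ∑ ys (λ y → ∑ xs (λ x → f x y))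
∑-swap []       ys f = sym (∑-zero ys)
∑-swap (x ∷ xs) ys f = trans (cong (∑ ys (f x) +_) (∑-swap xs ys f)) (sym (∑-+ ys (f x) (λ y → ∑ xs (λ x → f x y))))

⟦_⟧ : Bool → ℚ
⟦ true  ⟧ = 1ℚ
⟦ false ⟧ = 0ℚ

0≤⟦⟧ : ∀ b → 0ℚ ≤ ⟦ b ⟧
0≤⟦⟧ true  = 0≤1
0≤⟦⟧ false = ≤-refl

∑-filter : ∀ {A : Set} {P : A → Set} (P? : Decidable P) xs f →
           ∑ (filter P? xs) f ≡ ∑ xs (λ x → ⟦ does (P? x) ⟧ * f x)
∑-filter P? []       f = refl
∑-filter P? (x ∷ xs) f with does (P? x)
... | true  = cong₂ _+_ (sym (*-identityˡ (f x))) (∑-filter P? xs f)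
... | false = trans (∑-filter P? xs f) (trans (sym (+-identityˡ _)) (cong (_+ ∑ xs (λ x → ⟦ does (P? x) ⟧ * f x)) (sym (*-zeroˡ (f x)))))

-- Subsets as events

-- The indicator of `B ⊆ S`, valued in ℚ so that intersections of events become products and
-- expectations stay linear.
ι : ∀ {N} → Subset N → Subset N → ℚ
ι []            []            = 1ℚ
ι (inside  ∷ B) (inside  ∷ S) = ι B S
ι (inside  ∷ B) (outside ∷ S) = 0ℚ
ι (outside ∷ B) (_       ∷ S) = ι B S

0≤ι : ∀ {N} (B S : Subset N) → 0ℚ ≤ ι B S
0≤ι []            []            = 0≤1
0≤ι (inside  ∷ B) (inside  ∷ S) = 0≤ι B S
0≤ι (inside  ∷ B) (outside ∷ S) = ≤-refl
0≤ι (outside ∷ B) (_       ∷ S) = 0≤ι B S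

ι≤1 : ∀ {N} (B S : Subset N) → ι B S ≤ 1ℚ
ι≤1 []            []            = ≤-refl
ι≤1 (inside  ∷ B) (inside  ∷ S) = ι≤1 B S
ι≤1 (inside  ∷ B) (outside ∷ S) = 0≤1
ι≤1 (outside ∷ B) (_       ∷ S) = ι≤1 B S

ι-mono-∪ : ∀ {N} (B C S : Subset N) → ι B S ≤ ι B (C ∪ S)
ι-mono-∪ []            []            []            = ≤-refl
ι-mono-∪ (inside  ∷ B) (inside  ∷ C) (inside  ∷ S) = ι-mono-∪ B C S
ι-mono-∪ (inside  ∷ B) (inside  ∷ C) (outside ∷ S) = 0≤ι B (C ∪ S)
ι-mono-∪ (inside  ∷ B) (outside ∷ C) (inside  ∷ S) = ι-mono-∪ B C S
ι-mono-∪ (inside  ∷ B) (outside ∷ C) (outside ∷ S) = ≤-refl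
ι-mono-∪ (outside ∷ B) (_       ∷ C) (_       ∷ S) = ι-mono-∪ B C S

ι-* : ∀ {N} (B C S : Subset N) → ι B S * ι C S ≡ ι (B ∪ C) S
ι-* []            []            []            = refl
ι-* (inside  ∷ B) (inside  ∷ C) (inside  ∷ S) = ι-* B C S
ι-* (inside  ∷ B) (inside  ∷ C) (outside ∷ S) = refl
ι-* (inside  ∷ B) (outside ∷ C) (inside  ∷ S) = ι-* B C S
ι-* (inside  ∷ B) (outside ∷ C) (outside ∷ S) = *-zeroˡ (ι C S)
ι-* (outside ∷ B) (inside  ∷ C) (inside  ∷ S) = ι-* B C S
ι-* (outside ∷ B) (inside  ∷ C) (outside ∷ S) = *-zeroʳ (ι B S)
ι-* (outside ∷ B) (outside ∷ C) (_       ∷ S) = ι-* B C S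

meets : ∀ {N} → Subset N → Subset N → Bool
meets []            []            = false
meets (inside  ∷ B) (inside  ∷ C) = true
meets (inside  ∷ B) (outside ∷ C) = meets B C
meets (outside ∷ B) (_       ∷ C) = meets B C

ι-disjoint : ∀ {N} (B C S : Subset N) → meets B C ≡ false → ι C (B ∪ S) ≡ ι C S
ι-disjoint []            []            []            _ = refl
ι-disjoint (inside  ∷ B) (inside  ∷ C) (_       ∷ S) ()
ι-disjoint (inside  ∷ B) (outside ∷ C) (_       ∷ S) h = ι-disjoint B C S h
ι-disjoint (outside ∷ B) (inside  ∷ C) (inside  ∷ S) h = ι-disjoint B C S h
ι-disjoint (outside ∷ B) (inside  ∷ C) (outside ∷ S) h = refl
ι-disjoint (outside ∷ B) (outside ∷ C) (_       ∷ S) h = ι-disjoint B C S h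

avoid : ∀ {N} → List (Subset N) → Subset N → ℚ
avoid []       S = 1ℚ
avoid (B ∷ Bs) S = (1ℚ - ι B S) * avoid Bs S

module _ {N : ℕ} where

  0≤avoid : ∀ Bs (S : Subset N) → 0ℚ ≤ avoid Bs S
  0≤avoid []       S = 0≤1
  0≤avoid (B ∷ Bs) S = slack (ι≤1 B S) ⊠ 0≤avoid Bs S

  avoid≤1 : ∀ Bs (S : Subset N) → avoid Bs S ≤ 1ℚ
  avoid≤1 []       S = ≤-refl
  avoid≤1 (B ∷ Bs) S = *-mono-≤ (slack (ι≤1 B S)) (≤-by (0≤ι B S) (solve 1 (λ a → con 1ℚ := con 1ℚ :- a :+ a) refl (ι B S)))
                                (0≤avoid Bs S) (avoid≤1 Bs S)

  avoid-++ : ∀ Bs Cs (S : Subset N) → avoid (Bs ++ Cs) S ≡ avoid Bs S * avoid Cs S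
  avoid-++ []       Cs S = sym (*-identityˡ _)
  avoid-++ (B ∷ Bs) Cs S = trans (cong ((1ℚ - ι B S) *_) (avoid-++ Bs Cs S)) (sym (*-assoc (1ℚ - ι B S) (avoid Bs S) (avoid Cs S)))

  1-ι-anti-∪ : ∀ B C (S : Subset N) → 1ℚ - ι B (C ∪ S) ≤ 1ℚ - ι B S
  1-ι-anti-∪ B C S = ≤-by (slack (ι-mono-∪ B C S)) (solve 2 (λ a b → con 1ℚ :- a := con 1ℚ :- b :+ (b :- a)) refl (ι B S) (ι B (C ∪ S)))

  avoid-anti-∪ : ∀ Bs C (S : Subset N) → avoid Bs (C ∪ S) ≤ avoid Bs S
  avoid-anti-∪ []       C S = ≤-refl
  avoid-anti-∪ (B ∷ Bs) C S = *-mono-≤ (slack (ι≤1 B (C ∪ S))) (1-ι-anti-∪ B C S) (0≤avoid Bs (C ∪ S)) (avoid-anti-∪ Bs C S)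

  unless : Bool → ℚ → ℚ
  unless true  a = 1ℚ
  unless false a = 1ℚ - a

  -- Only members of Cs disjoint from B enter, so far B Cs is independent of the event B ⊆ S.
  far : Subset N → List (Subset N) → Subset N → ℚ
  far B []       S = 1ℚ
  far B (C ∷ Cs) S = unless (meets B C) (ι C S) * far B Cs S

  0≤unless : ∀ b C (S : Subset N) → 0ℚ ≤ unless b (ι C S)
  0≤unless true  C S = 0≤1
  0≤unless false C S = slack (ι≤1 C S)

  0≤far : ∀ B Cs S → 0ℚ ≤ far B Cs S
  0≤far B []       S = 0≤1
  0≤far B (C ∷ Cs) S = 0≤unless (meets B C) C S ⊠ 0≤far B Cs S

  far-anti-∪ : ∀ B Cs D S → far B Cs (D ∪ S) ≤ far B Cs S
  far-anti-∪ B []       D S = ≤-refl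
  far-anti-∪ B (C ∷ Cs) D S = *-mono-≤ (0≤unless (meets B C) C (D ∪ S)) (go (meets B C)) (0≤far B Cs (D ∪ S)) (far-anti-∪ B Cs D S)
    where
    go : ∀ b → unless b (ι C (D ∪ S)) ≤ unless b (ι C S)
    go true  = ≤-refl
    go false = 1-ι-anti-∪ C D S

  far-∪ : ∀ B Cs S → far B Cs (B ∪ S) ≡ far B Cs S
  far-∪ B []       S = refl
  far-∪ B (C ∷ Cs) S = cong₂ _*_ (go (meets B C) refl) (far-∪ B Cs S)
    where
    go : ∀ b → meets B C ≡ b → unless b (ι C (B ∪ S)) ≡ unless b (ι C S)
    go true  _ = refl
    go false h = cong (λ z → 1ℚ - z) (ι-disjoint B C S h)

  avoid≤far : ∀ B Cs S → avoid Cs S ≤ far B Cs S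
  avoid≤far B []       S = ≤-refl
  avoid≤far B (C ∷ Cs) S = *-mono-≤ (slack (ι≤1 C S)) (go (meets B C)) (0≤avoid Cs S) (avoid≤far B Cs S)
    where
    go : ∀ b → 1ℚ - ι C S ≤ unless b (ι C S)
    go true  = ≤-by (0≤ι C S) (solve 1 (λ a → con 1ℚ := con 1ℚ :- a :+ a) refl (ι C S))
    go false = ≤-refl

  hits : Subset N → List (Subset N) → Subset N → ℚ
  hits B Cs S = ∑ Cs (λ C → ⟦ meets B C ⟧ * ι C S)

  0≤hits : ∀ B Cs S → 0ℚ ≤ hits B Cs S
  0≤hits B Cs S = 0≤∑ Cs (λ C → 0≤⟦⟧ (meets B C) ⊠ 0≤ι C S)

  -- A union bound: if no member of `Cs` meeting `B` lies in `S` then both sides agree, and a single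
  -- such member already makes `1ℚ - hits B Cs S` nonpositive.
  far-hits : ∀ B Cs S → far B Cs S * (1ℚ - hits B Cs S) ≤ avoid Cs S
  far-hits B []       S = ≤-reflexive refl
  far-hits B (C ∷ Cs) S = go (meets B C)
    where
    a = ι C S
    f = far B Cs S
    h = hits B Cs S
    go : ∀ b → unless b a * f * (1ℚ - (⟦ b ⟧ * a + h)) ≤ (1ℚ - a) * avoid Cs S
    go true  = ≤-trans
      (≤-by (0≤far B Cs S ⊠ (0≤ι C S ⊠ 0≤hits B Cs S))
        (solve 3 (λ a f h → (con 1ℚ :- a) :* (f :* (con 1ℚ :- h)) := con 1ℚ :* f :* (con 1ℚ :- (con 1ℚ :* a :+ h)) :+ f :* (a :* h)) refl a f h))
      (*-monoˡ (slack (ι≤1 C S)) (far-hits B Cs S))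
    go false = ≤-trans (≤-reflexive
      (solve 3 (λ a f h → (con 1ℚ :- a) :* f :* (con 1ℚ :- (con 0ℚ :* a :+ h)) := (con 1ℚ :- a) :* (f :* (con 1ℚ :- h))) refl a f h))
      (*-monoˡ (slack (ι≤1 C S)) (far-hits B Cs S))

-- Expectation over the random subset

-- The recursion over coordinates makes the expectation a polynomial in `q` that is defined for
-- every rational `q`. Its continuity can then be used at approximations of p that fall outside the
-- unit interval.
expect : ∀ {N} → ℚ → (Subset N → ℚ) → ℚ
expect {zero}  q f = f []
expect {suc N} q f = q * expect q (λ S → f (inside ∷ S)) + (1ℚ - q) * expect q (λ S → f (outside ∷ S))

module RandomSubset (q : ℚ) (0≤q : 0ℚ ≤ q) (q≤1 : q ≤ 1ℚ) where

  𝔼 : ∀ {N} → (Subset N → ℚ) → ℚ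
  𝔼 = expect q

  𝔼-cong : ∀ {N} {f g : Subset N → ℚ} → (∀ S → f S ≡ g S) → 𝔼 f ≡ 𝔼 g
  𝔼-cong {zero}  h = h []
  𝔼-cong {suc N} h = cong₂ (λ a b → q * a + (1ℚ - q) * b) (𝔼-cong (λ S → h (inside ∷ S))) (𝔼-cong (λ S → h (outside ∷ S)))

  𝔼-mono : ∀ {N} {f g : Subset N → ℚ} → (∀ S → f S ≤ g S) → 𝔼 f ≤ 𝔼 g
  𝔼-mono {zero}  h = h []
  𝔼-mono {suc N} h = +-mono-≤ (*-monoˡ 0≤q (𝔼-mono (λ S → h (inside ∷ S)))) (*-monoˡ (slack q≤1) (𝔼-mono (λ S → h (outside ∷ S))))

  𝔼-const : ∀ {N} c → 𝔼 {N} (λ _ → c) ≡ c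
  𝔼-const {zero}  c = refl
  𝔼-const {suc N} c = trans (cong₂ (λ a b → q * a + (1ℚ - q) * b) (𝔼-const {N} c) (𝔼-const {N} c))
    (solve 2 (λ q c → q :* c :+ (con 1ℚ :- q) :* c := c) refl q c)

  𝔼-+ : ∀ {N} (f g : Subset N → ℚ) → 𝔼 (λ S → f S + g S) ≡ 𝔼 f + 𝔼 g
  𝔼-+ {zero}  f g = refl
  𝔼-+ {suc N} f g = trans
    (cong₂ (λ a b → q * a + (1ℚ - q) * b) (𝔼-+ (λ S → f (inside ∷ S)) (λ S → g (inside ∷ S))) (𝔼-+ (λ S → f (outside ∷ S)) (λ S → g (outside ∷ S))))
    (solve 5 (λ q a b c d → q :* (a :+ b) :+ (con 1ℚ :- q) :* (c :+ d) := q :* a :+ (con 1ℚ :- q) :* c :+ (q :* b :+ (con 1ℚ :- q) :* d)) refl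
      q (𝔼 (λ S → f (inside ∷ S))) (𝔼 (λ S → g (inside ∷ S))) (𝔼 (λ S → f (outside ∷ S))) (𝔼 (λ S → g (outside ∷ S))))

  𝔼-*ˡ : ∀ {N} c (f : Subset N → ℚ) → 𝔼 (λ S → c * f S) ≡ c * 𝔼 f
  𝔼-*ˡ {zero}  c f = refl
  𝔼-*ˡ {suc N} c f = trans
    (cong₂ (λ a b → q * a + (1ℚ - q) * b) (𝔼-*ˡ c (λ S → f (inside ∷ S))) (𝔼-*ˡ c (λ S → f (outside ∷ S))))
    (solve 4 (λ q c a b → q :* (c :* a) :+ (con 1ℚ :- q) :* (c :* b) := c :* (q :* a :+ (con 1ℚ :- q) :* b)) refl
      q c (𝔼 (λ S → f (inside ∷ S))) (𝔼 (λ S → f (outside ∷ S))))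

  𝔼-∑ : ∀ {N} {A : Set} (xs : List A) (f : A → Subset N → ℚ) → 𝔼 (λ S → ∑ xs (λ x → f x S)) ≡ ∑ xs (λ x → 𝔼 (f x))
  𝔼-∑ {N} []       f = 𝔼-const {N} 0ℚ
  𝔼-∑ (x ∷ xs) f = trans (𝔼-+ (f x) (λ S → ∑ xs (λ x → f x S))) (cong (𝔼 (f x) +_) (𝔼-∑ xs f))

  𝔼-- : ∀ {N} (f g : Subset N → ℚ) → 𝔼 (λ S → f S - g S) ≡ 𝔼 f - 𝔼 g
  𝔼-- f g = trans (𝔼-cong (λ S → solve 2 (λ a b → a :- b := a :+ con (- 1ℚ) :* b) refl (f S) (g S)))
    (trans (𝔼-+ f (λ S → - 1ℚ * g S)) (trans (cong (𝔼 f +_) (𝔼-*ˡ (- 1ℚ) g))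
      (solve 2 (λ a b → a :+ con (- 1ℚ) :* b := a :- b) refl (𝔼 f) (𝔼 g))))

  0≤𝔼 : ∀ {N} {f : Subset N → ℚ} → (∀ S → 0ℚ ≤ f S) → 0ℚ ≤ 𝔼 f
  0≤𝔼 {N} {f} h = subst (_≤ 𝔼 f) (𝔼-const {N} 0ℚ) (𝔼-mono h)

  -- Conditioning on `B ⊆ S`: the elements outside `B` keep their distribution, so the conditioned
  -- subset is `B ∪ S` for a fresh `S`.
  𝔼-superset : ∀ {N} (B : Subset N) f → 𝔼 (λ S → ι B S * f S) ≡ q ^ ∥ B ∥ * 𝔼 (λ S → f (B ∪ S))
  𝔼-superset []            f = refl
  𝔼-superset {suc N} (inside  ∷ B) f = trans
    (cong₂ (λ a b → q * a + (1ℚ - q) * b) (𝔼-superset B (λ S → f (inside ∷ S)))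
      (trans (𝔼-cong (λ S → *-zeroˡ (f (outside ∷ S)))) (𝔼-const {N} 0ℚ)))
    (solve 3 (λ q Q a → q :* (Q :* a) :+ (con 1ℚ :- q) :* con 0ℚ := q :* Q :* (q :* a :+ (con 1ℚ :- q) :* a)) refl
      q (q ^ ∥ B ∥) (𝔼 (λ S → f (inside ∷ (B ∪ S)))))
  𝔼-superset (outside ∷ B) f = trans
    (cong₂ (λ a b → q * a + (1ℚ - q) * b) (𝔼-superset B (λ S → f (inside ∷ S))) (𝔼-superset B (λ S → f (outside ∷ S))))
    (solve 4 (λ q Q a b → q :* (Q :* a) :+ (con 1ℚ :- q) :* (Q :* b) := Q :* (q :* a :+ (con 1ℚ :- q) :* b)) refl
      q (q ^ ∥ B ∥) (𝔼 (λ S → f (inside ∷ (B ∪ S)))) (𝔼 (λ S → f (outside ∷ (B ∪ S)))))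

  -- The Harris inequality for the increasing event `B ⊆ S` against a function that decreases when
  -- `B` is added.
  𝔼-superset-≤ : ∀ {N} (B : Subset N) {f} → (∀ S → f (B ∪ S) ≤ f S) → 𝔼 (λ S → ι B S * f S) ≤ q ^ ∥ B ∥ * 𝔼 f
  𝔼-superset-≤ B {f} h = subst (_≤ q ^ ∥ B ∥ * 𝔼 f) (sym (𝔼-superset B f)) (*-monoˡ (0≤^ ∥ B ∥ 0≤q) (𝔼-mono h))

  module _ {N : ℕ} where

    𝔸 : List (Subset N) → ℚ
    𝔸 Bs = 𝔼 (avoid Bs)

    0≤𝔸 : ∀ Bs → 0ℚ ≤ 𝔸 Bs
    0≤𝔸 Bs = 0≤𝔼 (0≤avoid Bs)

    -- The value that 𝔸 Bs would have if the events were independent.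
    indep : List (Subset N) → ℚ
    indep []       = 1ℚ
    indep (B ∷ Bs) = (1ℚ - q ^ ∥ B ∥) * indep Bs

    0≤indep : ∀ Bs → 0ℚ ≤ indep Bs
    0≤indep []       = 0≤1
    0≤indep (B ∷ Bs) = slack (^≤1 ∥ B ∥ 0≤q q≤1) ⊠ 0≤indep Bs

    indep-++ : ∀ Bs Cs → indep (Bs ++ Cs) ≡ indep Bs * indep Cs
    indep-++ []       Cs = sym (*-identityˡ _)
    indep-++ (B ∷ Bs) Cs = trans (cong ((1ℚ - q ^ ∥ B ∥) *_) (indep-++ Bs Cs)) (sym (*-assoc (1ℚ - q ^ ∥ B ∥) (indep Bs) (indep Cs)))

    𝔸-∷ : ∀ B Bs → 𝔸 (B ∷ Bs) ≡ 𝔸 Bs - 𝔼 (λ S → ι B S * avoid Bs S)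
    𝔸-∷ B Bs = trans (𝔼-cong (λ S → solve 2 (λ a b → (con 1ℚ :- a) :* b := b :- a :* b) refl (ι B S) (avoid Bs S)))
                     (𝔼-- (avoid Bs) (λ S → ι B S * avoid Bs S))

    -- Harris' inequality, one member at a time: avoiding `Bs` is a decreasing event, hence
    -- negatively correlated with `B ⊆ S`.
    indep≤𝔸 : ∀ Bs → indep Bs ≤ 𝔸 Bs
    indep≤𝔸 []       = ≤-reflexive (sym (𝔼-const {N} 1ℚ))
    indep≤𝔸 (B ∷ Bs) = ≤-trans (*-monoˡ (slack (^≤1 ∥ B ∥ 0≤q q≤1)) (indep≤𝔸 Bs))
      (≤-by (slack (𝔼-superset-≤ B (avoid-anti-∪ Bs B)))
        (trans (𝔸-∷ B Bs) (solve 3 (λ t a e → a :- e := (con 1ℚ :- t) :* a :+ (t :* a :- e)) refl (q ^ ∥ B ∥) (𝔸 Bs) (𝔼 (λ S → ι B S * avoid Bs S)))))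

    near : Subset N → List (Subset N) → ℚ
    near B Cs = ∑ Cs (λ C → ⟦ meets B C ⟧ * q ^ ∥ B ∪ C ∥)

    -- Janson's correlation sum over unordered pairs: each pair is counted at the member that comes
    -- first in the list.
    Δ : List (Subset N) → ℚ
    Δ []       = 0ℚ
    Δ (B ∷ Bs) = near B Bs + Δ Bs

    0≤near : ∀ B Cs → 0ℚ ≤ near B Cs
    0≤near B Cs = 0≤∑ Cs (λ C → 0≤⟦⟧ (meets B C) ⊠ 0≤^ ∥ B ∪ C ∥ 0≤q)

    0≤Δ : ∀ Bs → 0ℚ ≤ Δ Bs
    0≤Δ []       = ≤-refl
    0≤Δ (B ∷ Bs) = 0≤near B Bs ⊞ 0≤Δ Bs

    -- Given `B ⊆ S`, the event behind `far` keeps its probability, since it concerns only sets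
    -- disjoint from `B`. The members meeting `B` are removed by the union bound `far-hits`, and
    -- each costs at most `q ^ ∥ B ∪ C ∥` times the same expectation because `far` is decreasing.
    ι-far : ∀ B Cs → (q ^ ∥ B ∥ - near B Cs) * 𝔼 (far B Cs) ≤ 𝔼 (λ S → ι B S * avoid Cs S)
    ι-far B Cs = begin
      (q ^ ∥ B ∥ - near B Cs) * F
        ≡⟨ solve 3 (λ t s F → (t :- s) :* F := t :* F :- s :* F) refl (q ^ ∥ B ∥) (near B Cs) F ⟩
      q ^ ∥ B ∥ * F - near B Cs * F
        ≡⟨ cong (_- near B Cs * F) (trans (cong (q ^ ∥ B ∥ *_) (sym (𝔼-cong (far-∪ B Cs)))) (sym (𝔼-superset B (far B Cs)))) ⟩
      𝔼 (λ S → ι B S * far B Cs S) - near B Cs * F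
        ≤⟨ ℚ.+-monoʳ-≤ (𝔼 (λ S → ι B S * far B Cs S)) (ℚ.neg-antimono-≤ pairs) ⟩
      𝔼 (λ S → ι B S * far B Cs S) - 𝔼 (λ S → ι B S * (far B Cs S * hits B Cs S))
        ≡⟨ 𝔼-- (λ S → ι B S * far B Cs S) (λ S → ι B S * (far B Cs S * hits B Cs S)) ⟨
      𝔼 (λ S → ι B S * far B Cs S - ι B S * (far B Cs S * hits B Cs S))
        ≡⟨ 𝔼-cong (λ S → solve 3 (λ i f h → i :* f :- i :* (f :* h) := i :* (f :* (con 1ℚ :- h))) refl (ι B S) (far B Cs S) (hits B Cs S)) ⟩
      𝔼 (λ S → ι B S * (far B Cs S * (1ℚ - hits B Cs S)))
        ≤⟨ 𝔼-mono (λ S → *-monoˡ (0≤ι B S) (far-hits B Cs S)) ⟩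
      𝔼 (λ S → ι B S * avoid Cs S) ∎
      where
      open ℚ.≤-Reasoning
      F = 𝔼 (far B Cs)
      expand : ∀ S → ι B S * (far B Cs S * hits B Cs S) ≡ ∑ Cs (λ C → ⟦ meets B C ⟧ * (ι (B ∪ C) S * far B Cs S))
      expand S = trans (sym (*-assoc (ι B S) (far B Cs S) (hits B Cs S))) (trans (sym (∑-*ˡ (ι B S * far B Cs S) Cs (λ C → ⟦ meets B C ⟧ * ι C S)))
        (∑-cong Cs (λ C → trans
          (solve 4 (λ i f m j → i :* f :* (m :* j) := m :* (i :* j :* f)) refl (ι B S) (far B Cs S) ⟦ meets B C ⟧ (ι C S))
          (cong (λ z → ⟦ meets B C ⟧ * (z * far B Cs S)) (ι-* B C S)))))
      pairs : 𝔼 (λ S → ι B S * (far B Cs S * hits B Cs S)) ≤ near B Cs * F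
      pairs = begin
        𝔼 (λ S → ι B S * (far B Cs S * hits B Cs S))
          ≡⟨ 𝔼-cong expand ⟩
        𝔼 (λ S → ∑ Cs (λ C → ⟦ meets B C ⟧ * (ι (B ∪ C) S * far B Cs S)))
          ≡⟨ 𝔼-∑ Cs (λ C S → ⟦ meets B C ⟧ * (ι (B ∪ C) S * far B Cs S)) ⟩
        ∑ Cs (λ C → 𝔼 (λ S → ⟦ meets B C ⟧ * (ι (B ∪ C) S * far B Cs S)))
          ≡⟨ ∑-cong Cs (λ C → 𝔼-*ˡ ⟦ meets B C ⟧ (λ S → ι (B ∪ C) S * far B Cs S)) ⟩
        ∑ Cs (λ C → ⟦ meets B C ⟧ * 𝔼 (λ S → ι (B ∪ C) S * far B Cs S))
          ≤⟨ ∑-mono Cs (λ C → *-monoˡ (0≤⟦⟧ (meets B C)) (𝔼-superset-≤ (B ∪ C) (far-anti-∪ B Cs (B ∪ C)))) ⟩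
        ∑ Cs (λ C → ⟦ meets B C ⟧ * (q ^ ∥ B ∪ C ∥ * F))
          ≡⟨ ∑-cong Cs (λ C → sym (*-assoc ⟦ meets B C ⟧ (q ^ ∥ B ∪ C ∥) F)) ⟩
        ∑ Cs (λ C → ⟦ meets B C ⟧ * q ^ ∥ B ∪ C ∥ * F)
          ≡⟨ ∑-*ʳ F Cs (λ C → ⟦ meets B C ⟧ * q ^ ∥ B ∪ C ∥) ⟩
        near B Cs * F ∎

    janson-step : ∀ B Bs → 𝔸 (B ∷ Bs) ≤ 𝔸 Bs * (1ℚ - q ^ ∥ B ∥ + near B Bs)
    janson-step B Bs = ≤-by (slack key) (trans
      (solve 4 (λ a t s e → a :* (con 1ℚ :- t :+ s) := a :- e :+ (e :- (t :- s) :* a)) refl (𝔸 Bs) t s e)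
      (cong (_+ (e - (t - s) * 𝔸 Bs)) (sym (𝔸-∷ B Bs))))
      where
      t = q ^ ∥ B ∥
      s = near B Bs
      e = 𝔼 (λ S → ι B S * avoid Bs S)
      key : (t - s) * 𝔸 Bs ≤ e
      key = go (≤-total s t)
        where
        go : s ≤ t ⊎ t ≤ s → (t - s) * 𝔸 Bs ≤ e
        go (inj₁ s≤t) = ≤-trans (*-monoˡ (slack s≤t) (𝔼-mono (avoid≤far B Bs))) (ι-far B Bs)
        -- Here the left side is nonpositive. The split is needed because passing from `far` down to
        -- `avoid` requires a nonnegative factor `t - s`.
        go (inj₂ t≤s) = ≤-trans
          (≤-by (slack t≤s ⊠ 0≤𝔸 Bs) (solve 3 (λ t s a → con 0ℚ := (t :- s) :* a :+ (s :- t) :* a) refl t s (𝔸 Bs)))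
          (0≤𝔼 (λ S → 0≤ι B S ⊠ 0≤avoid Bs S))

    -- Janson's inequality, in a form that avoids the exponential function.
    janson : q ≤ ½ → ∀ Bs → All (λ B → 1 ℕ.≤ ∥ B ∥) Bs → 𝔸 Bs * (1ℚ - nat 2 * Δ Bs) ≤ indep Bs
    janson q≤½ []       []        = ≤-reflexive (cong (_* 1ℚ) (𝔼-const {N} 1ℚ))
    janson q≤½ (B ∷ Bs) (1≤B ∷ h) = go (≤-total (nat 2 * (s + D)) 1ℚ)
      where
      t = q ^ ∥ B ∥
      s = near B Bs
      D = Δ Bs
      t≤½ : t ≤ ½
      t≤½ = ≤-trans (^-antiʳ 0≤q q≤1 1≤B) (subst (_≤ ½) (sym (*-identityʳ q)) q≤½)
      0≤1-t : 0ℚ ≤ 1ℚ - t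
      0≤1-t = slack (^≤1 ∥ B ∥ 0≤q q≤1)
      go : nat 2 * (s + D) ≤ 1ℚ ⊎ 1ℚ ≤ nat 2 * (s + D) → 𝔸 (B ∷ Bs) * (1ℚ - nat 2 * (s + D)) ≤ (1ℚ - t) * indep Bs
      go (inj₂ 1≤) = ≤-trans
        (≤-by (0≤𝔸 (B ∷ Bs) ⊠ slack 1≤) (solve 2 (λ a d → con 0ℚ := a :* (con 1ℚ :- d) :+ a :* (d :- con 1ℚ)) refl (𝔸 (B ∷ Bs)) (nat 2 * (s + D))))
        (0≤1-t ⊠ 0≤indep Bs)
      -- Two elementary bounds carry the induction: 1 - t + s ≤ (1 - t)(1 + 2s), which uses t ≤ ½,
      -- and (1 + 2s)(1 - 2(s + D)) ≤ 1 - 2D.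
      go (inj₁ ≤1) = begin
        𝔸 (B ∷ Bs) * (1ℚ - nat 2 * (s + D))
          ≤⟨ *-monoʳ (slack ≤1) (janson-step B Bs) ⟩
        𝔸 Bs * (1ℚ - t + s) * (1ℚ - nat 2 * (s + D))
          ≤⟨ *-monoʳ (slack ≤1) (*-monoˡ (0≤𝔸 Bs) (≤-by (nonneg-2 ⊠ slack t≤½ ⊠ 0≤near B Bs)
               (solve 2 (λ t s → (con 1ℚ :- t) :* (con 1ℚ :+ con (nat 2) :* s) := con 1ℚ :- t :+ s :+ con (nat 2) :* (con ½ :- t) :* s) refl t s))) ⟩
        𝔸 Bs * ((1ℚ - t) * (1ℚ + nat 2 * s)) * (1ℚ - nat 2 * (s + D))
          ≤⟨ ≤-by (0≤𝔸 Bs ⊠ 0≤1-t ⊠ (nonneg-2 ⊠ 0≤near B Bs ⊠ (nonneg-2 ⊠ (0≤near B Bs ⊞ 0≤Δ Bs))))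
               (solve 4 (λ a t s D → (con 1ℚ :- t) :* (a :* (con 1ℚ :- con (nat 2) :* D)) :=
                  a :* ((con 1ℚ :- t) :* (con 1ℚ :+ con (nat 2) :* s)) :* (con 1ℚ :- con (nat 2) :* (s :+ D)) :+
                  a :* (con 1ℚ :- t) :* (con (nat 2) :* s :* (con (nat 2) :* (s :+ D)))) refl (𝔸 Bs) t s D) ⟩
        (1ℚ - t) * (𝔸 Bs * (1ℚ - nat 2 * D))
          ≤⟨ *-monoˡ 0≤1-t (janson q≤½ Bs h) ⟩
        (1ℚ - t) * indep Bs ∎
        where
        open ℚ.≤-Reasoning
        nonneg-2 = 0≤nat 2

-- The second moment method for nearly uncorrelated variables

∑-mono-All : ∀ {A : Set} {f g : A → ℚ} {xs} → All (λ x → f x ≤ g x) xs → ∑ xs f ≤ ∑ xs g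
∑-mono-All []       = ≤-refl
∑-mono-All (h ∷ hs) = +-mono-≤ h (∑-mono-All hs)

guard : ∀ b {x y} → 0ℚ ≤ y → (b ≡ true → x ≤ y) → ⟦ b ⟧ * x ≤ y
guard true  {x} {y} 0≤y h = subst (_≤ y) (sym (*-identityˡ x)) (h refl)
guard false {x} {y} 0≤y h = subst (_≤ y) (sym (*-zeroˡ x)) 0≤y

guard-cong : ∀ b {x y} → (b ≡ true → x ≡ y) → ⟦ b ⟧ * x ≡ ⟦ b ⟧ * y
guard-cong true          h = cong (1ℚ *_) (h refl)
guard-cong false {x} {y} h = trans (*-zeroˡ x) (sym (*-zeroˡ y))

module SecondMoment (q : ℚ) (0≤q : 0ℚ ≤ q) (q≤1 : q ≤ 1ℚ) where
  open RandomSubset q 0≤q q≤1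

  module _ {N : ℕ} {X : Set} (_≟_ : DecidableEquality X) (P : X → Set) (xs : List X) (xs⊆P : All P xs)
           (once : ∀ x → ∑ xs (λ y → ⟦ does (x ≟ y) ⟧) ≤ 1ℚ)
           (a : X → Subset N → ℚ) (0≤a : ∀ x S → 0ℚ ≤ a x S) (a≤1 : ∀ x S → a x S ≤ 1ℚ)
           (η : ℚ) (0≤η : 0ℚ ≤ η) (η≤¼ : η ≤ ½ * ½)
           (decorrelated : ∀ x y → P x → P y → x ≢ y →
              𝔼 (λ S → a x S * a y S) * (1ℚ - nat 2 * η) ≤ 𝔼 (a x) * 𝔼 (a y))
    where

    private
      c : ℚ
      c = 1ℚ - nat 2 * η

      ½≤c : ½ ≤ c
      ½≤c = ≤-by (0≤nat 2 ⊠ slack η≤¼) (solve 1 (λ η → con 1ℚ :- con (nat 2) :* η := con ½ :+ con (nat 2) :* (con (½ * ½) :- η)) refl η)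

      c≤1 : c ≤ 1ℚ
      c≤1 = ≤-by (0≤nat 2 ⊠ 0≤η) (solve 1 (λ z → con 1ℚ := con 1ℚ :- z :+ z) refl (nat 2 * η))

      0≤c : 0ℚ ≤ c
      0≤c = ≤-trans 0≤½ ½≤c

    count : Subset N → ℚ
    count S = ∑ xs (λ x → a x S)

    mean : ℚ
    mean = ∑ xs (λ x → 𝔼 (a x))

    0≤mean : 0ℚ ≤ mean
    0≤mean = 0≤∑ xs (λ x → 0≤𝔼 (0≤a x))

    -- The diagonal is not covered by `decorrelated`; there a² ≤ a replaces it, at the price of the
    -- extra summand.
    pair-moment : ∀ x y → P x → P y →
      𝔼 (λ S → a x S * a y S) * c ≤ 𝔼 (a x) * 𝔼 (a y) + ⟦ does (x ≟ y) ⟧ * 𝔼 (a x)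
    pair-moment x y px py = go (x ≟ y)
      where
      0≤xy : 0ℚ ≤ 𝔼 (a x) * 𝔼 (a y)
      0≤xy = 0≤𝔼 (0≤a x) ⊠ 0≤𝔼 (0≤a y)
      go : (x≟y : Dec (x ≡ y)) → 𝔼 (λ S → a x S * a y S) * c ≤ 𝔼 (a x) * 𝔼 (a y) + ⟦ does x≟y ⟧ * 𝔼 (a x)
      go (no x≢y)   = ≤-trans (decorrelated x y px py x≢y) (≤-by (≤-refl ⊠ 0≤𝔼 (0≤a x)) refl)
      go (yes refl) = begin
        𝔼 (λ S → a x S * a x S) * c ≤⟨ *-mono-≤ (0≤𝔼 (λ S → 0≤a x S ⊠ 0≤a x S)) (𝔼-mono (λ S → subst (a x S * a x S ≤_) (*-identityʳ (a x S)) (*-monoˡ (0≤a x S) (a≤1 x S)))) 0≤c c≤1 ⟩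
        𝔼 (a x) * 1ℚ ≤⟨ ≤-by 0≤xy (solve 2 (λ u v → u :* v :+ con 1ℚ :* u := u :* con 1ℚ :+ u :* v) refl (𝔼 (a x)) (𝔼 (a x))) ⟩
        𝔼 (a x) * 𝔼 (a x) + 1ℚ * 𝔼 (a x) ∎
        where open ℚ.≤-Reasoning

    square-expand : ∀ S → count S * count S ≡ ∑ xs (λ x → ∑ xs (λ y → a x S * a y S))
    square-expand S = trans (sym (∑-*ʳ (count S) xs (λ x → a x S))) (∑-cong xs (λ x → sym (∑-*ˡ (a x S) xs (λ y → a y S))))

    second-moment : 𝔼 (λ S → count S * count S) * c ≤ mean * mean + mean
    second-moment = begin
      𝔼 (λ S → count S * count S) * c
        ≡⟨ cong (_* c) (trans (𝔼-cong square-expand) (trans (𝔼-∑ xs (λ x S → ∑ xs (λ y → a x S * a y S))) (∑-cong xs (λ x → 𝔼-∑ xs (λ y S → a x S * a y S))))) ⟩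
      ∑ xs (λ x → ∑ xs (λ y → 𝔼 (λ S → a x S * a y S))) * c
        ≡⟨ trans (sym (∑-*ʳ c xs (λ x → ∑ xs (λ y → 𝔼 (λ S → a x S * a y S))))) (∑-cong xs (λ x → sym (∑-*ʳ c xs (λ y → 𝔼 (λ S → a x S * a y S))))) ⟩
      ∑ xs (λ x → ∑ xs (λ y → 𝔼 (λ S → a x S * a y S) * c))
        ≤⟨ ∑-mono-All (All.map (λ {x} px → ∑-mono-All (All.map (λ {y} py → pair-moment x y px py) xs⊆P)) xs⊆P) ⟩
      ∑ xs (λ x → ∑ xs (λ y → 𝔼 (a x) * 𝔼 (a y) + ⟦ does (x ≟ y) ⟧ * 𝔼 (a x)))
        ≡⟨ ∑-cong xs (λ x → trans (∑-+ xs (λ y → 𝔼 (a x) * 𝔼 (a y)) (λ y → ⟦ does (x ≟ y) ⟧ * 𝔼 (a x)))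
             (cong₂ _+_ (∑-*ˡ (𝔼 (a x)) xs (λ y → 𝔼 (a y))) (∑-*ʳ (𝔼 (a x)) xs (λ y → ⟦ does (x ≟ y) ⟧)))) ⟩
      ∑ xs (λ x → 𝔼 (a x) * mean + ∑ xs (λ y → ⟦ does (x ≟ y) ⟧) * 𝔼 (a x))
        ≤⟨ ∑-mono xs (λ x → ℚ.+-monoʳ-≤ (𝔼 (a x) * mean) (*-monoʳ (0≤𝔼 (0≤a x)) (once x))) ⟩
      ∑ xs (λ x → 𝔼 (a x) * mean + 1ℚ * 𝔼 (a x))
        ≡⟨ trans (∑-+ xs (λ x → 𝔼 (a x) * mean) (λ x → 1ℚ * 𝔼 (a x))) (cong₂ _+_ (∑-*ʳ mean xs (λ x → 𝔼 (a x))) (∑-cong xs (λ x → *-identityˡ (𝔼 (a x))))) ⟩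
      mean * mean + mean ∎
      where open ℚ.≤-Reasoning

    variance : 𝔼 (λ S → (count S - mean) * (count S - mean)) ≡ 𝔼 (λ S → count S * count S) - mean * mean
    variance = begin
      𝔼 (λ S → (count S - mean) * (count S - mean))
        ≡⟨ 𝔼-cong (λ S → solve 2 (λ X m → (X :- m) :* (X :- m) := X :* X :- (con (nat 2) :* m :* X :- m :* m)) refl (count S) mean) ⟩
      𝔼 (λ S → count S * count S - (nat 2 * mean * count S - mean * mean))
        ≡⟨ 𝔼-- (λ S → count S * count S) (λ S → nat 2 * mean * count S - mean * mean) ⟩
      V - 𝔼 (λ S → nat 2 * mean * count S - mean * mean)
        ≡⟨ cong (λ z → V - z) (trans (𝔼-- (λ S → nat 2 * mean * count S) (λ _ → mean * mean)) (cong₂ _-_ (trans (𝔼-*ˡ (nat 2 * mean) count) (cong (nat 2 * mean *_) (𝔼-∑ xs a))) (𝔼-const {N} (mean * mean)))) ⟩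
      V - (nat 2 * mean * mean - mean * mean)
        ≡⟨ solve 2 (λ V m → V :- (con (nat 2) :* m :* m :- m :* m) := V :- m :* m) refl V mean ⟩
      V - mean * mean ∎
      where
      open ≡-Reasoning
      V = 𝔼 (λ S → count S * count S)

    -- The event forces the count to 0, a deviation by the full mean, so its probability times mean²
    -- is at most the variance. Since c = 1 - 2η, multiplying by c bounds that variance by mean + 2
    -- η mean², and c ≥ ½ doubles both constants.
    chebyshev : (e : Subset N → Bool) → (∀ S → e S ≡ true → count S ≡ 0ℚ) → 0ℚ < mean →
                𝔼 (λ S → ⟦ e S ⟧) * mean ≤ nat 2 + nat 4 * η * mean
    chebyshev e vanish 0<mean = *-cancelʳ 0<mean (≤-by (0≤nat 2 ⊠ (slack step₁ ⊠ 0≤c ⊞ slack second-moment ⊞ slack ½≤c ⊠ (0≤𝔼 (λ S → 0≤⟦⟧ (e S)) ⊠ (0≤mean ⊠ 0≤mean))))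
      (solve 4 (λ p m V η → let c = con 1ℚ :- con (nat 2) :* η in
        (con (nat 2) :+ con (nat 4) :* η :* m) :* m :=
        p :* m :* m :+ con (nat 2) :* ((V :- m :* m :- p :* (m :* m)) :* c :+ (m :* m :+ m :- V :* c) :+ (c :- con ½) :* (p :* (m :* m)))) refl
        p mean V η))
      where
      p = 𝔼 (λ S → ⟦ e S ⟧)
      V = 𝔼 (λ S → count S * count S)
      pointwise : ∀ S → mean * mean * ⟦ e S ⟧ ≤ (count S - mean) * (count S - mean)
      pointwise S = subst (_≤ (count S - mean) * (count S - mean)) (*-comm ⟦ e S ⟧ (mean * mean))
        (guard (e S) (square-nonneg (count S - mean)) (λ eq → ≤-reflexive
          (trans (solve 1 (λ m → m :* m := (con 0ℚ :- m) :* (con 0ℚ :- m)) refl mean) (cong (λ z → (z - mean) * (z - mean)) (sym (vanish S eq))))))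
      step₁ : p * (mean * mean) ≤ V - mean * mean
      step₁ = subst₂ _≤_ (trans (𝔼-*ˡ (mean * mean) (λ S → ⟦ e S ⟧)) (*-comm (mean * mean) p)) variance (𝔼-mono pointwise)

-- Enumeration of subsets and removal of marked elements

∑-∙≤ : ∀ {A : Set} (xs : List A) f c → 0ℚ ≤ c → ∑ xs f ≤ 1ℚ → ∑ xs (λ x → f x * c) ≤ c
∑-∙≤ xs f c 0≤c h = subst₂ _≤_ (sym (∑-*ʳ c xs f)) (*-identityˡ c) (*-monoʳ 0≤c h)

-- Turns "at most one solution" into a bound on a sum of indicators, the form in which uniqueness
-- enters the counting arguments.
∑-unique : ∀ {A : Set} {xs : List A} → Unique xs → (e : A → Bool) →
           (∀ x y → e x ≡ true → e y ≡ true → x ≡ y) → ∑ xs (λ x → ⟦ e x ⟧) ≤ 1ℚ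
∑-unique []                       e inj = 0≤1
∑-unique {xs = x ∷ xs} (x∉ ∷ uxs) e inj = go (e x) refl
  where
  rest-zero : e x ≡ true → ∀ {ys} → All (x ≢_) ys → ∑ ys (λ y → ⟦ e y ⟧) ≡ 0ℚ
  rest-zero ex []                   = refl
  rest-zero ex {y ∷ ys} (x≢y ∷ hs) = trans (cong₂ _+_ (zero? (e y) refl) (rest-zero ex hs)) (+-identityˡ 0ℚ)
    where
    zero? : ∀ b → e y ≡ b → ⟦ b ⟧ ≡ 0ℚ
    zero? true  ey = contradiction (inj x y ex ey) x≢y
    zero? false _  = refl
  go : ∀ b → e x ≡ b → ⟦ b ⟧ + ∑ xs (λ x → ⟦ e x ⟧) ≤ 1ℚ
  go true  ex = ≤-reflexive (trans (cong (1ℚ +_) (rest-zero ex x∉)) (+-identityʳ 1ℚ))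
  go false _  = subst (_≤ 1ℚ) (sym (+-identityˡ _)) (∑-unique uxs e inj)

∑-allFin-suc : ∀ {N} (f : Fin (suc N) → ℚ) → ∑ (allFin (suc N)) f ≡ f Fin.zero + ∑ (allFin N) (f ∘ Fin.suc)
∑-allFin-suc {N} f = cong (f Fin.zero +_) (trans (cong (λ xs → ∑ xs f) (sym (List.map-tabulate id Fin.suc))) (∑-map Fin.suc (allFin N) f))

subsets : ∀ N → List (Subset N)
subsets zero    = [] ∷ []
subsets (suc N) = List.map (inside ∷_) (subsets N) ++ List.map (outside ∷_) (subsets N)

∑-subsets-suc : ∀ {N} (f : Subset (suc N) → ℚ) →
  ∑ (subsets (suc N)) f ≡ ∑ (subsets N) (λ B → f (inside ∷ B)) + ∑ (subsets N) (λ B → f (outside ∷ B))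
∑-subsets-suc {N} f = trans (∑-++ (List.map (inside ∷_) (subsets N)) (List.map (outside ∷_) (subsets N)) f)
  (cong₂ _+_ (∑-map (inside ∷_) (subsets N) f) (∑-map (outside ∷_) (subsets N) f))

subsets-unique : ∀ N → Unique (subsets N)
subsets-unique zero    = [] ∷ []
subsets-unique (suc N) = Unique.++⁺ (Unique.map⁺ Vec.∷-injectiveʳ (subsets-unique N)) (Unique.map⁺ Vec.∷-injectiveʳ (subsets-unique N)) disjoint
  where
  disjoint : ∀ {B} → ¬ (B ∈ˡ List.map (inside ∷_) (subsets N) × B ∈ˡ List.map (outside ∷_) (subsets N))
  disjoint (p , r) with Membership.∈-map⁻ (inside ∷_) p | Membership.∈-map⁻ (outside ∷_) r
  ... | _ , _ , refl | _ , _ , ()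

∈-subsets : ∀ {N} (B : Subset N) → B ∈ˡ subsets N
∈-subsets []            = here refl
∈-subsets (inside  ∷ B) = Membership.∈-++⁺ˡ (Membership.∈-map⁺ (inside ∷_) (∈-subsets B))
∈-subsets {suc N} (outside ∷ B) = Membership.∈-++⁺ʳ (List.map (inside ∷_) (subsets N)) (Membership.∈-map⁺ (outside ∷_) (∈-subsets B))

infixl 9 _⊕_
_⊕_ : ∀ {N} → Subset N → Fin N → Subset N
B ⊕ i = B [ i ]≔ inside

-- Reindexing along the bijection that adds `i` to the subsets not containing it.
∑-remove : ∀ {N} (i : Fin N) (φ : Subset N → ℚ) →
  ∑ (subsets N) (λ B → ⟦ lookup B i ⟧ * φ B) ≡ ∑ (subsets N) (λ B → ⟦ not (lookup B i) ⟧ * φ (B ⊕ i))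
∑-remove {suc N} Fin.zero φ = begin
  ∑ (subsets (suc N)) (λ B → ⟦ lookup B Fin.zero ⟧ * φ B)
    ≡⟨ ∑-subsets-suc {N} (λ B → ⟦ lookup B Fin.zero ⟧ * φ B) ⟩
  ∑ (subsets N) (λ B → 1ℚ * φ (inside ∷ B)) + ∑ (subsets N) (λ B → 0ℚ * φ (outside ∷ B))
    ≡⟨ cong (∑ (subsets N) (λ B → 1ℚ * φ (inside ∷ B)) +_) (∑-cong (subsets N) (λ B → trans (*-zeroˡ (φ (outside ∷ B))) (sym (*-zeroˡ (φ (inside ∷ B)))))) ⟩
  ∑ (subsets N) (λ B → 1ℚ * φ (inside ∷ B)) + ∑ (subsets N) (λ B → 0ℚ * φ (inside ∷ B))
    ≡⟨ +-comm (∑ (subsets N) (λ B → 1ℚ * φ (inside ∷ B))) _ ⟩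
  ∑ (subsets N) (λ B → 0ℚ * φ (inside ∷ B)) + ∑ (subsets N) (λ B → 1ℚ * φ (inside ∷ B))
    ≡⟨ ∑-subsets-suc {N} (λ B → ⟦ not (lookup B Fin.zero) ⟧ * φ (B ⊕ Fin.zero)) ⟨
  ∑ (subsets (suc N)) (λ B → ⟦ not (lookup B Fin.zero) ⟧ * φ (B ⊕ Fin.zero)) ∎
  where open ≡-Reasoning
∑-remove {suc N} (Fin.suc i) φ = trans (∑-subsets-suc {N} (λ B → ⟦ lookup B (Fin.suc i) ⟧ * φ B))
  (trans (cong₂ _+_ (∑-remove i (λ B → φ (inside ∷ B))) (∑-remove i (λ B → φ (outside ∷ B))))
         (sym (∑-subsets-suc {N} (λ B → ⟦ not (lookup B (Fin.suc i)) ⟧ * φ (B ⊕ Fin.suc i)))))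

∥∥-⊕ : ∀ {N} (B : Subset N) i → lookup B i ≡ false → ∥ B ⊕ i ∥ ≡ suc ∥ B ∥
∥∥-⊕ (outside ∷ B) Fin.zero    h = refl
∥∥-⊕ (inside  ∷ B) (Fin.suc i) h = cong suc (∥∥-⊕ B i h)
∥∥-⊕ (outside ∷ B) (Fin.suc i) h = ∥∥-⊕ B i h

∥∥-⊕-∪-⊕ : ∀ {N} (B C : Subset N) i → lookup B i ≡ false → lookup C i ≡ false → ∥ (B ⊕ i) ∪ (C ⊕ i) ∥ ≡ suc ∥ B ∪ C ∥
∥∥-⊕-∪-⊕ (outside ∷ B) (outside ∷ C) Fin.zero    h k = refl
∥∥-⊕-∪-⊕ (inside  ∷ B) (_       ∷ C) (Fin.suc i) h k = cong suc (∥∥-⊕-∪-⊕ B C i h k)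
∥∥-⊕-∪-⊕ (outside ∷ B) (inside  ∷ C) (Fin.suc i) h k = cong suc (∥∥-⊕-∪-⊕ B C i h k)
∥∥-⊕-∪-⊕ (outside ∷ B) (outside ∷ C) (Fin.suc i) h k = ∥∥-⊕-∪-⊕ B C i h k

∥∥-⊕-∪ : ∀ {N} (B C : Subset N) i → lookup B i ≡ false → lookup C i ≡ false → ∥ (B ⊕ i) ∪ C ∥ ≡ suc ∥ B ∪ C ∥
∥∥-⊕-∪ (outside ∷ B) (outside ∷ C) Fin.zero    h k = refl
∥∥-⊕-∪ (inside  ∷ B) (_       ∷ C) (Fin.suc i) h k = cong suc (∥∥-⊕-∪ B C i h k)
∥∥-⊕-∪ (outside ∷ B) (inside  ∷ C) (Fin.suc i) h k = cong suc (∥∥-⊕-∪ B C i h k)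
∥∥-⊕-∪ (outside ∷ B) (outside ∷ C) (Fin.suc i) h k = ∥∥-⊕-∪ B C i h k

∑-lookup : ∀ {N} (B : Subset N) → ∑ (allFin N) (λ i → ⟦ lookup B i ⟧) ≡ nat ∥ B ∥
∑-lookup []            = refl
∑-lookup (inside  ∷ B) = trans (∑-allFin-suc (λ i → ⟦ lookup (inside ∷ B) i ⟧)) (trans (cong (1ℚ +_) (∑-lookup B)) (sym (nat-suc ∥ B ∥)))
∑-lookup (outside ∷ B) = trans (∑-allFin-suc (λ i → ⟦ lookup (outside ∷ B) i ⟧)) (trans (cong (0ℚ +_) (∑-lookup B)) (+-identityˡ _))

meets≤∑ : ∀ {N} (B C : Subset N) → ⟦ meets B C ⟧ ≤ ∑ (allFin N) (λ i → ⟦ lookup B i ⟧ * ⟦ lookup C i ⟧)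
meets≤∑ []            []            = ≤-refl
meets≤∑ {suc N} (inside ∷ B) (inside ∷ C) = subst (1ℚ ≤_) (sym (∑-allFin-suc (λ i → ⟦ lookup (inside ∷ B) i ⟧ * ⟦ lookup (inside ∷ C) i ⟧)))
  (≤-by (0≤∑ (allFin N) (λ i → 0≤⟦⟧ (lookup B i) ⊠ 0≤⟦⟧ (lookup C i))) refl)
meets≤∑ (inside ∷ B) (outside ∷ C) = subst (⟦ meets B C ⟧ ≤_) (sym (trans (∑-allFin-suc (λ i → ⟦ lookup (inside ∷ B) i ⟧ * ⟦ lookup (outside ∷ C) i ⟧)) (+-identityˡ _))) (meets≤∑ B C)
meets≤∑ (outside ∷ B) (c ∷ C) = subst (⟦ meets B C ⟧ ≤_) (sym (trans (∑-allFin-suc (λ i → ⟦ lookup (outside ∷ B) i ⟧ * ⟦ lookup (c ∷ C) i ⟧))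
  (trans (cong (_+ ∑ (allFin _) (λ i → ⟦ lookup B i ⟧ * ⟦ lookup C i ⟧)) (*-zeroˡ ⟦ c ⟧)) (+-identityˡ _)))) (meets≤∑ B C)

differs : ∀ {N} → Subset N → Subset N → Bool
differs []            []            = false
differs (inside  ∷ B) (inside  ∷ C) = differs B C
differs (inside  ∷ B) (outside ∷ C) = true
differs (outside ∷ B) (inside  ∷ C) = true
differs (outside ∷ B) (outside ∷ C) = differs B C

≢⇒differs : ∀ {N} (B C : Subset N) → B ≢ C → differs B C ≡ true
≢⇒differs []            []            B≢C = contradiction refl B≢C
≢⇒differs (inside  ∷ B) (inside  ∷ C) B≢C = ≢⇒differs B C (B≢C ∘ cong (inside ∷_))
≢⇒differs (inside  ∷ B) (outside ∷ C) B≢C = refl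
≢⇒differs (outside ∷ B) (inside  ∷ C) B≢C = refl
≢⇒differs (outside ∷ B) (outside ∷ C) B≢C = ≢⇒differs B C (B≢C ∘ cong (outside ∷_))

in-exactly-one : ∀ {N} → Subset N → Subset N → Fin N → ℚ
in-exactly-one B C j = ⟦ lookup B j ⟧ * ⟦ not (lookup C j) ⟧ + ⟦ lookup C j ⟧ * ⟦ not (lookup B j) ⟧

0≤in-exactly-one : ∀ {N} (B C : Subset N) j → 0ℚ ≤ in-exactly-one B C j
0≤in-exactly-one B C j = 0≤⟦⟧ (lookup B j) ⊠ 0≤⟦⟧ (not (lookup C j)) ⊞ 0≤⟦⟧ (lookup C j) ⊠ 0≤⟦⟧ (not (lookup B j))

differs≤∑ : ∀ {N} (B C : Subset N) → ⟦ differs B C ⟧ ≤ ∑ (allFin N) (in-exactly-one B C)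
differs≤∑ []      []      = ≤-refl
differs≤∑ {suc N} (b ∷ B) (c ∷ C) = subst (⟦ differs (b ∷ B) (c ∷ C) ⟧ ≤_) (sym (∑-allFin-suc (in-exactly-one (b ∷ B) (c ∷ C)))) (go b c)
  where
  0≤rest : 0ℚ ≤ ∑ (allFin N) (in-exactly-one B C)
  0≤rest = 0≤∑ (allFin N) (0≤in-exactly-one B C)
  go : ∀ b c → ⟦ differs (b ∷ B) (c ∷ C) ⟧ ≤ ⟦ b ⟧ * ⟦ not c ⟧ + ⟦ c ⟧ * ⟦ not b ⟧ + ∑ (allFin N) (in-exactly-one B C)
  go inside  inside  = subst (⟦ differs B C ⟧ ≤_) (sym (+-identityˡ _)) (differs≤∑ B C)
  go inside  outside = ≤-by 0≤rest refl
  go outside inside  = ≤-by 0≤rest refl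
  go outside outside = subst (⟦ differs B C ⟧ ≤_) (sym (+-identityˡ _)) (differs≤∑ B C)

-- The strict inequality is what matters: two overlapping sets of size at most d have a union of
-- size at most 2d - 1.
∥∪∥<∥∥+∥∥ : ∀ {N} (B C : Subset N) → meets B C ≡ true → ∥ B ∪ C ∥ ℕ.< ∥ B ∥ ℕ.+ ∥ C ∥
∥∪∥<∥∥+∥∥ []            []            ()
∥∪∥<∥∥+∥∥ (inside  ∷ B) (inside  ∷ C) _ = s≤s (subst (suc ∥ B ∪ C ∥ ℕ.≤_) (sym (ℕ.+-suc ∥ B ∥ ∥ C ∥)) (s≤s (∥∪∥≤∥∥+∥∥ B C)))
  where
  ∥∪∥≤∥∥+∥∥ : ∀ {N} (B C : Subset N) → ∥ B ∪ C ∥ ℕ.≤ ∥ B ∥ ℕ.+ ∥ C ∥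
  ∥∪∥≤∥∥+∥∥ []            []            = z≤n
  ∥∪∥≤∥∥+∥∥ (inside  ∷ B) (inside  ∷ C) = s≤s (subst (∥ B ∪ C ∥ ℕ.≤_) (sym (ℕ.+-suc ∥ B ∥ ∥ C ∥)) (ℕ.m≤n⇒m≤1+n (∥∪∥≤∥∥+∥∥ B C)))
  ∥∪∥≤∥∥+∥∥ (inside  ∷ B) (outside ∷ C) = s≤s (∥∪∥≤∥∥+∥∥ B C)
  ∥∪∥≤∥∥+∥∥ (outside ∷ B) (inside  ∷ C) = subst (suc ∥ B ∪ C ∥ ℕ.≤_) (sym (ℕ.+-suc ∥ B ∥ ∥ C ∥)) (s≤s (∥∪∥≤∥∥+∥∥ B C))
  ∥∪∥≤∥∥+∥∥ (outside ∷ B) (outside ∷ C) = ∥∪∥≤∥∥+∥∥ B C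
∥∪∥<∥∥+∥∥ (inside  ∷ B) (outside ∷ C) h = s≤s (∥∪∥<∥∥+∥∥ B C h)
∥∪∥<∥∥+∥∥ (outside ∷ B) (inside  ∷ C) h = subst (suc (suc ∥ B ∪ C ∥) ℕ.≤_) (sym (ℕ.+-suc ∥ B ∥ ∥ C ∥)) (s≤s (∥∪∥<∥∥+∥∥ B C h))
∥∪∥<∥∥+∥∥ (outside ∷ B) (outside ∷ C) h = ∥∪∥<∥∥+∥∥ B C h

-- Weighted counts of subsets and of pairs of subsets

^-increment : ∀ k {x t} → 0ℚ ≤ x → 0ℚ ≤ t → x ^ suc k + nat (suc k) * (t * x ^ k) ≤ (x + t) ^ suc k
^-increment zero    {x} {t} 0≤x 0≤t = ≤-reflexive (solve 2 (λ x t → x :* con 1ℚ :+ con 1ℚ :* (t :* con 1ℚ) := (x :+ t) :* con 1ℚ) refl x t)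
^-increment (suc k) {x} {t} 0≤x 0≤t = ≤-trans
  (≤-by (0≤nat (suc k) ⊠ (0≤t ⊠ 0≤t ⊠ 0≤^ k 0≤x))
    (trans (solve 4 (λ x t X n → (x :+ t) :* (x :* X :+ n :* (t :* X)) := x :* (x :* X) :+ (con 1ℚ :+ n) :* (t :* (x :* X)) :+ n :* (t :* t :* X)) refl x t (x ^ k) (nat (suc k)))
           (cong (λ z → x * (x * x ^ k) + z * (t * (x * x ^ k)) + nat (suc k) * (t * t * x ^ k)) (sym (nat-suc (suc k))))))
  (*-monoˡ (0≤x ⊞ 0≤t) (^-increment k 0≤x 0≤t))

module Counting (q : ℚ) (0≤q : 0ℚ ≤ q) where

  ∑-≤-size : ∀ N K → ∑ (subsets N) (λ B → ⟦ ∥ B ∥ ℕ.<ᵇ suc K ⟧ * q ^ ∥ B ∥) ≤ (1ℚ + nat N * q) ^ K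
  ∑-≤-size zero    K = subst (1ℚ ≤_) (sym (trans (cong (λ z → (1ℚ + z) ^ K) (*-zeroˡ q)) (1^ K))) ≤-refl
  ∑-≤-size (suc N) K = ≤-trans (≤-reflexive (∑-subsets-suc {N} (λ B → ⟦ ∥ B ∥ ℕ.<ᵇ suc K ⟧ * q ^ ∥ B ∥))) (go K)
    where
    x = 1ℚ + nat N * q
    x′ = 1ℚ + nat (suc N) * q
    0≤x : 0ℚ ≤ x
    0≤x = 0≤1 ⊞ 0≤nat N ⊠ 0≤q
    x′≡ : x′ ≡ x + q
    x′≡ = trans (cong (λ z → 1ℚ + z * q) (nat-suc N)) (solve 2 (λ n q → con 1ℚ :+ (con 1ℚ :+ n) :* q := con 1ℚ :+ n :* q :+ q) refl (nat N) q)
    go : ∀ K → ∑ (subsets N) (λ B → ⟦ suc ∥ B ∥ ℕ.<ᵇ suc K ⟧ * q ^ suc ∥ B ∥) + ∑ (subsets N) (λ B → ⟦ ∥ B ∥ ℕ.<ᵇ suc K ⟧ * q ^ ∥ B ∥) ≤ x′ ^ K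
    go zero = ≤-trans (+-mono-≤ (≤-reflexive (trans (∑-cong (subsets N) (λ B → *-zeroˡ (q ^ suc ∥ B ∥))) (∑-zero (subsets N)))) (∑-≤-size N zero))
                (≤-reflexive (+-identityˡ 1ℚ))
    go (suc K) = ≤-trans (+-mono-≤
        (≤-trans (≤-reflexive (trans (∑-cong (subsets N) (λ B → solve 3 (λ a q b → a :* (q :* b) := q :* (a :* b)) refl ⟦ ∥ B ∥ ℕ.<ᵇ suc K ⟧ q (q ^ ∥ B ∥))) (∑-*ˡ q (subsets N) (λ B → ⟦ ∥ B ∥ ℕ.<ᵇ suc K ⟧ * q ^ ∥ B ∥)))) (*-monoˡ 0≤q (∑-≤-size N K)))
        (∑-≤-size N (suc K)))
      (≤-trans (≤-reflexive (solve 3 (λ q X x → q :* X :+ x :* X := (x :+ q) :* X) refl q (x ^ K) x))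
        (subst (λ z → (x + q) * x ^ K ≤ z * z ^ K) (sym x′≡) (*-monoˡ (0≤x ⊞ 0≤q) (^-mono K 0≤x (≤-by 0≤q refl)))))

  -- The bound of the binomial coefficient by Nᵏ / k!, proved by Pascal's rule. Keeping the
  -- factorial exact is essential, since it has to match the d! in the threshold.
  ∑-size : ∀ N k → nat (k !) * ∑ (subsets N) (λ B → ⟦ ∥ B ∥ ℕ.≡ᵇ k ⟧ * q ^ ∥ B ∥) ≤ (nat N * q) ^ k
  ∑-size zero    zero    = ≤-refl
  ∑-size zero    (suc k) = subst (_≤ (nat 0 * q) ^ suc k) (sym (*-zeroʳ (nat (suc k !)))) (0≤^ (suc k) (0≤nat 0 ⊠ 0≤q))
  ∑-size (suc N) zero    = ≤-trans (≤-reflexive (cong (nat 1 *_) (trans (∑-subsets-suc {N} (λ B → ⟦ ∥ B ∥ ℕ.≡ᵇ zero ⟧ * q ^ ∥ B ∥))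
    (trans (cong (_+ Z₀) (trans (∑-cong (subsets N) (λ B → *-zeroˡ (q ^ suc ∥ B ∥))) (∑-zero (subsets N)))) (+-identityˡ Z₀))))) (∑-size N zero)
    where Z₀ = ∑ (subsets N) (λ B → ⟦ ∥ B ∥ ℕ.≡ᵇ zero ⟧ * q ^ ∥ B ∥)
  ∑-size (suc N) (suc k) = begin
    nat (suc k !) * ∑ (subsets (suc N)) (λ B → ⟦ ∥ B ∥ ℕ.≡ᵇ suc k ⟧ * q ^ ∥ B ∥)
      ≡⟨ cong (nat (suc k !) *_) (trans (∑-subsets-suc {N} (λ B → ⟦ ∥ B ∥ ℕ.≡ᵇ suc k ⟧ * q ^ ∥ B ∥))
           (cong (_+ Z₁) (trans (∑-cong (subsets N) (λ B → solve 3 (λ a q b → a :* (q :* b) := q :* (a :* b)) refl ⟦ ∥ B ∥ ℕ.≡ᵇ k ⟧ q (q ^ ∥ B ∥))) (∑-*ˡ q (subsets N) (λ B → ⟦ ∥ B ∥ ℕ.≡ᵇ k ⟧ * q ^ ∥ B ∥))))) ⟩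
    nat (suc k !) * (q * Z₀ + Z₁)
      ≡⟨ trans (solve 4 (λ f q a b → f :* (q :* a :+ b) := f :* b :+ f :* (q :* a)) refl (nat (suc k !)) q Z₀ Z₁)
           (cong (λ z → nat (suc k !) * Z₁ + z) (trans (cong (_* (q * Z₀)) (nat-* (suc k) (k !))) (solve 4 (λ n f q a → n :* f :* (q :* a) := n :* (q :* (f :* a))) refl (nat (suc k)) (nat (k !)) q Z₀))) ⟩
    nat (suc k !) * Z₁ + nat (suc k) * (q * (nat (k !) * Z₀))
      ≤⟨ +-mono-≤ (∑-size N (suc k)) (*-monoˡ (0≤nat (suc k)) (*-monoˡ 0≤q (∑-size N k))) ⟩
    (nat N * q) ^ suc k + nat (suc k) * (q * (nat N * q) ^ k)
      ≤⟨ ^-increment k (0≤nat N ⊠ 0≤q) 0≤q ⟩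
    (nat N * q + q) ^ suc k
      ≡⟨ cong (_^ suc k) (trans (solve 2 (λ n q → n :* q :+ q := (con 1ℚ :+ n) :* q) refl (nat N) q) (cong (_* q) (sym (nat-suc N)))) ⟩
    (nat (suc N) * q) ^ suc k ∎
    where
    open ℚ.≤-Reasoning
    Z₀ = ∑ (subsets N) (λ B → ⟦ ∥ B ∥ ℕ.≡ᵇ k ⟧ * q ^ ∥ B ∥)
    Z₁ = ∑ (subsets N) (λ B → ⟦ ∥ B ∥ ℕ.≡ᵇ suc k ⟧ * q ^ ∥ B ∥)

  capped : ℕ → ℕ → ℚ
  capped K u = ⟦ u ℕ.<ᵇ suc K ⟧ * q ^ u

  0≤capped : ∀ K u → 0ℚ ≤ capped K u
  0≤capped K u = 0≤⟦⟧ (u ℕ.<ᵇ suc K) ⊠ 0≤^ u 0≤q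

  capped-suc : ∀ K u → capped (suc K) (suc u) ≡ q * capped K u
  capped-suc K u = solve 3 (λ a q b → a :* (q :* b) := q :* (a :* b)) refl ⟦ u ℕ.<ᵇ suc K ⟧ q (q ^ u)

  pairs : ℕ → ℕ → ℚ
  pairs N K = ∑ (subsets N) (λ B → ∑ (subsets N) (λ C → capped K ∥ B ∪ C ∥))

  pairs-suc : ∀ N K → pairs (suc N) K ≡
    nat 3 * ∑ (subsets N) (λ B → ∑ (subsets N) (λ C → capped K (suc ∥ B ∪ C ∥))) + pairs N K
  pairs-suc N K = begin
    pairs (suc N) K
      ≡⟨ ∑-subsets-suc {N} (λ B → ∑ (subsets (suc N)) (λ C → capped K ∥ B ∪ C ∥)) ⟩
    ∑ (subsets N) (λ B → ∑ (subsets (suc N)) (λ C → capped K ∥ (inside ∷ B) ∪ C ∥)) + ∑ (subsets N) (λ B → ∑ (subsets (suc N)) (λ C → capped K ∥ (outside ∷ B) ∪ C ∥))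
      ≡⟨ cong₂ _+_ (∑-cong (subsets N) (λ B → ∑-subsets-suc {N} (λ C → capped K ∥ (inside ∷ B) ∪ C ∥))) (∑-cong (subsets N) (λ B → ∑-subsets-suc {N} (λ C → capped K ∥ (outside ∷ B) ∪ C ∥))) ⟩
    ∑ (subsets N) (λ B → U B + U B) + ∑ (subsets N) (λ B → U B + V B)
      ≡⟨ cong₂ _+_ (∑-+ (subsets N) U U) (∑-+ (subsets N) U V) ⟩
    ∑ (subsets N) U + ∑ (subsets N) U + (∑ (subsets N) U + pairs N K)
      ≡⟨ solve 2 (λ u v → u :+ u :+ (u :+ v) := con (nat 3) :* u :+ v) refl (∑ (subsets N) U) (pairs N K) ⟩
    nat 3 * ∑ (subsets N) U + pairs N K ∎
    where
    open ≡-Reasoning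
    U V : Subset N → ℚ
    U B = ∑ (subsets N) (λ C → capped K (suc ∥ B ∪ C ∥))
    V B = ∑ (subsets N) (λ C → capped K ∥ B ∪ C ∥)

  -- An element of `B ∪ C` lies in `B` only, in `C` only or in both; these three possibilities give
  -- the factor 3.
  pairs-bound : ∀ N K → pairs N K ≤ (1ℚ + nat 3 * (nat N * q)) ^ K
  pairs-bound zero    K = subst (1ℚ ≤_) (sym (trans (cong (λ z → (1ℚ + nat 3 * z) ^ K) (*-zeroˡ q)) (1^ K))) ≤-refl
  pairs-bound (suc N) K = ≤-trans (≤-reflexive (pairs-suc N K)) (go K)
    where
    x = 1ℚ + nat 3 * (nat N * q)
    x′ = 1ℚ + nat 3 * (nat (suc N) * q)
    0≤x : 0ℚ ≤ x
    0≤x = 0≤1 ⊞ 0≤nat 3 ⊠ (0≤nat N ⊠ 0≤q)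
    x′≡ : x′ ≡ x + nat 3 * q
    x′≡ = trans (cong (λ z → 1ℚ + nat 3 * (z * q)) (nat-suc N)) (solve 2 (λ n q → con 1ℚ :+ con (nat 3) :* ((con 1ℚ :+ n) :* q) := con 1ℚ :+ con (nat 3) :* (n :* q) :+ con (nat 3) :* q) refl (nat N) q)
    U : ℕ → ℚ
    U K = ∑ (subsets N) (λ B → ∑ (subsets N) (λ C → capped K (suc ∥ B ∪ C ∥)))
    go : ∀ K → nat 3 * U K + pairs N K ≤ x′ ^ K
    go zero = ≤-trans (+-mono-≤ (≤-reflexive (trans (cong (nat 3 *_)
        (trans (∑-cong (subsets N) (λ B → trans (∑-cong (subsets N) (λ C → *-zeroˡ (q ^ suc ∥ B ∪ C ∥))) (∑-zero (subsets N)))) (∑-zero (subsets N)))) (*-zeroʳ (nat 3))))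
        (pairs-bound N zero))
      (≤-reflexive (+-identityˡ 1ℚ))
    go (suc K) = ≤-trans (+-mono-≤ (*-monoˡ (0≤nat 3) (≤-trans (≤-reflexive
          (trans (∑-cong (subsets N) (λ B → trans (∑-cong (subsets N) (λ C → capped-suc K ∥ B ∪ C ∥)) (∑-*ˡ q (subsets N) (λ C → capped K ∥ B ∪ C ∥))))
                 (∑-*ˡ q (subsets N) (λ B → ∑ (subsets N) (λ C → capped K ∥ B ∪ C ∥)))))
          (*-monoˡ 0≤q (pairs-bound N K))))
        (pairs-bound N (suc K)))
      (≤-trans (≤-reflexive (solve 3 (λ q X x → con (nat 3) :* (q :* X) :+ x :* X := (x :+ con (nat 3) :* q) :* X) refl q (x ^ K) x))
        (subst (λ z → (x + nat 3 * q) * x ^ K ≤ z * z ^ K) (sym x′≡) (*-monoˡ (0≤x ⊞ 0≤3q) (^-mono K 0≤x (≤-by 0≤3q refl)))))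
      where
      0≤3q : 0ℚ ≤ nat 3 * q
      0≤3q = 0≤nat 3 ⊠ 0≤q

does-true : ∀ {P : Set} (p? : Dec P) → does p? ≡ true → P
does-true (yes p) _ = p

not-true : ∀ b → not b ≡ true → b ≡ false
not-true false _ = refl

∑-swap₄ : ∀ {A B C D : Set} (as : List A) (bs : List B) (cs : List C) (ds : List D) (f : A → B → C → D → ℚ) →
  ∑ as (λ a → ∑ bs (λ b → ∑ cs (λ c → ∑ ds (λ d → f a b c d)))) ≡
  ∑ cs (λ c → ∑ ds (λ d → ∑ bs (λ b → ∑ as (λ a → f a b c d))))
∑-swap₄ as bs cs ds f = begin
  ∑ as (λ a → ∑ bs (λ b → ∑ cs (λ c → ∑ ds (λ d → f a b c d))))
    ≡⟨ ∑-swap as bs (λ a b → ∑ cs (λ c → ∑ ds (λ d → f a b c d))) ⟩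
  ∑ bs (λ b → ∑ as (λ a → ∑ cs (λ c → ∑ ds (λ d → f a b c d))))
    ≡⟨ ∑-cong bs (λ b → trans (∑-swap as cs (λ a c → ∑ ds (λ d → f a b c d))) (∑-cong cs (λ c → ∑-swap as ds (λ a d → f a b c d)))) ⟩
  ∑ bs (λ b → ∑ cs (λ c → ∑ ds (λ d → ∑ as (λ a → f a b c d))))
    ≡⟨ trans (∑-swap bs cs (λ b c → ∑ ds (λ d → ∑ as (λ a → f a b c d)))) (∑-cong cs (λ c → ∑-swap bs ds (λ b d → ∑ as (λ a → f a b c d)))) ⟩
  ∑ cs (λ c → ∑ ds (λ d → ∑ bs (λ b → ∑ as (λ a → f a b c d)))) ∎
  where open ≡-Reasoning

∑-remove₂ : ∀ {N} {i j : Fin N} → i ≢ j → (φ : Subset N → ℚ) →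
  ∑ (subsets N) (λ B → ⟦ lookup B j ⟧ * (⟦ lookup B i ⟧ * φ B)) ≡
  ∑ (subsets N) (λ B → ⟦ not (lookup B i) ⟧ * (⟦ not (lookup B j) ⟧ * φ (B ⊕ i ⊕ j)))
∑-remove₂ {N} {i} {j} i≢j φ = begin
  ∑ (subsets N) (λ B → ⟦ lookup B j ⟧ * (⟦ lookup B i ⟧ * φ B))
    ≡⟨ ∑-remove j (λ B → ⟦ lookup B i ⟧ * φ B) ⟩
  ∑ (subsets N) (λ B → ⟦ not (lookup B j) ⟧ * (⟦ lookup (B ⊕ j) i ⟧ * φ (B ⊕ j)))
    ≡⟨ ∑-cong (subsets N) (λ B → trans (cong (λ z → ⟦ not (lookup B j) ⟧ * (⟦ z ⟧ * φ (B ⊕ j))) (Vec.lookup∘update′ i≢j B inside))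
         (solve 3 (λ a b c → a :* (b :* c) := b :* (a :* c)) refl ⟦ not (lookup B j) ⟧ ⟦ lookup B i ⟧ (φ (B ⊕ j)))) ⟩
  ∑ (subsets N) (λ B → ⟦ lookup B i ⟧ * (⟦ not (lookup B j) ⟧ * φ (B ⊕ j)))
    ≡⟨ ∑-remove i (λ B → ⟦ not (lookup B j) ⟧ * φ (B ⊕ j)) ⟩
  ∑ (subsets N) (λ B → ⟦ not (lookup B i) ⟧ * (⟦ not (lookup (B ⊕ i) j) ⟧ * φ (B ⊕ i ⊕ j)))
    ≡⟨ ∑-cong (subsets N) (λ B → cong (λ z → ⟦ not (lookup B i) ⟧ * (⟦ not z ⟧ * φ (B ⊕ i ⊕ j))) (Vec.lookup∘update′ (i≢j ∘ sym) B inside)) ⟩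
  ∑ (subsets N) (λ B → ⟦ not (lookup B i) ⟧ * (⟦ not (lookup B j) ⟧ * φ (B ⊕ i ⊕ j))) ∎
  where open ≡-Reasoning

-- Subset sums in a group of exponent two

module SubsetSums (G : Set) (_≟_ : DecidableEquality G) (_∙_ : G → G → G) (0# : G)
                  (assoc : ∀ x y z → (x ∙ y) ∙ z ≡ x ∙ (y ∙ z)) (comm : ∀ x y → x ∙ y ≡ y ∙ x)
                  (identityʳ : ∀ x → x ∙ 0# ≡ x) (self-inverse : ∀ x → x ∙ x ≡ 0#) where

  undo : ∀ x a → (x ∙ a) ∙ a ≡ x
  undo x a = trans (assoc x a a) (trans (cong (x ∙_) (self-inverse a)) (identityʳ x))

  cancelʳ : ∀ {x y} a → x ∙ a ≡ y ∙ a → x ≡ y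
  cancelʳ {x} {y} a eq = trans (sym (undo x a)) (trans (cong (_∙ a) eq) (undo y a))

  swap-front : ∀ x y z → x ∙ (y ∙ z) ≡ y ∙ (x ∙ z)
  swap-front x y z = trans (sym (assoc x y z)) (trans (cong (_∙ z) (comm x y)) (assoc y x z))

  total : ∀ {N} → (Fin N → G) → Subset N → G
  total v []            = 0#
  total v (inside  ∷ B) = v Fin.zero ∙ total (v ∘ Fin.suc) B
  total v (outside ∷ B) = total (v ∘ Fin.suc) B

  total-⊕ : ∀ {N} (v : Fin N → G) B i → lookup B i ≡ false → total v (B ⊕ i) ≡ v i ∙ total v B
  total-⊕ v (outside ∷ B) Fin.zero    h = refl
  total-⊕ v (inside  ∷ B) (Fin.suc i) h = trans (cong (v Fin.zero ∙_) (total-⊕ (v ∘ Fin.suc) B i h)) (swap-front (v Fin.zero) (v (Fin.suc i)) (total (v ∘ Fin.suc) B))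
  total-⊕ v (outside ∷ B) (Fin.suc i) h = total-⊕ (v ∘ Fin.suc) B i h

  total-empty : ∀ {N} (v : Fin N → G) B → ∥ B ∥ ≡ 0 → total v B ≡ 0#
  total-empty v []            _ = refl
  total-empty v (outside ∷ B) h = total-empty (v ∘ Fin.suc) B h

  total≢0⇒nonempty : ∀ {N} (v : Fin N → G) B → total v B ≢ 0# → 1 ℕ.≤ ∥ B ∥
  total≢0⇒nonempty v B h = ℕ.n≢0⇒n>0 (h ∘ total-empty v B)

  ⟨_≐_⟩ : G → G → ℚ
  ⟨ x ≐ y ⟩ = ⟦ does (x ≟ y) ⟧

  0≤⟨≐⟩ : ∀ x y → 0ℚ ≤ ⟨ x ≐ y ⟩
  0≤⟨≐⟩ x y = 0≤⟦⟧ (does (x ≟ y))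

  module _ {N : ℕ} (v : Fin N → G) (v-injective : ∀ {i j} → v i ≡ v j → i ≡ j) where

    one-solution : ∀ a x → ∑ (allFin N) (λ i → ⟨ v i ∙ a ≐ x ⟩) ≤ 1ℚ
    one-solution a x = ∑-unique (Unique.allFin⁺ N) (λ i → does ((v i ∙ a) ≟ x)) (λ i j hi hj →
      v-injective (cancelʳ a (trans (does-true ((v i ∙ a) ≟ x) hi) (sym (does-true ((v j ∙ a) ≟ x) hj)))))

    -- Double counting of pairs of a subset and one of its elements. After the element is removed,
    -- the prescribed total determines it, so the constraint on the total replaces a sum over all N
    -- elements by a single one: a gain of a factor N.
    ∑-weighted-by-size : ∀ x {ω : ℕ → ℚ} → (∀ k → 0ℚ ≤ ω k) →
      ∑ (subsets N) (λ B → ⟨ total v B ≐ x ⟩ * (nat ∥ B ∥ * ω ∥ B ∥)) ≤ ∑ (subsets N) (λ B → ω (suc ∥ B ∥))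
    ∑-weighted-by-size x {ω} 0≤ω = begin
      ∑ (subsets N) (λ B → ⟨ total v B ≐ x ⟩ * (nat ∥ B ∥ * ω ∥ B ∥))
        ≡⟨ ∑-cong (subsets N) (λ B → trans (solve 3 (λ s n w → s :* (n :* w) := n :* (s :* w)) refl ⟨ total v B ≐ x ⟩ (nat ∥ B ∥) (ω ∥ B ∥))
             (trans (cong (_* φ B) (sym (∑-lookup B))) (sym (∑-*ʳ (φ B) (allFin N) (λ i → ⟦ lookup B i ⟧))))) ⟩
      ∑ (subsets N) (λ B → ∑ (allFin N) (λ i → ⟦ lookup B i ⟧ * φ B))
        ≡⟨ ∑-swap (subsets N) (allFin N) (λ B i → ⟦ lookup B i ⟧ * φ B) ⟩
      ∑ (allFin N) (λ i → ∑ (subsets N) (λ B → ⟦ lookup B i ⟧ * φ B))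
        ≡⟨ ∑-cong (allFin N) (λ i → ∑-remove i φ) ⟩
      ∑ (allFin N) (λ i → ∑ (subsets N) (λ B → ⟦ not (lookup B i) ⟧ * φ (B ⊕ i)))
        ≤⟨ ∑-mono (allFin N) (λ i → ∑-mono (subsets N) (λ B → guard (not (lookup B i)) (0≤⟨≐⟩ (v i ∙ total v B) x ⊠ 0≤ω (suc ∥ B ∥)) (λ h →
             ≤-reflexive (cong₂ (λ t k → ⟨ t ≐ x ⟩ * ω k) (total-⊕ v B i (not-true (lookup B i) h)) (∥∥-⊕ B i (not-true (lookup B i) h)))))) ⟩
      ∑ (allFin N) (λ i → ∑ (subsets N) (λ B → ⟨ v i ∙ total v B ≐ x ⟩ * ω (suc ∥ B ∥)))
        ≡⟨ ∑-swap (allFin N) (subsets N) (λ i B → ⟨ v i ∙ total v B ≐ x ⟩ * ω (suc ∥ B ∥)) ⟩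
      ∑ (subsets N) (λ B → ∑ (allFin N) (λ i → ⟨ v i ∙ total v B ≐ x ⟩ * ω (suc ∥ B ∥)))
        ≤⟨ ∑-mono (subsets N) (λ B → ∑-∙≤ (allFin N) (λ i → ⟨ v i ∙ total v B ≐ x ⟩) (ω (suc ∥ B ∥)) (0≤ω (suc ∥ B ∥)) (one-solution (total v B) x)) ⟩
      ∑ (subsets N) (λ B → ω (suc ∥ B ∥)) ∎
      where
      open ℚ.≤-Reasoning
      φ : Subset N → ℚ
      φ B = ⟨ total v B ≐ x ⟩ * ω ∥ B ∥

    module PairCount (q : ℚ) (0≤q : 0ℚ ≤ q) (K : ℕ) where
      open Counting q 0≤q

      Ψ : G → G → Subset N → Subset N → ℚ
      Ψ a b B C = ⟨ total v B ≐ a ⟩ * (⟨ total v C ≐ b ⟩ * capped (suc (suc K)) ∥ B ∪ C ∥)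

      0≤Ψ : ∀ a b B C → 0ℚ ≤ Ψ a b B C
      0≤Ψ a b B C = 0≤⟨≐⟩ (total v B) a ⊠ (0≤⟨≐⟩ (total v C) b ⊠ 0≤capped (suc (suc K)) ∥ B ∪ C ∥)

      Ψ-swap : ∀ a b B C → Ψ a b B C ≡ Ψ b a C B
      Ψ-swap a b B C = trans (cong (λ D → ⟨ total v B ≐ a ⟩ * (⟨ total v C ≐ b ⟩ * capped (suc (suc K)) ∥ D ∥)) (Subset.∪-comm B C))
        (solve 3 (λ s t w → s :* (t :* w) := t :* (s :* w)) refl ⟨ total v B ≐ a ⟩ ⟨ total v C ≐ b ⟩ (capped (suc (suc K)) ∥ C ∪ B ∥))

      -- What `Ψ` becomes once `i` is taken out of both sets and `j` out of `B` only. The union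
      -- loses two elements, so two factors `q` come out and the size cap falls from K + 2 to K.
      Reduced : G → G → Fin N → Fin N → Subset N → Subset N → ℚ
      Reduced a b i j B C = ⟨ v j ∙ (v i ∙ total v B) ≐ a ⟩ * (⟨ v i ∙ total v C ≐ b ⟩ * (q * (q * capped K ∥ B ∪ C ∥)))

      0≤w : ∀ (B C : Subset N) → 0ℚ ≤ q * (q * capped K ∥ B ∪ C ∥)
      0≤w B C = 0≤q ⊠ (0≤q ⊠ 0≤capped K ∥ B ∪ C ∥)

      0≤Reduced : ∀ a b i j B C → 0ℚ ≤ Reduced a b i j B C
      0≤Reduced a b i j B C = 0≤⟨≐⟩ (v j ∙ (v i ∙ total v B)) a ⊠ (0≤⟨≐⟩ (v i ∙ total v C) b ⊠ 0≤w B C)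

      Ψ-⊕ : ∀ a b {i j} → i ≢ j → ∀ B C → lookup B i ≡ false → lookup B j ≡ false → lookup C i ≡ false → lookup C j ≡ false →
            Ψ a b (B ⊕ i ⊕ j) (C ⊕ i) ≡ Reduced a b i j B C
      Ψ-⊕ a b {i} {j} i≢j B C Bi Bj Ci Cj = cong₂ _*_
        (cong (λ t → ⟨ t ≐ a ⟩) (trans (total-⊕ v (B ⊕ i) j Bj′) (cong (v j ∙_) (total-⊕ v B i Bi))))
        (cong₂ _*_ (cong (λ t → ⟨ t ≐ b ⟩) (total-⊕ v C i Ci))
          (trans (cong (capped (suc (suc K))) (trans (∥∥-⊕-∪ (B ⊕ i) (C ⊕ i) j Bj′ Cj′) (cong suc (∥∥-⊕-∪-⊕ B C i Bi Ci))))
            (trans (capped-suc (suc K) (suc ∥ B ∪ C ∥)) (cong (q *_) (capped-suc K ∥ B ∪ C ∥)))))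
        where
        Bj′ = trans (Vec.lookup∘update′ (i≢j ∘ sym) B inside) Bj
        Cj′ = trans (Vec.lookup∘update′ (i≢j ∘ sym) C inside) Cj

      T : G → G → Fin N → Fin N → ℚ
      T a b i j = ∑ (subsets N) (λ C → ⟦ lookup C i ⟧ * (⟦ not (lookup C j) ⟧ *
                    ∑ (subsets N) (λ B → ⟦ lookup B j ⟧ * (⟦ lookup B i ⟧ * Ψ a b B C))))

      T-bound : ∀ a b i j → T a b i j ≤ ∑ (subsets N) (λ C → ∑ (subsets N) (λ B → Reduced a b i j B C))
      T-bound a b i j = go (i Fin.≟ j)
        where
        0≤bound : 0ℚ ≤ ∑ (subsets N) (λ C → ∑ (subsets N) (λ B → Reduced a b i j B C))
        0≤bound = 0≤∑ (subsets N) (λ C → 0≤∑ (subsets N) (λ B → 0≤Reduced a b i j B C))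
        vanish : ∀ b x → ⟦ b ⟧ * (⟦ not b ⟧ * x) ≡ 0ℚ
        vanish true  x = trans (*-identityˡ (0ℚ * x)) (*-zeroˡ x)
        vanish false x = *-zeroˡ (1ℚ * x)
        go : Dec (i ≡ j) → T a b i j ≤ ∑ (subsets N) (λ C → ∑ (subsets N) (λ B → Reduced a b i j B C))
        -- For `i` equal to `j` the two factors of `T` ask the same element to be in `C` and not in
        -- `C`.
        go (yes refl) = subst (_≤ ∑ (subsets N) (λ C → ∑ (subsets N) (λ B → Reduced a b i j B C)))
          (sym (trans (∑-cong (subsets N) (λ C → vanish (lookup C i) (∑ (subsets N) (λ B → ⟦ lookup B j ⟧ * (⟦ lookup B i ⟧ * Ψ a b B C))))) (∑-zero (subsets N)))) 0≤bound
        go (no i≢j) = begin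
          T a b i j
            ≡⟨ ∑-cong (subsets N) (λ C → cong (λ z → ⟦ lookup C i ⟧ * (⟦ not (lookup C j) ⟧ * z)) (∑-remove₂ i≢j (λ B → Ψ a b B C))) ⟩
          ∑ (subsets N) (λ C → ⟦ lookup C i ⟧ * (⟦ not (lookup C j) ⟧ * Θ C))
            ≡⟨ ∑-remove i (λ C → ⟦ not (lookup C j) ⟧ * Θ C) ⟩
          ∑ (subsets N) (λ C → ⟦ not (lookup C i) ⟧ * (⟦ not (lookup (C ⊕ i) j) ⟧ * Θ (C ⊕ i)))
            ≡⟨ ∑-cong (subsets N) (λ C → cong (λ z → ⟦ not (lookup C i) ⟧ * (⟦ not z ⟧ * Θ (C ⊕ i))) (Vec.lookup∘update′ (i≢j ∘ sym) C inside)) ⟩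
          ∑ (subsets N) (λ C → ⟦ not (lookup C i) ⟧ * (⟦ not (lookup C j) ⟧ * Θ (C ⊕ i)))
            ≤⟨ ∑-mono (subsets N) (λ C →
                 guard (not (lookup C i)) (0≤row C) (λ Ci → guard (not (lookup C j)) (0≤row C) (λ Cj →
                 ∑-mono (subsets N) (λ B → guard (not (lookup B i)) (0≤Reduced a b i j B C) (λ Bi → guard (not (lookup B j)) (0≤Reduced a b i j B C) (λ Bj →
                 ≤-reflexive (Ψ-⊕ a b i≢j B C (not-true (lookup B i) Bi) (not-true (lookup B j) Bj) (not-true (lookup C i) Ci) (not-true (lookup C j) Cj)))))))) ⟩
          ∑ (subsets N) (λ C → ∑ (subsets N) (λ B → Reduced a b i j B C)) ∎
          where
          open ℚ.≤-Reasoning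
          Θ : Subset N → ℚ
          Θ C = ∑ (subsets N) (λ B → ⟦ not (lookup B i) ⟧ * (⟦ not (lookup B j) ⟧ * Ψ a b (B ⊕ i ⊕ j) C))
          0≤row : ∀ C → 0ℚ ≤ ∑ (subsets N) (λ B → Reduced a b i j B C)
          0≤row C = 0≤∑ (subsets N) (λ B → 0≤Reduced a b i j B C)

      -- Once i and j are removed from B and C, the two prescribed totals determine i and j.
      marked : G → G → ℚ
      marked a b = ∑ (subsets N) (λ B → ∑ (subsets N) (λ C → ∑ (allFin N) (λ i → ∑ (allFin N) (λ j →
        (⟦ lookup B i ⟧ * ⟦ lookup C i ⟧) * ((⟦ lookup B j ⟧ * ⟦ not (lookup C j) ⟧) * Ψ a b B C)))))

      marked-bound : ∀ a b → marked a b ≤ q * (q * pairs N K)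
      marked-bound a b = begin
        marked a b
          ≡⟨ ∑-swap₄ (subsets N) (subsets N) (allFin N) (allFin N) (λ B C i j → (⟦ lookup B i ⟧ * ⟦ lookup C i ⟧) * ((⟦ lookup B j ⟧ * ⟦ not (lookup C j) ⟧) * Ψ a b B C)) ⟩
        ∑ (allFin N) (λ i → ∑ (allFin N) (λ j → ∑ (subsets N) (λ C → ∑ (subsets N) (λ B → (⟦ lookup B i ⟧ * ⟦ lookup C i ⟧) * ((⟦ lookup B j ⟧ * ⟦ not (lookup C j) ⟧) * Ψ a b B C)))))
          ≡⟨ ∑-cong (allFin N) (λ i → ∑-cong (allFin N) (λ j → ∑-cong (subsets N) (λ C → factor i j C))) ⟩
        ∑ (allFin N) (λ i → ∑ (allFin N) (λ j → T a b i j))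
          ≤⟨ ∑-mono (allFin N) (λ i → ∑-mono (allFin N) (λ j → T-bound a b i j)) ⟩
        ∑ (allFin N) (λ i → ∑ (allFin N) (λ j → ∑ (subsets N) (λ C → ∑ (subsets N) (λ B → Reduced a b i j B C))))
          ≡⟨ ∑-swap₄ (subsets N) (subsets N) (allFin N) (allFin N) (λ B C i j → Reduced a b i j B C) ⟨
        ∑ (subsets N) (λ B → ∑ (subsets N) (λ C → ∑ (allFin N) (λ i → ∑ (allFin N) (λ j → Reduced a b i j B C))))
          ≤⟨ ∑-mono (subsets N) (λ B → ∑-mono (subsets N) (λ C → solutions B C)) ⟩
        ∑ (subsets N) (λ B → ∑ (subsets N) (λ C → q * (q * capped K ∥ B ∪ C ∥)))
          ≡⟨ pull ⟩
        q * (q * pairs N K) ∎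
        where
        open ℚ.≤-Reasoning
        factor : ∀ i j C → ∑ (subsets N) (λ B → (⟦ lookup B i ⟧ * ⟦ lookup C i ⟧) * ((⟦ lookup B j ⟧ * ⟦ not (lookup C j) ⟧) * Ψ a b B C)) ≡
          ⟦ lookup C i ⟧ * (⟦ not (lookup C j) ⟧ * ∑ (subsets N) (λ B → ⟦ lookup B j ⟧ * (⟦ lookup B i ⟧ * Ψ a b B C)))
        factor i j C = trans (∑-cong (subsets N) (λ B → solve 5 (λ x y z w p → (x :* y) :* ((z :* w) :* p) := (y :* w) :* (z :* (x :* p))) refl
                         ⟦ lookup B i ⟧ ⟦ lookup C i ⟧ ⟦ lookup B j ⟧ ⟦ not (lookup C j) ⟧ (Ψ a b B C)))
          (trans (∑-*ˡ (⟦ lookup C i ⟧ * ⟦ not (lookup C j) ⟧) (subsets N) (λ B → ⟦ lookup B j ⟧ * (⟦ lookup B i ⟧ * Ψ a b B C)))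
            (*-assoc ⟦ lookup C i ⟧ ⟦ not (lookup C j) ⟧ (∑ (subsets N) (λ B → ⟦ lookup B j ⟧ * (⟦ lookup B i ⟧ * Ψ a b B C)))))
        solutions : ∀ B C → ∑ (allFin N) (λ i → ∑ (allFin N) (λ j → Reduced a b i j B C)) ≤ q * (q * capped K ∥ B ∪ C ∥)
        -- The total of `C` determines `i`; with `i` fixed, the total of `B` determines `j`. The sum
        -- over `j` is therefore evaluated first.
        solutions B C = ≤-trans
          (∑-mono (allFin N) (λ i → ∑-∙≤ (allFin N) (λ j → ⟨ v j ∙ (v i ∙ total v B) ≐ a ⟩) (⟨ v i ∙ total v C ≐ b ⟩ * w)
            (0≤⟨≐⟩ (v i ∙ total v C) b ⊠ 0≤w B C) (one-solution (v i ∙ total v B) a)))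
          (∑-∙≤ (allFin N) (λ i → ⟨ v i ∙ total v C ≐ b ⟩) w (0≤w B C) (one-solution (total v C) b))
          where w = q * (q * capped K ∥ B ∪ C ∥)
        pull : ∑ (subsets N) (λ B → ∑ (subsets N) (λ C → q * (q * capped K ∥ B ∪ C ∥))) ≡ q * (q * pairs N K)
        pull = trans (∑-cong (subsets N) (λ B → trans (∑-*ˡ q (subsets N) (λ C → q * capped K ∥ B ∪ C ∥)) (cong (q *_) (∑-*ˡ q (subsets N) (λ C → capped K ∥ B ∪ C ∥)))))
          (trans (∑-*ˡ q (subsets N) (λ B → q * ∑ (subsets N) (λ C → capped K ∥ B ∪ C ∥))) (cong (q *_) (∑-*ˡ q (subsets N) (λ B → ∑ (subsets N) (λ C → capped K ∥ B ∪ C ∥)))))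

      overlapping : G → G → ℚ
      overlapping a b = ∑ (subsets N) (λ B → ∑ (subsets N) (λ C → ⟦ meets B C ⟧ * (⟦ differs B C ⟧ * Ψ a b B C)))

      -- Meeting sets have a common element `i`, and distinct sets have an element `j` lying in
      -- exactly one of them. If `j` belongs to `C`, exchanging the two sets gives the second
      -- summand.
      overlapping≤marked : ∀ a b → overlapping a b ≤ marked a b + marked b a
      overlapping≤marked a b = begin
        overlapping a b
          ≤⟨ ∑-mono (subsets N) (λ B → ∑-mono (subsets N) (λ C → *-mono-≤ (0≤⟦⟧ (meets B C)) (meets≤∑ B C) (0≤⟦⟧ (differs B C) ⊠ 0≤Ψ a b B C) (*-monoʳ (0≤Ψ a b B C) (differs≤∑ B C)))) ⟩
        ∑ (subsets N) (λ B → ∑ (subsets N) (λ C → ∑ (allFin N) (common B C) * (∑ (allFin N) (in-exactly-one B C) * Ψ a b B C)))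
          ≡⟨ ∑-cong (subsets N) (λ B → trans (∑-cong (subsets N) (λ C → distribute B C)) (∑-+ (subsets N) (left B) (right B))) ⟩
        ∑ (subsets N) (λ B → ∑ (subsets N) (left B) + ∑ (subsets N) (right B))
          ≡⟨ ∑-+ (subsets N) (λ B → ∑ (subsets N) (left B)) (λ B → ∑ (subsets N) (right B)) ⟩
        marked a b + ∑ (subsets N) (λ B → ∑ (subsets N) (right B))
          ≡⟨ cong (marked a b +_) (∑-swap (subsets N) (subsets N) right) ⟩
        marked a b + ∑ (subsets N) (λ C → ∑ (subsets N) (λ B → right B C))
          ≡⟨ cong (marked a b +_) (∑-cong (subsets N) (λ C → ∑-cong (subsets N) (λ B → ∑-cong (allFin N) (λ i → ∑-cong (allFin N) (λ j →
               cong₂ _*_ (*-comm ⟦ lookup B i ⟧ ⟦ lookup C i ⟧) (cong ((⟦ lookup C j ⟧ * ⟦ not (lookup B j) ⟧) *_) (Ψ-swap a b B C))))))) ⟩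
        marked a b + marked b a ∎
        where
        open ℚ.≤-Reasoning
        common : Subset N → Subset N → Fin N → ℚ
        common B C i = ⟦ lookup B i ⟧ * ⟦ lookup C i ⟧
        left right : Subset N → Subset N → ℚ
        left  B C = ∑ (allFin N) (λ i → ∑ (allFin N) (λ j → common B C i * ((⟦ lookup B j ⟧ * ⟦ not (lookup C j) ⟧) * Ψ a b B C)))
        right B C = ∑ (allFin N) (λ i → ∑ (allFin N) (λ j → common B C i * ((⟦ lookup C j ⟧ * ⟦ not (lookup B j) ⟧) * Ψ a b B C)))
        distribute : ∀ B C → ∑ (allFin N) (common B C) * (∑ (allFin N) (in-exactly-one B C) * Ψ a b B C) ≡ left B C + right B C
        distribute B C = trans
          (cong (∑ (allFin N) (common B C) *_) (trans (sym (∑-*ʳ p (allFin N) (in-exactly-one B C))) (trans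
            (∑-cong (allFin N) (λ j → ℚ.*-distribʳ-+ p (⟦ lookup B j ⟧ * ⟦ not (lookup C j) ⟧) (⟦ lookup C j ⟧ * ⟦ not (lookup B j) ⟧))) (∑-+ (allFin N) l r))))
          (trans (ℚ.*-distribˡ-+ (∑ (allFin N) (common B C)) (∑ (allFin N) l) (∑ (allFin N) r)) (cong₂ _+_ (product l) (product r)))
          where
          p = Ψ a b B C
          l r : Fin N → ℚ
          l j = (⟦ lookup B j ⟧ * ⟦ not (lookup C j) ⟧) * p
          r j = (⟦ lookup C j ⟧ * ⟦ not (lookup B j) ⟧) * p
          product : ∀ g → ∑ (allFin N) (common B C) * ∑ (allFin N) g ≡ ∑ (allFin N) (λ i → ∑ (allFin N) (λ j → common B C i * g j))
          product g = trans (sym (∑-*ʳ (∑ (allFin N) g) (allFin N) (common B C))) (∑-cong (allFin N) (λ i → sym (∑-*ˡ (common B C i) (allFin N) g)))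

      -- The two marked elements contribute q² where free elements would contribute (N q)²; this is
      -- the factor 1 / N² that makes the avoidance events almost uncorrelated.
      overlapping-bound : ∀ a b → overlapping a b ≤ nat 2 * (q * q * (1ℚ + nat 3 * (nat N * q)) ^ K)
      overlapping-bound a b = begin
        overlapping a b ≤⟨ overlapping≤marked a b ⟩
        marked a b + marked b a ≤⟨ +-mono-≤ (marked-bound a b) (marked-bound b a) ⟩
        q * (q * pairs N K) + q * (q * pairs N K) ≡⟨ solve 2 (λ q w → q :* (q :* w) :+ q :* (q :* w) := con (nat 2) :* (q :* q :* w)) refl q (pairs N K) ⟩
        nat 2 * (q * q * pairs N K) ≤⟨ *-monoˡ (0≤nat 2) (*-monoˡ (0≤q ⊠ 0≤q) (pairs-bound N K)) ⟩
        nat 2 * (q * q * (1ℚ + nat 3 * (nat N * q)) ^ K) ∎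
        where open ℚ.≤-Reasoning

-- Avoidance of the families of subsets with a given sum

⟦⟧-∧ : ∀ a b → ⟦ a ∧ b ⟧ ≡ ⟦ a ⟧ * ⟦ b ⟧
⟦⟧-∧ true  b = sym (*-identityˡ ⟦ b ⟧)
⟦⟧-∧ false b = sym (*-zeroˡ ⟦ b ⟧)

guard-mono : ∀ b {x y} → (b ≡ true → x ≤ y) → ⟦ b ⟧ * x ≤ ⟦ b ⟧ * y
guard-mono true          h = *-monoˡ 0≤1 (h refl)
guard-mono false {x} {y} h = ≤-reflexive (trans (*-zeroˡ x) (sym (*-zeroˡ y)))

<ᵇ-true : ∀ m n → (m ℕ.<ᵇ n) ≡ true → m ℕ.< n
<ᵇ-true m n eq = ℕ.<ᵇ⇒< m n (subst Bool.T (sym eq) tt)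

<⇒⟦<ᵇ⟧ : ∀ {m n} → m ℕ.< n → ⟦ m ℕ.<ᵇ n ⟧ ≡ 1ℚ
<⇒⟦<ᵇ⟧ {m} {n} m<n = go (m ℕ.<ᵇ n) (ℕ.<⇒<ᵇ m<n)
  where
  go : ∀ b → Bool.T b → ⟦ b ⟧ ≡ 1ℚ
  go true _ = refl

⟦<ᵇsuc⟧ : ∀ k d → ⟦ k ℕ.<ᵇ suc d ⟧ ≡ ⟦ k ℕ.<ᵇ d ⟧ + ⟦ k ℕ.≡ᵇ d ⟧
⟦<ᵇsuc⟧ zero    zero    = refl
⟦<ᵇsuc⟧ zero    (suc d) = refl
⟦<ᵇsuc⟧ (suc k) zero    = refl
⟦<ᵇsuc⟧ (suc k) (suc d) = ⟦<ᵇsuc⟧ k d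

module Independence (q : ℚ) (0≤q : 0ℚ ≤ q) (q≤1 : q ≤ 1ℚ) (q≤½ : q ≤ ½) where
  open RandomSubset q 0≤q q≤1

  -- (1 - t)(1 + (1 + 2q)t) ≥ 1 for 0 ≤ t ≤ q ≤ ½.
  1≤indep*E : ∀ {N} (Bs : List (Subset N)) → All (λ B → 1 ℕ.≤ ∥ B ∥) Bs →
              1ℚ ≤ indep Bs * E (suc (length Bs)) (∑ Bs (λ B → (1ℚ + nat 2 * q) * q ^ ∥ B ∥))
  1≤indep*E []       []        = ≤-refl
  1≤indep*E (B ∷ Bs) (1≤B ∷ h) = begin
    1ℚ
      ≤⟨ ≤-by (0≤t ⊠ (slack t≤q ⊞ 0≤q ⊠ (0≤nat 2 ⊠ slack (≤-trans t≤q q≤½))))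
           (solve 2 (λ t q → (con 1ℚ :- t) :* (con 1ℚ :+ (con 1ℚ :+ con (nat 2) :* q) :* t) := con 1ℚ :+ t :* ((q :- t) :+ q :* (con (nat 2) :* (con ½ :- t)))) refl t q) ⟩
    (1ℚ - t) * (1ℚ + t′)
      ≡⟨ *-identityˡ ((1ℚ - t) * (1ℚ + t′)) ⟨
    1ℚ * ((1ℚ - t) * (1ℚ + t′))
      ≤⟨ *-monoʳ (0≤1-t ⊠ (0≤1 ⊞ 0≤t′)) (1≤indep*E Bs h) ⟩
    indep Bs * E (suc (length Bs)) s * ((1ℚ - t) * (1ℚ + t′))
      ≡⟨ solve 4 (λ a b c d → a :* b :* (c :* d) := c :* a :* (b :* d)) refl (indep Bs) (E (suc (length Bs)) s) (1ℚ - t) (1ℚ + t′) ⟩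
    (1ℚ - t) * indep Bs * (E (suc (length Bs)) s * (1ℚ + t′))
      ≤⟨ *-monoˡ (0≤1-t ⊠ 0≤indep Bs) (E-shift-lower (suc (length Bs)) 0≤s 0≤t′) ⟩
    (1ℚ - t) * indep Bs * E (suc (suc (length Bs))) (s + t′)
      ≡⟨ cong (λ z → (1ℚ - t) * indep Bs * E (suc (suc (length Bs))) z) (+-comm s t′) ⟩
    (1ℚ - t) * indep Bs * E (suc (suc (length Bs))) (t′ + s) ∎
    where
    open ℚ.≤-Reasoning
    t = q ^ ∥ B ∥
    t′ = (1ℚ + nat 2 * q) * t
    s = ∑ Bs (λ B → (1ℚ + nat 2 * q) * q ^ ∥ B ∥)
    0≤t : 0ℚ ≤ t
    0≤t = 0≤^ ∥ B ∥ 0≤q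
    0≤c : 0ℚ ≤ 1ℚ + nat 2 * q
    0≤c = 0≤1 ⊞ 0≤nat 2 ⊠ 0≤q
    0≤t′ : 0ℚ ≤ t′
    0≤t′ = 0≤c ⊠ 0≤t
    0≤s : 0ℚ ≤ s
    0≤s = 0≤∑ Bs (λ B → 0≤c ⊠ 0≤^ ∥ B ∥ 0≤q)
    t≤q : t ≤ q
    t≤q = subst (t ≤_) (*-identityʳ q) (^-antiʳ 0≤q q≤1 1≤B)
    0≤1-t : 0ℚ ≤ 1ℚ - t
    0≤1-t = slack (^≤1 ∥ B ∥ 0≤q q≤1)

  joint : ∀ {N} → Subset N → Subset N → ℚ
  joint B C = ⟦ meets B C ⟧ * (⟦ differs B C ⟧ * q ^ ∥ B ∪ C ∥)

  0≤joint : ∀ {N} (B C : Subset N) → 0ℚ ≤ joint B C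
  0≤joint B C = 0≤⟦⟧ (meets B C) ⊠ (0≤⟦⟧ (differs B C) ⊠ 0≤^ ∥ B ∪ C ∥ 0≤q)

  -- `Unique` supplies the `differs` factor that `overlapping-bound` needs: only pairs at different
  -- positions enter `Δ`. Passing to ordered pairs only adds nonnegative terms.
  Δ≤overlaps : ∀ {N} {Bs : List (Subset N)} → Unique Bs → Δ Bs ≤ ∑ Bs (λ B → ∑ Bs (joint B))
  Δ≤overlaps []                        = ≤-refl
  Δ≤overlaps {N} {B ∷ Bs} (B∉Bs ∷ uBs) = +-mono-≤
    (≤-trans (∑-mono-All (All.map (λ {C} B≢C → ≤-reflexive (cong (⟦ meets B C ⟧ *_)
        (trans (sym (*-identityˡ (q ^ ∥ B ∪ C ∥))) (cong (λ b → ⟦ b ⟧ * q ^ ∥ B ∪ C ∥) (sym (≢⇒differs B C B≢C)))))) B∉Bs))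
      (≤-by (0≤joint B B) (+-comm (joint B B) (∑ Bs (joint B)))))
    (≤-trans (Δ≤overlaps uBs) (∑-mono Bs (λ D → ≤-by (0≤joint D B) (+-comm (joint D B) (∑ Bs (joint D))))))

module Families (G : Set) (_≟_ : DecidableEquality G) (_∙_ : G → G → G) (0# : G)
                (assoc : ∀ x y z → (x ∙ y) ∙ z ≡ x ∙ (y ∙ z)) (comm : ∀ x y → x ∙ y ≡ y ∙ x)
                (identityʳ : ∀ x → x ∙ 0# ≡ x) (self-inverse : ∀ x → x ∙ x ≡ 0#)
                {N : ℕ} (v : Fin N → G) (v-injective : ∀ {i j} → v i ≡ v j → i ≡ j) (e : ℕ) where
  open SubsetSums G _≟_ _∙_ 0# assoc comm identityʳ self-inverse

  d : ℕ
  d = suc (suc e)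

  -- The size condition is written with `suc d` so that the Boolean of the decision is the test
  -- `_<ᵇ_` appearing in the weights.
  represents? : ∀ x → Decidable (λ B → total v B ≡ x × ∥ B ∥ ℕ.< suc d)
  represents? x B = (total v B ≟ x) ×-dec (∥ B ∥ ℕ.<? suc d)

  family : G → List (Subset N)
  family x = filter (represents? x) (subsets N)

  small : Subset N → ℚ
  small B = ⟦ ∥ B ∥ ℕ.<ᵇ suc d ⟧

  ∑-family : ∀ x f → ∑ (family x) f ≡ ∑ (subsets N) (λ B → ⟨ total v B ≐ x ⟩ * (small B * f B))
  ∑-family x f = trans (∑-filter (represents? x) (subsets N) f) (∑-cong (subsets N) (λ B →
    trans (cong (_* f B) (⟦⟧-∧ (does (total v B ≟ x)) (∥ B ∥ ℕ.<ᵇ suc d))) (*-assoc ⟦ does (total v B ≟ x) ⟧ (small B) (f B))))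

  family-represents : ∀ x → All (λ B → total v B ≡ x × ∥ B ∥ ℕ.< suc d) (family x)
  family-represents x = All.all-filter (represents? x) (subsets N)

  family-nonempty : ∀ x → x ≢ 0# → All (λ B → 1 ℕ.≤ ∥ B ∥) (family x)
  family-nonempty x x≢0 = All.map (λ {B} (eq , _) → total≢0⇒nonempty v B (x≢0 ∘ trans (sym eq))) (family-represents x)

  ∈-family : ∀ x B → total v B ≡ x → ∥ B ∥ ℕ.≤ d → B ∈ˡ family x
  ∈-family x B eq ≤d = Membership.∈-filter⁺ (represents? x) (∈-subsets B) (eq , s≤s ≤d)

  families-unique : ∀ {x y} → x ≢ y → Unique (family x ++ family y)
  families-unique {x} {y} x≢y = Unique.++⁺ (Unique.filter⁺ (represents? x) (subsets-unique N)) (Unique.filter⁺ (represents? y) (subsets-unique N))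
    (λ (B∈x , B∈y) → x≢y (trans (sym (proj₁ (proj₂ (Membership.∈-filter⁻ (represents? x) {xs = subsets N} B∈x)))) (proj₁ (proj₂ (Membership.∈-filter⁻ (represents? y) {xs = subsets N} B∈y)))))

  module _ (q : ℚ) (0≤q : 0ℚ ≤ q) (q≤1 : q ≤ 1ℚ) (q≤½ : q ≤ ½) where
    open RandomSubset q 0≤q q≤1
    open Independence q 0≤q q≤1 q≤½
    open Counting q 0≤q

    weight : G → ℚ
    weight x = ∑ (family x) (λ B → q ^ ∥ B ∥)

    low top : G → ℚ
    low x = ∑ (subsets N) (λ B → ⟨ total v B ≐ x ⟩ * (⟦ ∥ B ∥ ℕ.<ᵇ d ⟧ * q ^ ∥ B ∥))
    top x = ∑ (subsets N) (λ B → ⟨ total v B ≐ x ⟩ * (⟦ ∥ B ∥ ℕ.≡ᵇ d ⟧ * q ^ ∥ B ∥))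

    weight≡low+top : ∀ x → weight x ≡ low x + top x
    weight≡low+top x = trans (∑-family x (λ B → q ^ ∥ B ∥)) (trans (∑-cong (subsets N) (λ B →
        trans (cong (λ z → ⟨ total v B ≐ x ⟩ * (z * q ^ ∥ B ∥)) (⟦<ᵇsuc⟧ ∥ B ∥ d))
          (solve 4 (λ s a b w → s :* ((a :+ b) :* w) := s :* (a :* w) :+ s :* (b :* w)) refl ⟨ total v B ≐ x ⟩ ⟦ ∥ B ∥ ℕ.<ᵇ d ⟧ ⟦ ∥ B ∥ ℕ.≡ᵇ d ⟧ (q ^ ∥ B ∥))))
      (∑-+ (subsets N) (λ B → ⟨ total v B ≐ x ⟩ * (⟦ ∥ B ∥ ℕ.<ᵇ d ⟧ * q ^ ∥ B ∥)) (λ B → ⟨ total v B ≐ x ⟩ * (⟦ ∥ B ∥ ℕ.≡ᵇ d ⟧ * q ^ ∥ B ∥))))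

    -- A subset with nonzero total is nonempty, so the factor `nat ∥ B ∥` required by
    -- `∑-weighted-by-size` can be inserted for free.
    low-bound : ∀ x → x ≢ 0# → low x ≤ q * (1ℚ + nat N * q) ^ e
    low-bound x x≢0 = begin
      low x
        ≤⟨ ∑-mono (subsets N) (λ B → guard-mono (does (total v B ≟ x)) (λ h →
             subst (_≤ nat ∥ B ∥ * ω ∥ B ∥) (*-identityˡ (ω ∥ B ∥)) (*-monoʳ (0≤ω ∥ B ∥)
               (nat-mono-≤ (total≢0⇒nonempty v B (x≢0 ∘ trans (sym (does-true (total v B ≟ x) h)))))))) ⟩
      ∑ (subsets N) (λ B → ⟨ total v B ≐ x ⟩ * (nat ∥ B ∥ * ω ∥ B ∥))
        ≤⟨ ∑-weighted-by-size v v-injective x 0≤ω ⟩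
      ∑ (subsets N) (λ B → ω (suc ∥ B ∥))
        ≡⟨ trans (∑-cong (subsets N) (λ B → capped-suc e ∥ B ∥)) (∑-*ˡ q (subsets N) (λ B → capped e ∥ B ∥)) ⟩
      q * ∑ (subsets N) (λ B → capped e ∥ B ∥)
        ≤⟨ *-monoˡ 0≤q (∑-≤-size N e) ⟩
      q * (1ℚ + nat N * q) ^ e ∎
      where
      open ℚ.≤-Reasoning
      ω : ℕ → ℚ
      ω = capped (suc e)
      0≤ω : ∀ k → 0ℚ ≤ ω k
      0≤ω = 0≤capped (suc e)

    -- For subsets of size exactly d the multiplicity in `∑-weighted-by-size` equals d, and d times
    -- the (d - 1)! of `∑-size` completes the d! of the threshold.
    top-bound : ∀ x → nat (d !) * top x ≤ q * (nat N * q) ^ suc e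
    top-bound x = begin
      nat (d !) * top x
        ≡⟨ trans (cong (_* top x) (nat-* d (suc e !))) (solve 3 (λ a b t → a :* b :* t := b :* (a :* t)) refl (nat d) (nat (suc e !)) (top x)) ⟩
      nat (suc e !) * (nat d * top x)
        ≡⟨ cong (nat (suc e !) *_) (trans (sym (∑-*ˡ (nat d) (subsets N) (λ B → ⟨ total v B ≐ x ⟩ * (⟦ ∥ B ∥ ℕ.≡ᵇ d ⟧ * q ^ ∥ B ∥)))) (∑-cong (subsets N) (λ B →
             trans (solve 3 (λ n s w → n :* (s :* w) := s :* (n :* w)) refl (nat d) ⟨ total v B ≐ x ⟩ (ω ∥ B ∥))
                   (cong (⟨ total v B ≐ x ⟩ *_) (size ∥ B ∥))))) ⟩
      nat (suc e !) * ∑ (subsets N) (λ B → ⟨ total v B ≐ x ⟩ * (nat ∥ B ∥ * ω ∥ B ∥))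
        ≤⟨ *-monoˡ (0≤nat (suc e !)) (∑-weighted-by-size v v-injective x 0≤ω) ⟩
      nat (suc e !) * ∑ (subsets N) (λ B → ω (suc ∥ B ∥))
        ≡⟨ trans (cong (nat (suc e !) *_) (trans (∑-cong (subsets N) (λ B → solve 3 (λ a q b → a :* (q :* b) := q :* (a :* b)) refl ⟦ ∥ B ∥ ℕ.≡ᵇ suc e ⟧ q (q ^ ∥ B ∥))) (∑-*ˡ q (subsets N) (λ B → ⟦ ∥ B ∥ ℕ.≡ᵇ suc e ⟧ * q ^ ∥ B ∥))))
             (solve 3 (λ f q z → f :* (q :* z) := q :* (f :* z)) refl (nat (suc e !)) q (∑ (subsets N) (λ B → ⟦ ∥ B ∥ ℕ.≡ᵇ suc e ⟧ * q ^ ∥ B ∥))) ⟩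
      q * (nat (suc e !) * ∑ (subsets N) (λ B → ⟦ ∥ B ∥ ℕ.≡ᵇ suc e ⟧ * q ^ ∥ B ∥))
        ≤⟨ *-monoˡ 0≤q (∑-size N (suc e)) ⟩
      q * (nat N * q) ^ suc e ∎
      where
      open ℚ.≤-Reasoning
      ω : ℕ → ℚ
      ω k = ⟦ k ℕ.≡ᵇ d ⟧ * q ^ k
      0≤ω : ∀ k → 0ℚ ≤ ω k
      0≤ω k = 0≤⟦⟧ (k ℕ.≡ᵇ d) ⊠ 0≤^ k 0≤q
      size : ∀ k → nat d * ω k ≡ nat k * ω k
      size k = trans (solve 3 (λ a s w → a :* (s :* w) := s :* (a :* w)) refl (nat d) ⟦ k ℕ.≡ᵇ d ⟧ (q ^ k)) (trans
        (guard-cong (k ℕ.≡ᵇ d) (λ h → cong (λ z → nat z * q ^ k) (sym (ℕ.≡ᵇ⇒≡ k d (subst Bool.T (sym h) tt)))))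
        (solve 3 (λ a s w → s :* (a :* w) := a :* (s :* w)) refl (nat k) ⟦ k ℕ.≡ᵇ d ⟧ (q ^ k)))

    -- K = 2d - 3
    K : ℕ
    K = suc (e ℕ.+ e)

    open PairCount v v-injective q 0≤q K

    overlaps-bound : ∀ a b → ∑ (family a) (λ B → ∑ (family b) (joint B)) ≤ overlapping a b
    overlaps-bound a b = begin
      ∑ (family a) (λ B → ∑ (family b) (joint B))
        ≡⟨ ∑-family a (λ B → ∑ (family b) (joint B)) ⟩
      ∑ (subsets N) (λ B → s B a * (small B * ∑ (family b) (joint B)))
        ≡⟨ ∑-cong (subsets N) (λ B → trans (cong (λ z → s B a * (small B * z)) (∑-family b (joint B)))
             (trans (sym (*-assoc (s B a) (small B) (∑ (subsets N) (λ C → s C b * (small C * joint B C))))) (sym (∑-*ˡ (s B a * small B) (subsets N) (λ C → s C b * (small C * joint B C)))))) ⟩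
      ∑ (subsets N) (λ B → ∑ (subsets N) (λ C → s B a * small B * (s C b * (small C * joint B C))))
        ≡⟨ ∑-cong (subsets N) (λ B → ∑-cong (subsets N) (λ C → solve 7 (λ s t x y m f w → s :* x :* (t :* (y :* (m :* (f :* w)))) := m :* (f :* (s :* (t :* (x :* (y :* w)))))) refl
             (s B a) (s C b) (small B) (small C) ⟦ meets B C ⟧ ⟦ differs B C ⟧ (q ^ ∥ B ∪ C ∥))) ⟩
      ∑ (subsets N) (λ B → ∑ (subsets N) (λ C → ⟦ meets B C ⟧ * (⟦ differs B C ⟧ * (s B a * (s C b * (small B * (small C * q ^ ∥ B ∪ C ∥)))))))
        ≤⟨ ∑-mono (subsets N) (λ B → ∑-mono (subsets N) (λ C → guard-mono (meets B C) (λ h → *-monoˡ (0≤⟦⟧ (differs B C)) (*-monoˡ (0≤⟦⟧ (does (total v B ≟ a))) (*-monoˡ (0≤⟦⟧ (does (total v C ≟ b))) (cap B C h)))))) ⟩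
      overlapping a b ∎
      where
      open ℚ.≤-Reasoning
      s : Subset N → G → ℚ
      s B x = ⟨ total v B ≐ x ⟩
      -- By the overlap the union has size below 2d, and 2d is K + 3, exactly the cutoff in
      -- `capped (suc (suc K))`.
      cap : ∀ B C → meets B C ≡ true → small B * (small C * q ^ ∥ B ∪ C ∥) ≤ capped (suc (suc K)) ∥ B ∪ C ∥
      cap B C h = guard (∥ B ∥ ℕ.<ᵇ suc d) (0≤capped (suc (suc K)) ∥ B ∪ C ∥) (λ B≤ → guard (∥ C ∥ ℕ.<ᵇ suc d) (0≤capped (suc (suc K)) ∥ B ∪ C ∥) (λ C≤ →
        ≤-reflexive (trans (sym (*-identityˡ (q ^ ∥ B ∪ C ∥))) (cong (_* q ^ ∥ B ∪ C ∥) (sym (<⇒⟦<ᵇ⟧ (ℕ.<-≤-trans (∥∪∥<∥∥+∥∥ B C h)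
          (ℕ.≤-trans (ℕ.+-mono-≤ (ℕ.s≤s⁻¹ (<ᵇ-true ∥ B ∥ (suc d) B≤)) (ℕ.s≤s⁻¹ (<ᵇ-true ∥ C ∥ (suc d) C≤))) (ℕ.≤-reflexive (cong (suc ∘ suc) (trans (ℕ.+-suc e (suc e)) (cong suc (ℕ.+-suc e e))))))))))))) 

    -- The 8 is four blocks of ordered pairs between the families of x and y, times the 2 of
    -- `overlapping-bound`.
    η : ℚ
    η = nat 8 * (q * q * (1ℚ + nat 3 * (nat N * q)) ^ K)

    0≤η : 0ℚ ≤ η
    0≤η = 0≤nat 8 ⊠ (0≤q ⊠ 0≤q ⊠ 0≤^ K (0≤1 ⊞ 0≤nat 3 ⊠ (0≤nat N ⊠ 0≤q)))

    Δ-bound : ∀ {x y} → x ≢ y → Δ (family x ++ family y) ≤ η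
    Δ-bound {x} {y} x≢y = begin
      Δ (family x ++ family y)
        ≤⟨ Δ≤overlaps (families-unique x≢y) ⟩
      ∑ (family x ++ family y) (λ B → ∑ (family x ++ family y) (joint B))
        ≡⟨ trans (∑-cong (family x ++ family y) (λ B → ∑-++ (family x) (family y) (joint B)))
             (trans (∑-+ (family x ++ family y) (λ B → ∑ (family x) (joint B)) (λ B → ∑ (family y) (joint B)))
               (cong₂ _+_ (∑-++ (family x) (family y) (λ B → ∑ (family x) (joint B))) (∑-++ (family x) (family y) (λ B → ∑ (family y) (joint B))))) ⟩
      D x x + D y x + (D x y + D y y)
        ≤⟨ +-mono-≤ (+-mono-≤ (bound x x) (bound y x)) (+-mono-≤ (bound x y) (bound y y)) ⟩
      nat 2 * w + nat 2 * w + (nat 2 * w + nat 2 * w)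
        ≡⟨ solve 1 (λ w → con (nat 2) :* w :+ con (nat 2) :* w :+ (con (nat 2) :* w :+ con (nat 2) :* w) := con (nat 8) :* w) refl w ⟩
      η ∎
      where
      open ℚ.≤-Reasoning
      w = q * q * (1ℚ + nat 3 * (nat N * q)) ^ K
      D : G → G → ℚ
      D a b = ∑ (family a) (λ B → ∑ (family b) (joint B))
      bound : ∀ a b → D a b ≤ nat 2 * w
      bound a b = ≤-trans (overlaps-bound a b) (overlapping-bound a b)

    -- Janson's inequality for the concatenated families bounds the joint avoidance by the
    -- independent value, which factorises; Harris' inequality then bounds each factor by the true
    -- avoidance probability.
    decorrelated : ∀ x y → x ≢ 0# → y ≢ 0# → x ≢ y →
      𝔼 (λ S → avoid (family x) S * avoid (family y) S) * (1ℚ - nat 2 * η) ≤ 𝔼 (avoid (family x)) * 𝔼 (avoid (family y))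
    decorrelated x y x≢0 y≢0 x≢y = begin
      𝔼 (λ S → avoid (family x) S * avoid (family y) S) * (1ℚ - nat 2 * η)
        ≡⟨ cong (_* (1ℚ - nat 2 * η)) (𝔼-cong (λ S → sym (avoid-++ (family x) (family y) S))) ⟩
      𝔸 (family x ++ family y) * (1ℚ - nat 2 * η)
        ≤⟨ *-monoˡ (0≤𝔸 (family x ++ family y)) (≤-by (0≤nat 2 ⊠ slack (Δ-bound x≢y))
             (solve 2 (λ a b → con 1ℚ :- con (nat 2) :* a := con 1ℚ :- con (nat 2) :* b :+ con (nat 2) :* (b :- a)) refl (Δ (family x ++ family y)) η)) ⟩
      𝔸 (family x ++ family y) * (1ℚ - nat 2 * Δ (family x ++ family y))
        ≤⟨ janson q≤½ (family x ++ family y) (All.++⁺ (family-nonempty x x≢0) (family-nonempty y y≢0)) ⟩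
      indep (family x ++ family y)
        ≡⟨ indep-++ (family x) (family y) ⟩
      indep (family x) * indep (family y)
        ≤⟨ *-mono-≤ (0≤indep (family x)) (indep≤𝔸 (family x)) (0≤indep (family y)) (indep≤𝔸 (family y)) ⟩
      𝔸 (family x) * 𝔸 (family y) ∎
      where open ℚ.≤-Reasoning

    -- The truncated form of 𝔸 ≥ exp (-(1 + 2q) weight). The number of terms is raised to one that
    -- does not depend on x.
    1≤𝔸*E : ∀ x → x ≢ 0# → 1ℚ ≤ 𝔸 (family x) * E (suc (length (subsets N))) ((1ℚ + nat 2 * q) * weight x)
    1≤𝔸*E x x≢0 = ≤-trans (1≤indep*E (family x) (family-nonempty x x≢0))
      (*-mono-≤ (0≤indep (family x)) (indep≤𝔸 (family x)) (0≤E (suc (length (family x))) 0≤s)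
        (≤-trans (E-monoˡ 0≤s (s≤s (List.length-filter (represents? x) (subsets N))))
          (≤-reflexive (cong (E (suc (length (subsets N)))) (∑-*ˡ (1ℚ + nat 2 * q) (family x) (λ B → q ^ ∥ B ∥))))))
      where
      0≤s : 0ℚ ≤ ∑ (family x) (λ B → (1ℚ + nat 2 * q) * q ^ ∥ B ∥)
      0≤s = 0≤∑ (family x) (λ B → (0≤1 ⊞ 0≤nat 2 ⊠ 0≤q) ⊠ 0≤^ ∥ B ∥ 0≤q)

-- Size estimates

ℕ-^-distrib-* : ∀ a b k → (a ℕ.* b) ℕ.^ k ≡ a ℕ.^ k ℕ.* b ℕ.^ k
ℕ-^-distrib-* a b zero    = refl
ℕ-^-distrib-* a b (suc k) = trans (cong (a ℕ.* b ℕ.*_) (ℕ-^-distrib-* a b k)) (ℕ.[m*n]*[o*p]≡[m*o]*[n*p] a b (a ℕ.^ k) (b ℕ.^ k))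

2^-cancel-≤ : ∀ {m n} → 2 ℕ.^ m ℕ.≤ 2 ℕ.^ n → m ℕ.≤ n
2^-cancel-≤ {m} {n} h = ℕ.≮⇒≥ (λ n<m → ℕ.<⇒≱ (ℕ.^-monoʳ-< 2 (s≤s (s≤s z≤n)) n<m) h)

!≤^ : ∀ d → d ! ℕ.≤ d ℕ.^ d
!≤^ zero    = s≤s z≤n
!≤^ (suc d) = ℕ.*-monoʳ-≤ (suc d) (ℕ.≤-trans (!≤^ d) (ℕ.^-monoˡ-≤ d (ℕ.n≤1+n d)))

module _ (H d n : ℕ) .{{_ : ℕ.NonZero H}} (2≤d : 2 ℕ.≤ d) (big : 2 ℕ.^ (64 ℕ.* H ℕ.+ 5) ℕ.≤ n)
         (n²ᴰ≤ : (n ℕ.* n) ℕ.^ (d ℕ.* d) ℕ.≤ 32 ℕ.^ (d ℕ.* d) ℕ.* 2 ℕ.^ n) where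
  private
    a D : ℕ
    a = 64 ℕ.* H
    D = d ℕ.* d

    1≤n : 1 ℕ.≤ n
    1≤n = ℕ.≤-trans (ℕ.m^n>0 2 (a ℕ.+ 5)) big

  -- The hypothesis `big` gives 2ᵃ · 32 ≤ n², so `n²ᴰ≤` cancels to 2 ^ (a D) ≤ 2ⁿ.
  degree-bound : a ℕ.* D ℕ.≤ n
  degree-bound = 2^-cancel-≤ (ℕ.*-cancelʳ-≤ (2 ℕ.^ (a ℕ.* D)) (2 ℕ.^ n) (32 ℕ.^ D) {{ℕ.m^n≢0 32 D}} (begin
    2 ℕ.^ (a ℕ.* D) ℕ.* 32 ℕ.^ D ≡⟨ cong (ℕ._* 32 ℕ.^ D) (ℕ.^-*-assoc 2 a D) ⟨
    (2 ℕ.^ a) ℕ.^ D ℕ.* 32 ℕ.^ D ≡⟨ ℕ-^-distrib-* (2 ℕ.^ a) 32 D ⟨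
    (2 ℕ.^ a ℕ.* 2 ℕ.^ 5) ℕ.^ D ≡⟨ cong (ℕ._^ D) (ℕ.^-distribˡ-+-* 2 a 5) ⟨
    (2 ℕ.^ (a ℕ.+ 5)) ℕ.^ D ≤⟨ ℕ.^-monoˡ-≤ D (ℕ.≤-trans big (ℕ.m≤m*n n n {{ℕ.>-nonZero 1≤n}})) ⟩
    (n ℕ.* n) ℕ.^ D ≤⟨ n²ᴰ≤ ⟩
    32 ℕ.^ D ℕ.* 2 ℕ.^ n ≡⟨ ℕ.*-comm (32 ℕ.^ D) (2 ℕ.^ n) ⟩
    2 ℕ.^ n ℕ.* 32 ℕ.^ D ∎))
    where open ℕ.≤-Reasoning

  -- The factorial is absorbed through d! ≤ dᵈ and (dᵈ)^(2d) = D^D, and the powers of 2n through 2d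
  -- ≤ d². Multiplying by a^D permits the use of a D ≤ n; what remains is (2H n²)^D, and 2H · 32 = a
  -- explains the 64.
  size-estimate : ∀ r → r ℕ.≤ 2 ℕ.* d → (d ! ℕ.* suc n) ℕ.^ r ℕ.* H ℕ.^ D ℕ.≤ 2 ℕ.^ n
  size-estimate r r≤2d = ℕ.*-cancelʳ-≤ ((d ! ℕ.* suc n) ℕ.^ r ℕ.* H ℕ.^ D) (2 ℕ.^ n) (a ℕ.^ D) {{ℕ.m^n≢0 a D {{ℕ.m*n≢0 64 H}}}} (begin
    (d ! ℕ.* suc n) ℕ.^ r ℕ.* H ℕ.^ D ℕ.* a ℕ.^ D
      ≤⟨ ℕ.*-monoˡ-≤ (a ℕ.^ D) (ℕ.*-monoˡ-≤ (H ℕ.^ D) first) ⟩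
    (D ℕ.* (2 ℕ.* n)) ℕ.^ D ℕ.* H ℕ.^ D ℕ.* a ℕ.^ D
      ≡⟨ trans (cong (ℕ._* a ℕ.^ D) (sym (ℕ-^-distrib-* (D ℕ.* (2 ℕ.* n)) H D))) (sym (ℕ-^-distrib-* (D ℕ.* (2 ℕ.* n) ℕ.* H) a D)) ⟩
    (D ℕ.* (2 ℕ.* n) ℕ.* H ℕ.* a) ℕ.^ D
      ≡⟨ cong (ℕ._^ D) (rearrange D (2 ℕ.* n) H a) ⟩
    (H ℕ.* (2 ℕ.* n) ℕ.* (a ℕ.* D)) ℕ.^ D
      ≤⟨ ℕ.^-monoˡ-≤ D (ℕ.*-monoʳ-≤ (H ℕ.* (2 ℕ.* n)) degree-bound) ⟩
    (H ℕ.* (2 ℕ.* n) ℕ.* n) ℕ.^ D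
      ≡⟨ cong (ℕ._^ D) (trans (cong (ℕ._* n) (sym (ℕ.*-assoc H 2 n))) (ℕ.*-assoc (H ℕ.* 2) n n)) ⟩
    (H ℕ.* 2 ℕ.* (n ℕ.* n)) ℕ.^ D
      ≡⟨ ℕ-^-distrib-* (H ℕ.* 2) (n ℕ.* n) D ⟩
    (H ℕ.* 2) ℕ.^ D ℕ.* (n ℕ.* n) ℕ.^ D
      ≤⟨ ℕ.*-monoʳ-≤ ((H ℕ.* 2) ℕ.^ D) n²ᴰ≤ ⟩
    (H ℕ.* 2) ℕ.^ D ℕ.* (32 ℕ.^ D ℕ.* 2 ℕ.^ n)
      ≡⟨ trans (sym (ℕ.*-assoc ((H ℕ.* 2) ℕ.^ D) (32 ℕ.^ D) (2 ℕ.^ n))) (cong (ℕ._* 2 ℕ.^ n) (trans (sym (ℕ-^-distrib-* (H ℕ.* 2) 32 D)) (cong (ℕ._^ D) (trans (ℕ.*-assoc H 2 32) (ℕ.*-comm H 64))))) ⟩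
    a ℕ.^ D ℕ.* 2 ℕ.^ n
      ≡⟨ ℕ.*-comm (a ℕ.^ D) (2 ℕ.^ n) ⟩
    2 ℕ.^ n ℕ.* a ℕ.^ D ∎)
    where
    open ℕ.≤-Reasoning
    rearrange : ∀ x y z w → x ℕ.* y ℕ.* z ℕ.* w ≡ z ℕ.* y ℕ.* (w ℕ.* x)
    rearrange x y z w = trans (cong (ℕ._* w) (trans (ℕ.*-assoc x y z) (ℕ.*-comm x (y ℕ.* z)))) (trans (ℕ.*-assoc (y ℕ.* z) x w) (cong₂ ℕ._*_ (ℕ.*-comm y z) (ℕ.*-comm x w)))
    1≤2n : 1 ℕ.≤ 2 ℕ.* n
    1≤2n = ℕ.≤-trans 1≤n (ℕ.m≤n*m n 2)
    first : (d ! ℕ.* suc n) ℕ.^ r ℕ.≤ (D ℕ.* (2 ℕ.* n)) ℕ.^ D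
    first = begin
      (d ! ℕ.* suc n) ℕ.^ r
        ≤⟨ ℕ.^-monoʳ-≤ (d ! ℕ.* suc n) {{ℕ.m*n≢0 (d !) (suc n) {{d ℕ.!≢0}}}} r≤2d ⟩
      (d ! ℕ.* suc n) ℕ.^ (2 ℕ.* d)
        ≤⟨ ℕ.^-monoˡ-≤ (2 ℕ.* d) (ℕ.*-mono-≤ (!≤^ d) (ℕ.≤-trans (ℕ.+-monoˡ-≤ n 1≤n) (ℕ.≤-reflexive (cong (n ℕ.+_) (sym (ℕ.+-identityʳ n)))))) ⟩
      (d ℕ.^ d ℕ.* (2 ℕ.* n)) ℕ.^ (2 ℕ.* d)
        ≡⟨ ℕ-^-distrib-* (d ℕ.^ d) (2 ℕ.* n) (2 ℕ.* d) ⟩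
      (d ℕ.^ d) ℕ.^ (2 ℕ.* d) ℕ.* (2 ℕ.* n) ℕ.^ (2 ℕ.* d)
        ≤⟨ ℕ.*-mono-≤ (ℕ.≤-reflexive dd) (ℕ.^-monoʳ-≤ (2 ℕ.* n) {{ℕ.>-nonZero 1≤2n}} (ℕ.*-monoˡ-≤ d 2≤d)) ⟩
      D ℕ.^ D ℕ.* (2 ℕ.* n) ℕ.^ D
        ≡⟨ ℕ-^-distrib-* D (2 ℕ.* n) D ⟨
      (D ℕ.* (2 ℕ.* n)) ℕ.^ D ∎
      where
      dd : (d ℕ.^ d) ℕ.^ (2 ℕ.* d) ≡ D ℕ.^ D
      dd = trans (ℕ.^-*-assoc d d (2 ℕ.* d)) (trans (cong (d ℕ.^_) (trans (sym (ℕ.*-assoc d 2 d)) (trans (cong (ℕ._* d) (ℕ.*-comm d 2)) (ℕ.*-assoc 2 d d))))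
             (trans (sym (ℕ.^-*-assoc d 2 D)) (cong (ℕ._^ D) (cong (d ℕ.*_) (ℕ.*-identityʳ d)))))

-- M stands for max (1 , N q); all error terms are controlled by M^(2d - 1) H^d ≤ N².
module Numerics (c n e : ℕ) .{{_ : ℕ.NonZero c}} where
  H d K N : ℕ
  H = 128 ℕ.* c
  d = suc (suc e)
  K = suc (e ℕ.+ e)
  N = 2 ℕ.^ n

  instance
    H≢0 : ℕ.NonZero H
    H≢0 = ℕ.m*n≢0 128 c
    N≢0 : ℕ.NonZero N
    N≢0 = ℕ.m^n≢0 2 n

  16^e≤H^e : 16 ℕ.^ e ℕ.≤ H ℕ.^ e
  16^e≤H^e = ℕ.^-monoˡ-≤ e (ℕ.≤-trans (ℕ.≤ᵇ⇒≤ 16 128 _) (ℕ.m≤m*n 128 c))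

  4^e+e : 4 ℕ.^ (e ℕ.+ e) ≡ 16 ℕ.^ e
  4^e+e = trans (ℕ.^-distribˡ-+-* 4 e e) (sym (ℕ-^-distrib-* 4 4 e))

  -- The powers of 4 come from 1 + 3Nq ≤ 4M. Since 4ᴷ = 4 · 16ᵉ, e factors H absorb 16ᵉ and the two
  -- remaining ones absorb 8c and 4.
  η-constant : 8 ℕ.* c ℕ.* 4 ℕ.^ K ℕ.≤ H ℕ.^ d
  η-constant = begin
    8 ℕ.* c ℕ.* (4 ℕ.* 4 ℕ.^ (e ℕ.+ e)) ≡⟨ cong (λ z → 8 ℕ.* c ℕ.* (4 ℕ.* z)) 4^e+e ⟩
    8 ℕ.* c ℕ.* (4 ℕ.* 16 ℕ.^ e) ≤⟨ ℕ.*-mono-≤ (ℕ.*-monoˡ-≤ c (ℕ.≤ᵇ⇒≤ 8 128 _)) (ℕ.*-mono-≤ (ℕ.≤-trans (ℕ.≤ᵇ⇒≤ 4 128 _) (ℕ.m≤m*n 128 c)) 16^e≤H^e) ⟩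
    H ℕ.* (H ℕ.* H ℕ.^ e) ∎
    where open ℕ.≤-Reasoning

  low-constant : 4 ℕ.^ e ℕ.* (c ℕ.* c) ℕ.≤ H ℕ.^ d
  low-constant = begin
    4 ℕ.^ e ℕ.* (c ℕ.* c) ≤⟨ ℕ.*-mono-≤ (ℕ.≤-trans (ℕ.^-monoˡ-≤ e (ℕ.≤ᵇ⇒≤ 4 16 _)) 16^e≤H^e) (ℕ.*-mono-≤ (ℕ.m≤n*m c 128) (ℕ.m≤n*m c 128)) ⟩
    H ℕ.^ e ℕ.* (H ℕ.* H) ≡⟨ trans (ℕ.*-comm (H ℕ.^ e) (H ℕ.* H)) (ℕ.*-assoc H H (H ℕ.^ e)) ⟩
    H ℕ.^ d ∎
    where open ℕ.≤-Reasoning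

  module _ (big : 2 ℕ.^ (64 ℕ.* H ℕ.+ 5) ℕ.≤ n)
           (n²ᴰ≤ : (n ℕ.* n) ℕ.^ (d ℕ.* d) ℕ.≤ 32 ℕ.^ (d ℕ.* d) ℕ.* 2 ℕ.^ n)
           {M : ℚ} (1≤M : 1ℚ ≤ M) (Mᵈ≤ : M ^ d ≤ nat (d !) * nat (suc n) * nat N) where

    private
      r : ℕ
      r = suc (suc K)

      0≤M : 0ℚ ≤ M
      0≤M = ≤-trans 0≤1 1≤M

      h : ℚ
      h = nat H

      0≤h : 0ℚ ≤ h
      0≤h = 0≤nat H

    1+r≡2d : suc r ≡ 2 ℕ.* d
    1+r≡2d = cong (suc ∘ suc) (sym (trans (cong (e ℕ.+_) (ℕ.+-identityʳ d)) (trans (ℕ.+-suc e (suc e)) (cong suc (ℕ.+-suc e e)))))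

    -- Proved after raising to the power d, because only Mᵈ is bounded: with r = 2d - 1 the powers
    -- of N add up to Nʳ, and `size-estimate` supplies the one missing factor N of N^(2d).
    M-estimate : M ^ r * h ^ d ≤ nat N ^ 2
    M-estimate = ^-cancel-≤ d (0≤^ 2 (0≤nat N)) (begin
      (M ^ r * h ^ d) ^ d
        ≡⟨ ^-distrib-* (M ^ r) (h ^ d) d ⟩
      (M ^ r) ^ d * (h ^ d) ^ d
        ≡⟨ cong₂ _*_ (trans (^-^ M r d) (trans (cong (M ^_) (ℕ.*-comm r d)) (sym (^-^ M d r)))) (^-^ h d d) ⟩
      (M ^ d) ^ r * h ^ (d ℕ.* d)
        ≤⟨ *-monoʳ (0≤^ (d ℕ.* d) 0≤h) (^-mono r (0≤^ d 0≤M) Mᵈ≤) ⟩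
      (nat (d !) * nat (suc n) * nat N) ^ r * h ^ (d ℕ.* d)
        ≡⟨ trans (cong (_* h ^ (d ℕ.* d)) (^-distrib-* (nat (d !) * nat (suc n)) (nat N) r))
             (solve 3 (λ a b c → a :* b :* c := a :* c :* b) refl ((nat (d !) * nat (suc n)) ^ r) (nat N ^ r) (h ^ (d ℕ.* d))) ⟩
      (nat (d !) * nat (suc n)) ^ r * h ^ (d ℕ.* d) * nat N ^ r
        ≡⟨ cong (_* nat N ^ r) (sym (trans (nat-* ((d ! ℕ.* suc n) ℕ.^ r) (H ℕ.^ (d ℕ.* d))) (cong₂ _*_ (trans (nat-^ (d ! ℕ.* suc n) r) (cong (_^ r) (nat-* (d !) (suc n)))) (nat-^ H (d ℕ.* d))))) ⟩
      nat ((d ! ℕ.* suc n) ℕ.^ r ℕ.* H ℕ.^ (d ℕ.* d)) * nat N ^ r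
        ≤⟨ *-monoʳ (0≤^ r (0≤nat N)) (nat-mono-≤ (size-estimate H d n (s≤s (s≤s z≤n)) big n²ᴰ≤ r (ℕ.≤-trans (ℕ.n≤1+n r) (ℕ.≤-reflexive 1+r≡2d)))) ⟩
      nat N ^ suc r
        ≡⟨ trans (cong (nat N ^_) 1+r≡2d) (sym (^-^ (nat N) 2 d)) ⟩
      (nat N ^ 2) ^ d ∎)
      where open ℚ.≤-Reasoning

    MH≤N : M * h ≤ nat N
    MH≤N = ^-cancel-≤ 2 (0≤nat N) (begin
      (M * h) ^ 2 ≡⟨ ^-distrib-* M h 2 ⟩
      M ^ 2 * h ^ 2 ≤⟨ *-mono-≤ (0≤^ 2 0≤M) (^-monoʳ {a = 2} {b = r} 1≤M (s≤s (s≤s z≤n))) (0≤^ 2 0≤h) (^-monoʳ {a = 2} {b = d} (1≤nat H) (s≤s (s≤s z≤n))) ⟩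
      M ^ r * h ^ d ≤⟨ M-estimate ⟩
      nat N ^ 2 ∎)
      where open ℚ.≤-Reasoning

    module _ {q : ℚ} (0≤q : 0ℚ ≤ q) (m≤M : nat N * q ≤ M) where
      private
        m : ℚ
        m = nat N * q

        0≤m : 0ℚ ≤ m
        0≤m = 0≤nat N ⊠ 0≤q

        1+m≤2M : 1ℚ + m ≤ nat 2 * M
        1+m≤2M = ≤-by (slack 1≤M ⊞ slack m≤M) (solve 2 (λ M m → con (nat 2) :* M := con 1ℚ :+ m :+ ((M :- con 1ℚ) :+ (M :- m))) refl M m)

        1+3m≤4M : 1ℚ + nat 3 * m ≤ nat 4 * M
        1+3m≤4M = ≤-by (slack 1≤M ⊞ 0≤nat 3 ⊠ slack m≤M) (solve 2 (λ M m → con (nat 4) :* M := con 1ℚ :+ con (nat 3) :* m :+ ((M :- con 1ℚ) :+ con (nat 3) :* (M :- m))) refl M m)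

      qH≤1 : q * h ≤ 1ℚ
      qH≤1 = *-cancelˡ (0<nat N) (begin
        nat N * (q * h) ≡⟨ *-assoc (nat N) q h ⟨
        nat N * q * h ≤⟨ *-monoʳ 0≤h m≤M ⟩
        M * h ≤⟨ MH≤N ⟩
        nat N ≡⟨ *-identityʳ (nat N) ⟨
        nat N * 1ℚ ∎)
        where open ℚ.≤-Reasoning

      ηc≤1 : nat 8 * (q * q * (1ℚ + nat 3 * m) ^ K) * nat c ≤ 1ℚ
      ηc≤1 = *-cancelˡ (0<^ 2 (0<nat N)) (begin
        nat N ^ 2 * (nat 8 * (q * q * (1ℚ + nat 3 * m) ^ K) * nat c)
          ≡⟨ solve 4 (λ N q X c → N :* (N :* con 1ℚ) :* (con (nat 8) :* (q :* q :* X) :* c) := N :* q :* (N :* q) :* X :* (con (nat 8) :* c)) refl (nat N) q ((1ℚ + nat 3 * m) ^ K) (nat c) ⟩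
        m * m * (1ℚ + nat 3 * m) ^ K * (nat 8 * nat c)
          ≤⟨ *-monoʳ (0≤nat 8 ⊠ 0≤nat c) (*-mono-≤ (0≤m ⊠ 0≤m) (*-mono-≤ 0≤m m≤M 0≤m m≤M) (0≤^ K (0≤1 ⊞ 0≤nat 3 ⊠ 0≤m)) (^-mono K (0≤1 ⊞ 0≤nat 3 ⊠ 0≤m) 1+3m≤4M)) ⟩
        M * M * (nat 4 * M) ^ K * (nat 8 * nat c)
          ≡⟨ trans (cong (λ z → M * M * z * (nat 8 * nat c)) (^-distrib-* (nat 4) M K))
               (solve 4 (λ M F X c → M :* M :* (F :* X) :* c := M :* (M :* X) :* (c :* F)) refl M (nat 4 ^ K) (M ^ K) (nat 8 * nat c)) ⟩
        M ^ r * (nat 8 * nat c * nat 4 ^ K)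
          ≡⟨ cong (M ^ r *_) (sym (trans (nat-* (8 ℕ.* c) (4 ℕ.^ K)) (cong₂ _*_ (nat-* 8 c) (nat-^ 4 K)))) ⟩
        M ^ r * nat (8 ℕ.* c ℕ.* 4 ℕ.^ K)
          ≤⟨ *-monoˡ (0≤^ r 0≤M) (≤-trans (nat-mono-≤ η-constant) (≤-reflexive (nat-^ H d))) ⟩
        M ^ r * h ^ d
          ≤⟨ M-estimate ⟩
        nat N ^ 2
          ≡⟨ *-identityʳ (nat N ^ 2) ⟨
        nat N ^ 2 * 1ℚ ∎)
        where open ℚ.≤-Reasoning

      lowc≤1 : q * (1ℚ + m) ^ e * nat c ≤ 1ℚ
      lowc≤1 = *-cancelˡ (0<nat N) (begin
        nat N * (q * (1ℚ + m) ^ e * nat c)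
          ≡⟨ solve 4 (λ N q X c → N :* (q :* X :* c) := N :* q :* X :* c) refl (nat N) q ((1ℚ + m) ^ e) (nat c) ⟩
        m * (1ℚ + m) ^ e * nat c
          ≤⟨ *-monoʳ (0≤nat c) (*-mono-≤ 0≤m m≤M (0≤^ e (0≤1 ⊞ 0≤m)) (^-mono e (0≤1 ⊞ 0≤m) 1+m≤2M)) ⟩
        X
          -- `M-estimate` controls N², hence the squaring. The square contains M^(2e + 2), one power
          -- below the available M^(2e + 3).
          ≤⟨ ^-cancel-≤ 2 (0≤nat N) square ⟩
        nat N
          ≡⟨ *-identityʳ (nat N) ⟨
        nat N * 1ℚ ∎)
        where
        open ℚ.≤-Reasoning
        X = M * (nat 2 * M) ^ e * nat c
        square : X ^ 2 ≤ nat N ^ 2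
        square = begin
          X ^ 2
            ≡⟨ trans (cong (λ z → (M * z * nat c) ^ 2) (^-distrib-* (nat 2) M e))
                 (solve 4 (λ M F Y c → M :* (F :* Y) :* c :* (M :* (F :* Y) :* c :* con 1ℚ) := M :* (M :* (Y :* Y)) :* (F :* F :* (c :* c))) refl M (nat 2 ^ e) (M ^ e) (nat c)) ⟩
          M * (M * (M ^ e * M ^ e)) * (nat 2 ^ e * nat 2 ^ e * (nat c * nat c))
            ≡⟨ cong₂ (λ y z → M * (M * y) * (z * (nat c * nat c))) (sym (^-+ M e e)) (sym (^-distrib-* (nat 2) (nat 2) e)) ⟩
          M ^ suc (suc (e ℕ.+ e)) * (nat 4 ^ e * (nat c * nat c))
            ≡⟨ cong (M ^ suc (suc (e ℕ.+ e)) *_) (sym (trans (nat-* (4 ℕ.^ e) (c ℕ.* c)) (cong₂ _*_ (nat-^ 4 e) (nat-* c c)))) ⟩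
          M ^ suc (suc (e ℕ.+ e)) * nat (4 ℕ.^ e ℕ.* (c ℕ.* c))
            ≤⟨ *-mono-≤ (0≤^ (suc (suc (e ℕ.+ e))) 0≤M) (^-monoʳ 1≤M (ℕ.n≤1+n (suc (suc (e ℕ.+ e))))) (0≤nat (4 ℕ.^ e ℕ.* (c ℕ.* c)))
                 (≤-trans (nat-mono-≤ low-constant) (≤-reflexive (nat-^ H d))) ⟩
          M ^ r * h ^ d
            ≤⟨ M-estimate ⟩
          nat N ^ 2 ∎

-- The probability bound for rational parameters

-- With t = x / (n + 1), the hypothesis gives (1 + t)^(n + 1) ≤ 2^(n + 1), hence t ≤ 1.
λ≤1+n : ∀ n {x} → 0ℚ ≤ x → E (suc (suc n)) x ≤ nat 2 * nat (2 ℕ.^ n) → x ≤ nat (suc n)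
λ≤1+n n {x} 0≤x h = begin
  x ≡⟨ nt≡x ⟨
  nat (suc n) * t ≤⟨ *-monoˡ (0≤nat (suc n)) t≤1 ⟩
  nat (suc n) * 1ℚ ≡⟨ *-identityʳ (nat (suc n)) ⟩
  nat (suc n) ∎
  where
  open ℚ.≤-Reasoning
  t = x * recip (suc n)
  nt≡x : nat (suc n) * t ≡ x
  nt≡x = trans (solve 3 (λ n y r → n :* (y :* r) := y :* (r :* n)) refl (nat (suc n)) x (recip (suc n)))
               (trans (cong (x *_) (recip-inverse (suc n))) (*-identityʳ x))
  0≤t : 0ℚ ≤ t
  0≤t = 0≤x ⊠ <⇒≤ (0<recip (suc n))
  1+t≤2 : 1ℚ + t ≤ nat 2
  1+t≤2 = ^-cancel-≤ (suc n) (0≤nat 2) (≤-trans ([1+t]^k≤E (suc n) 0≤t)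
    (≤-trans (≤-reflexive (cong (E (suc (suc n))) nt≡x)) (≤-trans h (≤-reflexive (cong (nat 2 *_) (nat-^ 2 n))))))
  t≤1 : t ≤ 1ℚ
  t≤1 = ≤-by (slack 1+t≤2) (solve 1 (λ t → con 1ℚ := t :+ (con (nat 2) :- (con 1ℚ :+ t))) refl t)

module RationalParameters (c n e : ℕ) .{{_ : ℕ.NonZero c}} (ε λ′ q : ℚ) (0≤ε : 0ℚ ≤ ε) (0≤λ : 0ℚ ≤ λ′) (0≤q : 0ℚ ≤ q)
  (big : 2 ℕ.^ (64 ℕ.* (128 ℕ.* c) ℕ.+ 5) ℕ.≤ n)
  (n²ᴰ≤ : (n ℕ.* n) ℕ.^ (suc (suc e) ℕ.* suc (suc e)) ℕ.≤ 32 ℕ.^ (suc (suc e) ℕ.* suc (suc e)) ℕ.* 2 ℕ.^ n)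
  (E≤2N : E (length (subsets (2 ℕ.^ n)) ℕ.+ suc (suc n)) λ′ ≤ nat 2 * nat (2 ℕ.^ n))
  (q-small : q ^ suc (suc e) * nat (2 ℕ.^ n) ^ suc e ≤ nat (suc (suc e) !) * ((1ℚ - ε) * λ′))
  where
  open Numerics c n e using (d; N; H; N≢0)

  m : ℚ
  m = nat N * q

  λ≤n+1 : λ′ ≤ nat (suc n)
  -- The number of terms in `E≤2N` is a sum so that it dominates both the n + 2 terms used here and
  -- the number required in `avoidance-bound`.
  λ≤n+1 = λ≤1+n n 0≤λ (≤-trans (E-monoˡ 0≤λ (ℕ.m≤n+m (suc (suc n)) (length (subsets N)))) E≤2N)

  scaled-top : q * m ^ suc e ≤ nat (d !) * ((1ℚ - ε) * λ′)
  scaled-top = ≤-trans (≤-reflexive (trans (cong (q *_) (trans (^-distrib-* (nat N) q (suc e)) (*-comm (nat N ^ suc e) (q ^ suc e)))) (sym (*-assoc q (q ^ suc e) (nat N ^ suc e))))) q-small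

  mᵈ≤ : m ^ d ≤ nat (d !) * nat (suc n) * nat N
  mᵈ≤ = begin
    nat N * q * m ^ suc e ≡⟨ *-assoc (nat N) q (m ^ suc e) ⟩
    nat N * (q * m ^ suc e) ≤⟨ *-monoˡ (0≤nat N) (≤-trans scaled-top (*-monoˡ (0≤nat (d !)) [1-ε]λ≤1+n)) ⟩
    nat N * (nat (d !) * nat (suc n)) ≡⟨ *-comm (nat N) (nat (d !) * nat (suc n)) ⟩
    nat (d !) * nat (suc n) * nat N ∎
    where
    open ℚ.≤-Reasoning
    [1-ε]λ≤1+n : (1ℚ - ε) * λ′ ≤ nat (suc n)
    [1-ε]λ≤1+n = ≤-trans (≤-by (0≤ε ⊠ 0≤λ) (solve 2 (λ ε l → l := (con 1ℚ :- ε) :* l :+ ε :* l) refl ε λ′)) λ≤n+1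

  M : ℚ
  M = 1ℚ ℚ.⊔ m

  Mᵈ≤ : M ^ d ≤ nat (d !) * nat (suc n) * nat N
  Mᵈ≤ = go (≤-total 1ℚ m)
    where
    go : 1ℚ ≤ m ⊎ m ≤ 1ℚ → M ^ d ≤ nat (d !) * nat (suc n) * nat N
    go (inj₁ 1≤m) = subst (λ z → z ^ d ≤ nat (d !) * nat (suc n) * nat N) (sym (ℚ.p≤q⇒p⊔q≡q 1≤m)) mᵈ≤
    go (inj₂ m≤1) = subst (λ z → z ^ d ≤ nat (d !) * nat (suc n) * nat N) (sym (ℚ.p≥q⇒p⊔q≡p m≤1)) (subst (_≤ nat (d !) * nat (suc n) * nat N) (sym (1^ d))
      (*-mono-≤ 0≤1 (*-mono-≤ 0≤1 (1≤nat (d !) {{d ℕ.!≢0}}) 0≤1 (1≤nat (suc n))) 0≤1 (1≤nat N)))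

  1≤M : 1ℚ ≤ M
  1≤M = ℚ.p≤p⊔q 1ℚ m

  m≤M : m ≤ M
  m≤M = ℚ.p≤q⊔p 1ℚ m

  qH≤1 : q * nat H ≤ 1ℚ
  qH≤1 = Numerics.qH≤1 c n e big n²ᴰ≤ 1≤M Mᵈ≤ 0≤q m≤M

  ηc≤1 : nat 8 * (q * q * (1ℚ + nat 3 * m) ^ suc (e ℕ.+ e)) * nat c ≤ 1ℚ
  ηc≤1 = Numerics.ηc≤1 c n e big n²ᴰ≤ 1≤M Mᵈ≤ 0≤q m≤M

  lowc≤1 : q * (1ℚ + m) ^ e * nat c ≤ 1ℚ
  lowc≤1 = Numerics.lowc≤1 c n e big n²ᴰ≤ 1≤M Mᵈ≤ 0≤q m≤M

  qc≤1 : q * nat c ≤ 1ℚ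
  qc≤1 = ≤-trans (*-monoˡ 0≤q (nat-mono-≤ (ℕ.m≤n*m c 128))) qH≤1

  q≤½ : q ≤ ½
  q≤½ = *-cancelʳ (0<nat 2) (≤-trans (*-monoˡ 0≤q (nat-mono-≤ (ℕ.≤-trans (ℕ.≤ᵇ⇒≤ 2 128 _) (ℕ.m≤m*n 128 c)))) qH≤1)

  q≤1 : q ≤ 1ℚ
  q≤1 = ≤-trans q≤½ ½≤1

module RationalBound (G : Set) (_≟_ : DecidableEquality G) (_∙_ : G → G → G) (0# : G)
  (assoc : ∀ x y z → (x ∙ y) ∙ z ≡ x ∙ (y ∙ z)) (comm : ∀ x y → x ∙ y ≡ y ∙ x)
  (identityʳ : ∀ x → x ∙ 0# ≡ x) (self-inverse : ∀ x → x ∙ x ≡ 0#)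
  (c n e : ℕ) .{{_ : ℕ.NonZero c}} (v : Fin (2 ℕ.^ n) → G) (v-injective : ∀ {i j} → v i ≡ v j → i ≡ j)
  (ε λ′ q : ℚ) (0≤ε : 0ℚ ≤ ε) (0≤λ : 0ℚ ≤ λ′) (0≤q : 0ℚ ≤ q)
  (big : 2 ℕ.^ (64 ℕ.* (128 ℕ.* c) ℕ.+ 5) ℕ.≤ n)
  (n²ᴰ≤ : (n ℕ.* n) ℕ.^ (suc (suc e) ℕ.* suc (suc e)) ℕ.≤ 32 ℕ.^ (suc (suc e) ℕ.* suc (suc e)) ℕ.* 2 ℕ.^ n)
  (E≤2N : E (length (subsets (2 ℕ.^ n)) ℕ.+ suc (suc n)) λ′ ≤ nat 2 * nat (2 ℕ.^ n))
  (q-small : q ^ suc (suc e) * nat (2 ℕ.^ n) ^ suc e ≤ nat (suc (suc e) !) * ((1ℚ - ε) * λ′))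
  (n≤4λ : nat n ≤ nat 4 * λ′) (10≤εc : nat 10 ≤ ε * nat c) (4≤c : 4 ℕ.≤ c)
  where
  open Numerics c n e using (d; N; N≢0)
  open RationalParameters c n e ε λ′ q 0≤ε 0≤λ 0≤q big n²ᴰ≤ E≤2N q-small
  open Families G _≟_ _∙_ 0# assoc comm identityʳ self-inverse v v-injective e using (family)
  module F = Families G _≟_ _∙_ 0# assoc comm identityʳ self-inverse v v-injective e
  open RandomSubset q 0≤q q≤1

  private
    1≤n : 1 ℕ.≤ n
    1≤n = ℕ.≤-trans (ℕ.m^n>0 2 (64 ℕ.* (128 ℕ.* c) ℕ.+ 5)) big

    4≤n : 4 ℕ.≤ n
    4≤n = ℕ.≤-trans (ℕ.≤-trans (ℕ.≤ᵇ⇒≤ 4 32 _) (ℕ.^-monoʳ-≤ 2 (ℕ.m≤n+m 5 (64 ℕ.* (128 ℕ.* c))))) big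

    1≤λ : 1ℚ ≤ λ′
    1≤λ = *-cancelˡ (0<nat 4) (≤-trans (nat-mono-≤ 4≤n) n≤4λ)

    0≤c : 0ℚ ≤ nat c
    0≤c = 0≤nat c

  -- Half of ε is spent here. The subsets smaller than d and the factor 1 + 2q each cause a relative
  -- error of order 1 / c, and ε c ≥ 10 covers both. Everything is multiplied by c² to clear
  -- denominators.
  weight-bound : ∀ x → x ≢ 0# → (1ℚ + nat 2 * q) * F.weight q 0≤q q≤1 q≤½ x ≤ (1ℚ - ½ * ε) * λ′
  weight-bound x x≢0 = *-cancelʳ (*-pos (0<nat c) (0<nat c)) (begin
    (1ℚ + nat 2 * q) * w * (C * C)
      ≡⟨ solve 3 (λ q w C → (con 1ℚ :+ con (nat 2) :* q) :* w :* (C :* C) := (C :+ con (nat 2) :* (q :* C)) :* (w :* C)) refl q w C ⟩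
    (C + nat 2 * (q * C)) * (w * C)
      ≤⟨ *-mono-≤ (0≤c ⊞ 0≤nat 2 ⊠ (0≤q ⊠ 0≤c)) (ℚ.+-monoʳ-≤ C (*-monoˡ (0≤nat 2) qc≤1)) (0≤w ⊠ 0≤c) wC≤ ⟩
    (C + nat 2 * 1ℚ) * (λ′ + (1ℚ - ε) * λ′ * C)
      ≤⟨ ≤-by (0≤λ ⊠ (½C ⊠ slack 10≤εc ⊞ 0≤nat 2 ⊠ slack 1≤C ⊞ 0≤nat 2 ⊠ (0≤ε ⊠ 0≤c))) (solve 3 (λ C l ε →
           (con 1ℚ :- con ½ :* ε) :* l :* (C :* C) :=
           (C :+ con (nat 2) :* con 1ℚ) :* (l :+ (con 1ℚ :- ε) :* l :* C) :+
           l :* (con ½ :* C :* (ε :* C :- con (nat 10)) :+ con (nat 2) :* (C :- con 1ℚ) :+ con (nat 2) :* (ε :* C))) refl C λ′ ε) ⟩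
    (1ℚ - ½ * ε) * λ′ * (C * C) ∎)
    where
    open ℚ.≤-Reasoning
    C = nat c
    w = F.weight q 0≤q q≤1 q≤½ x
    ½C : 0ℚ ≤ ½ * C
    ½C = 0≤½ ⊠ 0≤c
    1≤C : 1ℚ ≤ C
    1≤C = 1≤nat c
    0≤w : 0ℚ ≤ w
    0≤w = 0≤∑ (family x) (λ B → 0≤^ ∥ B ∥ 0≤q)
    top≤ : F.top q 0≤q q≤1 q≤½ x ≤ (1ℚ - ε) * λ′
    top≤ = *-cancelˡ (0<nat (d !) {{d ℕ.!≢0}}) (≤-trans (F.top-bound q 0≤q q≤1 q≤½ x) scaled-top)
    wC≤ : w * C ≤ λ′ + (1ℚ - ε) * λ′ * C
    wC≤ = begin
      w * C ≡⟨ trans (cong (_* C) (F.weight≡low+top q 0≤q q≤1 q≤½ x)) (ℚ.*-distribʳ-+ C (F.low q 0≤q q≤1 q≤½ x) (F.top q 0≤q q≤1 q≤½ x)) ⟩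
      F.low q 0≤q q≤1 q≤½ x * C + F.top q 0≤q q≤1 q≤½ x * C
                                        ≤⟨ +-mono-≤ (≤-trans (*-monoʳ 0≤c (F.low-bound q 0≤q q≤1 q≤½ x x≢0)) (≤-trans lowc≤1 1≤λ)) (*-monoʳ 0≤c top≤) ⟩
      λ′ + (1ℚ - ε) * λ′ * C ∎

  -- The constant fits 2κ = ε n / 8 ≤ ½ ε λ, which follows from n ≤ 4λ.
  κ : ℚ
  κ = ε * nat n * recip 16

  -- The avoidance probability is at least 1 / exp ((1 - ½ε) λ). Multiplying that exponential by 1 +
  -- ½ε λ still gives at most exp λ, which is at most 2N in truncated form, so the unspent half of ε
  -- appears as a factor linear in log N.
  avoidance-bound : ∀ x → x ≢ 0# → κ ≤ 𝔼 (avoid (family x)) * nat N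
  avoidance-bound x x≢0 = *-cancelˡ (0<nat 2) (begin
    nat 2 * κ
      ≤⟨ ≤-by (0≤1 ⊞ recip8 ⊠ (0≤ε ⊠ slack n≤4λ)) (solve 3 (λ ε n l → con 1ℚ :+ con ½ :* ε :* l := con (nat 2) :* (ε :* n :* con (recip 16)) :+ (con 1ℚ :+ con (recip 8) :* (ε :* (con (nat 4) :* l :- n)))) refl ε (nat n) λ′) ⟩
    1ℚ + ½ * ε * λ′
      ≡⟨ *-identityˡ (1ℚ + ½ * ε * λ′) ⟨
    1ℚ * (1ℚ + ½ * ε * λ′)
      ≤⟨ *-monoʳ (0≤1 ⊞ 0≤t) (F.1≤𝔸*E q 0≤q q≤1 q≤½ x x≢0) ⟩
    A * E m₀ s * (1ℚ + ½ * ε * λ′)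
      ≤⟨ *-monoʳ (0≤1 ⊞ 0≤t) (*-monoˡ 0≤A (E-mono m₀ 0≤s (weight-bound x x≢0))) ⟩
    A * E m₀ ((1ℚ - ½ * ε) * λ′) * (1ℚ + ½ * ε * λ′)
      ≡⟨ *-assoc A (E m₀ ((1ℚ - ½ * ε) * λ′)) (1ℚ + ½ * ε * λ′) ⟩
    A * (E m₀ ((1ℚ - ½ * ε) * λ′) * (1ℚ + ½ * ε * λ′))
      ≤⟨ *-monoˡ 0≤A (E-shift-lower m₀ (≤-trans 0≤s (weight-bound x x≢0)) 0≤t) ⟩
    A * E (suc m₀) ((1ℚ - ½ * ε) * λ′ + ½ * ε * λ′)
      ≡⟨ cong (λ z → A * E (suc m₀) z) (solve 2 (λ ε l → (con 1ℚ :- con ½ :* ε) :* l :+ con ½ :* ε :* l := l) refl ε λ′) ⟩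
    A * E (suc m₀) λ′
      ≤⟨ *-monoˡ 0≤A (≤-trans (E-monoˡ 0≤λ m₀<) E≤2N) ⟩
    A * (nat 2 * nat N)
      ≡⟨ solve 3 (λ A t N → A :* (t :* N) := t :* (A :* N)) refl A (nat 2) (nat N) ⟩
    nat 2 * (A * nat N) ∎)
    where
    open ℚ.≤-Reasoning
    m₀ = suc (length (subsets N))
    A = 𝔼 (avoid (family x))
    s = (1ℚ + nat 2 * q) * F.weight q 0≤q q≤1 q≤½ x
    0≤A : 0ℚ ≤ A
    0≤A = 0≤𝔼 (0≤avoid (family x))
    0≤s : 0ℚ ≤ s
    0≤s = (0≤1 ⊞ 0≤nat 2 ⊠ 0≤q) ⊠ 0≤∑ (family x) (λ B → 0≤^ ∥ B ∥ 0≤q)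
    0≤t : 0ℚ ≤ ½ * ε * λ′
    0≤t = 0≤½ ⊠ 0≤ε ⊠ 0≤λ
    recip8 : 0ℚ ≤ recip 8
    recip8 = <⇒≤ (0<recip 8)
    m₀< : suc m₀ ℕ.≤ length (subsets N) ℕ.+ suc (suc n)
    m₀< = ℕ.≤-trans (ℕ.≤-reflexive (sym (trans (ℕ.+-suc (length (subsets N)) 1) (cong suc (trans (ℕ.+-suc (length (subsets N)) 0) (cong suc (ℕ.+-identityʳ _)))))))
      (ℕ.+-monoʳ-≤ (length (subsets N)) (s≤s (s≤s z≤n)))

  nonzero? : Decidable (λ x → ¬ (x ≡ 0#))
  nonzero? x = ¬? (x ≟ 0#)

  nonzero : List G
  nonzero = filter nonzero? (List.map v (allFin N))

  nonzero-unique : Unique nonzero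
  nonzero-unique = Unique.filter⁺ nonzero? (Unique.map⁺ v-injective (Unique.allFin⁺ N))

  half-nonzero : ∀ {k} → 0ℚ ≤ k → ½ * nat N * k ≤ ∑ nonzero (λ _ → k)
  half-nonzero {k} 0≤k = begin
    ½ * nat N * k
      ≤⟨ *-monoʳ {½ * nat N} {nat N - 1ℚ} 0≤k (≤-by (0≤½ ⊠ slack (nat-mono-≤ 2≤N)) (solve 1 (λ N → N :- con 1ℚ := con ½ :* N :+ con ½ :* (N :- con (nat 2))) refl (nat N))) ⟩
    (nat N - 1ℚ) * k
      ≤⟨ *-monoʳ {nat N - 1ℚ} {nat N - ∑ (allFin N) zero?} 0≤k (≤-by (slack atMostOne) (solve 2 (λ N z → N :- z := N :- con 1ℚ :+ (con 1ℚ :- z)) refl (nat N) (∑ (allFin N) zero?))) ⟩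
    (nat N - ∑ (allFin N) zero?) * k
      ≡⟨ cong (_* k) count ⟨
    ∑ (allFin N) (λ i → ⟦ does (nonzero? (v i)) ⟧) * k
      ≡⟨ ∑-*ʳ k (allFin N) (λ i → ⟦ does (nonzero? (v i)) ⟧) ⟨
    ∑ (allFin N) (λ i → ⟦ does (nonzero? (v i)) ⟧ * k)
      ≡⟨ ∑-map v (allFin N) (λ x → ⟦ does (nonzero? x) ⟧ * k) ⟨
    ∑ (List.map v (allFin N)) (λ x → ⟦ does (nonzero? x) ⟧ * k)
      ≡⟨ ∑-filter nonzero? (List.map v (allFin N)) (λ _ → k) ⟨
    ∑ nonzero (λ _ → k) ∎
    where
    open ℚ.≤-Reasoning
    zero? : Fin N → ℚ
    zero? i = ⟦ does (v i ≟ 0#) ⟧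
    2≤N : 2 ℕ.≤ N
    2≤N = ℕ.^-monoʳ-≤ 2 1≤n
    atMostOne : ∑ (allFin N) zero? ≤ 1ℚ
    atMostOne = ∑-unique (Unique.allFin⁺ N) (λ i → does (v i ≟ 0#)) (λ i j hi hj → v-injective (trans (does-true (v i ≟ 0#) hi) (sym (does-true (v j ≟ 0#) hj))))
    complement : ∀ b → ⟦ not b ⟧ + ⟦ b ⟧ ≡ 1ℚ
    complement true  = refl
    complement false = refl
    count : ∑ (allFin N) (λ i → ⟦ does (nonzero? (v i)) ⟧) ≡ nat N - ∑ (allFin N) zero?
    count = trans (solve 2 (λ a b → a := a :+ b :- b) refl (∑ (allFin N) (λ i → ⟦ does (nonzero? (v i)) ⟧)) (∑ (allFin N) zero?))
      (cong (_- ∑ (allFin N) zero?) (trans (sym (∑-+ (allFin N) (λ i → ⟦ not (does (v i ≟ 0#)) ⟧) zero?))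
        (trans (∑-cong (allFin N) (λ i → complement (does (v i ≟ 0#)))) (trans (∑-const (allFin N) 1ℚ) (trans (*-identityʳ _) (cong nat (List.length-tabulate {n = N} id)))))))

  module _ (δ : ℚ) (8≤δc : nat 8 ≤ δ * nat c) (128≤εδn : nat 128 ≤ ε * δ * nat n) (0≤δ : 0ℚ ≤ δ)
           (covered : Subset N → Bool) (covers : ∀ S → covered S ≡ true → ∀ x → x ≢ 0# → avoid (family x) S ≡ 0ℚ) where

    private
      η = F.η q 0≤q q≤1 q≤½

      0≤η : 0ℚ ≤ η
      0≤η = F.0≤η q 0≤q q≤1 q≤½

      η≤¼ : η ≤ ½ * ½
      η≤¼ = *-cancelʳ (0<nat 4) (≤-trans (*-monoˡ 0≤η (nat-mono-≤ 4≤c)) ηc≤1)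

      8η≤δ : nat 8 * η ≤ δ
      8η≤δ = ≤-trans (*-monoʳ 0≤η 8≤δc) (≤-trans (≤-reflexive (solve 3 (λ δ c η → δ :* c :* η := δ :* (η :* c)) refl δ (nat c) η))
        (subst (δ * (η * nat c) ≤_) (*-identityʳ δ) (*-monoˡ 0≤δ ηc≤1)))

      once : ∀ x → ∑ nonzero (λ y → ⟦ does (x ≟ y) ⟧) ≤ 1ℚ
      once x = ∑-unique nonzero-unique (λ y → does (x ≟ y)) (λ y z hy hz → trans (sym (does-true (x ≟ y) hy)) (does-true (x ≟ z) hz))

      nonzero-all : All (λ x → ¬ (x ≡ 0#)) nonzero
      nonzero-all = All.all-filter nonzero? (List.map v (allFin N))

      module SM = SecondMoment q 0≤q q≤1
      a : G → Subset N → ℚ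
      a x = avoid (family x)

      mean : ℚ
      mean = ∑ nonzero (λ x → 𝔼 (a x))

      0≤mean : 0ℚ ≤ mean
      0≤mean = 0≤∑ nonzero (λ x → 0≤𝔼 (0≤avoid (family x)))

      mean-bound : ½ * κ ≤ mean
      mean-bound = *-cancelʳ (0<nat N) (begin
        ½ * κ * nat N ≡⟨ solve 3 (λ h k N → h :* k :* N := h :* N :* k) refl ½ κ (nat N) ⟩
        ½ * nat N * κ ≤⟨ half-nonzero (0≤ε ⊠ 0≤nat n ⊠ <⇒≤ (0<recip 16)) ⟩
        ∑ nonzero (λ _ → κ) ≤⟨ ∑-mono-All (All.map (λ {x} x≢0 → avoidance-bound x x≢0) nonzero-all) ⟩
        ∑ nonzero (λ x → 𝔼 (a x) * nat N) ≡⟨ ∑-*ʳ (nat N) nonzero (λ x → 𝔼 (a x)) ⟩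
        mean * nat N ∎)
        where open ℚ.≤-Reasoning

      4≤δmean : nat 4 ≤ δ * mean
      4≤δmean = ≤-trans (≤-by (<⇒≤ (0<recip 32) ⊠ slack 128≤εδn)
        (solve 3 (λ ε δ n → δ :* (con ½ :* (ε :* n :* con (recip 16))) := con (nat 4) :+ con (recip 32) :* (ε :* δ :* n :- con (nat 128))) refl ε δ (nat n))) (*-monoˡ 0≤δ mean-bound)

      0<mean : 0ℚ < mean
      0<mean = ℚ.≰⇒> (λ mean≤0 → ≤⇒≯ (≤-trans 4≤δmean (subst (δ * mean ≤_) (*-zeroʳ δ) (*-monoˡ 0≤δ mean≤0))) (0<nat 4))

    -- In the Chebyshev bound 2 + 4 η mean, each summand is at most half of δ mean: the first
    -- because δ mean ≥ 4, the second because 8η ≤ δ.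
    covered-bound : 𝔼 (λ S → ⟦ covered S ⟧) ≤ δ
    covered-bound = *-cancelʳ 0<mean (≤-trans
      (SM.chebyshev _≟_ (λ x → ¬ (x ≡ 0#)) nonzero nonzero-all once a (λ x → 0≤avoid (family x)) (λ x → avoid≤1 (family x)) η 0≤η η≤¼
        (F.decorrelated q 0≤q q≤1 q≤½) covered vanish 0<mean)
      (≤-by (0≤½ ⊠ slack 4≤δmean ⊞ 0≤½ ⊠ (slack 8η≤δ ⊠ 0≤mean))
        (solve 3 (λ δ η m → δ :* m := con (nat 2) :+ con (nat 4) :* η :* m :+ (con ½ :* (δ :* m :- con (nat 4)) :+ con ½ :* ((δ :- con (nat 8) :* η) :* m))) refl δ η mean)))
      where
      ∑-vanish : ∀ {xs : List G} {f : G → ℚ} → All (λ x → f x ≡ 0ℚ) xs → ∑ xs f ≡ 0ℚ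
      ∑-vanish []       = refl
      ∑-vanish (h ∷ hs) = trans (cong₂ _+_ h (∑-vanish hs)) (+-identityˡ 0ℚ)
      vanish : ∀ S → covered S ≡ true → ∑ nonzero (λ x → a x S) ≡ 0ℚ
      vanish S h = ∑-vanish (All.map (λ {x} x≢0 → covers S h x x≢0) nonzero-all)

-- Walks in Cayley graphs of ℤ₂ⁿ

ι-⊥ : ∀ {N} (S : Subset N) → ι ⊥ S ≡ 1ℚ
ι-⊥ []      = refl
ι-⊥ (_ ∷ S) = ι-⊥ S

avoid-hit : ∀ {N} {Bs : List (Subset N)} {B S} → B ∈ˡ Bs → ι B S ≡ 1ℚ → avoid Bs S ≡ 0ℚ
avoid-hit {Bs = B ∷ Bs} {S = S} (here refl) h = trans (cong (λ z → (1ℚ - z) * avoid Bs S) h) (*-zeroˡ (avoid Bs S))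
avoid-hit {Bs = B ∷ Bs} {S = S} (there B∈) h = trans (cong ((1ℚ - ι B S) *_) (avoid-hit B∈ h)) (*-zeroʳ (1ℚ - ι B S))

-- Flipping, not adding: a generator used twice along a walk cancels in a group of exponent two.
toggle : ∀ {N} → Subset N → Fin N → Subset N
toggle B i = Vec.updateAt B i not

∥toggle∥≤ : ∀ {N} (B : Subset N) i → ∥ toggle B i ∥ ℕ.≤ suc ∥ B ∥
∥toggle∥≤ (inside  ∷ B) Fin.zero    = ℕ.m≤n⇒m≤1+n (ℕ.n≤1+n ∥ B ∥)
∥toggle∥≤ (outside ∷ B) Fin.zero    = ℕ.≤-refl
∥toggle∥≤ (inside  ∷ B) (Fin.suc i) = s≤s (∥toggle∥≤ B i)
∥toggle∥≤ (outside ∷ B) (Fin.suc i) = ∥toggle∥≤ B i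

ι-toggle : ∀ {N} (B S : Subset N) i → lookup S i ≡ inside → ι B S ≡ 1ℚ → ι (toggle B i) S ≡ 1ℚ
ι-toggle (inside  ∷ B) (inside  ∷ S) Fin.zero    _ h = h
ι-toggle (outside ∷ B) (inside  ∷ S) Fin.zero    _ h = h
ι-toggle (inside  ∷ B) (inside  ∷ S) (Fin.suc i) k h = ι-toggle B S i k h
ι-toggle (inside  ∷ B) (outside ∷ S) (Fin.suc i) k h = contradiction (sym h) ℚ.1≢0
ι-toggle (outside ∷ B) (_       ∷ S) (Fin.suc i) k h = ι-toggle B S i k h

module Elementary (n : ℕ) where
  open FiniteGroup (ℤ₂^ n) using (order; to; from; strictlyInverseˡ; strictlyInverseʳ)
  open RandomCayley (ℤ₂^ n) using (module Γ; diameter≤?)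

  V : Set
  V = Vec Parity n

  infixl 7 _∙_
  _∙_ : V → V → V
  _∙_ = Vec.zipWith ℙ._+_

  0# : V
  0# = Vec.replicate n 0ℙ

  _≟ⱽ_ : DecidableEquality V
  _≟ⱽ_ = Vec.≡-dec ℙ._≟_

  ∙-assoc : ∀ x y z → (x ∙ y) ∙ z ≡ x ∙ (y ∙ z)
  ∙-assoc = Vec.zipWith-assoc ℙ.+-assoc

  ∙-comm : ∀ x y → x ∙ y ≡ y ∙ x
  ∙-comm = Vec.zipWith-comm ℙ.+-comm

  ∙-identityʳ : ∀ x → x ∙ 0# ≡ x
  ∙-identityʳ = Vec.zipWith-identityʳ ℙ.+-identityʳ

  ∙-self : ∀ x → x ∙ x ≡ 0#
  ∙-self x = trans (cong (_∙ x) (sym (Vec.map-id x))) (Vec.zipWith-inverseˡ {⁻¹ = id} ℙ.p+p≡0ℙ x)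

  from-injective : ∀ {i j : Fin (2 ℕ.^ n)} → from i ≡ from j → i ≡ j
  from-injective {i} {j} eq = trans (sym (strictlyInverseˡ i)) (trans (cong to eq) (strictlyInverseˡ j))

  open SubsetSums V _≟ⱽ_ _∙_ 0# ∙-assoc ∙-comm ∙-identityʳ ∙-self

  total-toggle : ∀ {N} (v : Fin N → V) B i → total v (toggle B i) ≡ v i ∙ total v B
  total-toggle v (inside  ∷ B) Fin.zero    = sym (trans (sym (∙-assoc (v Fin.zero) (v Fin.zero) t)) (trans (cong (_∙ t) (∙-self (v Fin.zero))) (trans (∙-comm 0# t) (∙-identityʳ t))))
    where t = total (v ∘ Fin.suc) B
  total-toggle v (outside ∷ B) Fin.zero    = refl
  total-toggle v (inside  ∷ B) (Fin.suc i) = trans (cong (v Fin.zero ∙_) (total-toggle (v ∘ Fin.suc) B i)) (swap-front (v Fin.zero) (v (Fin.suc i)) (total (v ∘ Fin.suc) B))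
  total-toggle v (outside ∷ B) (Fin.suc i) = total-toggle (v ∘ Fin.suc) B i

  -- `B` collects the generators used an odd number of times. The sum of all steps is unchanged and
  -- the size cannot exceed the length. Both orientations of an edge give the same generator, since
  -- every element is its own inverse.
  walk⇒subset : ∀ {S k g h} → Γ.Walk S k g h → ∃[ B ] ι B S ≡ 1ℚ × ∥ B ∥ ℕ.≤ k × total from B ≡ g ∙ h
  walk⇒subset {S} {g = g} (Cayley.done refl) =
    ⊥ , ι-⊥ S , ℕ.≤-reflexive (Subset.∣⊥∣≡0 order) , trans (total-empty from ⊥ (Subset.∣⊥∣≡0 order)) (sym (∙-self g))
  walk⇒subset {S} {g = g} {h = h} (Cayley.step {w = w} (_ , edge) walk) =
    toggle B i , ι-toggle B S i i∈S B⊆S , ℕ.≤-trans (∥toggle∥≤ B i) (s≤s ∥B∥≤) , (begin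
      total from (toggle B i) ≡⟨ total-toggle from B i ⟩
      from i ∙ total from B ≡⟨ cong₂ _∙_ from-i totalB ⟩
      (g ∙ w) ∙ (w ∙ h) ≡⟨ ∙-assoc (g ∙ w) w h ⟨
      ((g ∙ w) ∙ w) ∙ h ≡⟨ cong (_∙ h) (undo g w) ⟩
      g ∙ h ∎)
    where
    open ≡-Reasoning
    rec = walk⇒subset walk
    B = proj₁ rec
    B⊆S = proj₁ (proj₂ rec)
    ∥B∥≤ = proj₁ (proj₂ (proj₂ rec))
    totalB = proj₂ (proj₂ (proj₂ rec))
    generators : to (Vec.map id g ∙ w) ∈ S ⊎ to (Vec.map id w ∙ g) ∈ S → ∃[ i ] lookup S i ≡ inside × from i ≡ g ∙ w
    generators (inj₁ s) = to (Vec.map id g ∙ w) , Vec.[]=⇒lookup s , trans (strictlyInverseʳ _) (cong (_∙ w) (Vec.map-id g))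
    generators (inj₂ s) = to (Vec.map id w ∙ g) , Vec.[]=⇒lookup s , trans (strictlyInverseʳ _) (trans (cong (_∙ g) (Vec.map-id w)) (∙-comm w g))
    generator = generators edge
    i = proj₁ generator
    i∈S = proj₁ (proj₂ generator)
    from-i = proj₂ (proj₂ generator)

  diameter⇒covered : ∀ e S → does (diameter≤? (suc (suc e)) S) ≡ true → ∀ x →
    avoid (Families.family V _≟ⱽ_ _∙_ 0# ∙-assoc ∙-comm ∙-identityʳ ∙-self from from-injective e x) S ≡ 0ℚ
  diameter⇒covered e S h x with does-true (diameter≤? (suc (suc e)) S) h 0# x
  ... | k , k≤d , walk with walk⇒subset walk
  ...   | B , B⊆S , ∥B∥≤k , eq = avoid-hit
    (Families.∈-family V _≟ⱽ_ _∙_ 0# ∙-assoc ∙-comm ∙-identityʳ ∙-self from from-injective e x B (trans eq (trans (∙-comm 0# x) (∙-identityʳ x))) (ℕ.≤-trans ∥B∥≤k k≤d)) B⊆S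

-- Probabilities as polynomials

seq-^ℝ : ∀ x k j → seq (x ^ℝ k) j ≡ seq x j ^ k
seq-^ℝ x zero    j = refl
seq-^ℝ x (suc k) j = cong (seq x j *_) (seq-^ℝ x k j)

seq-ΣSubset : ∀ N (f : Subset N → ℝ) j → seq (ΣSubset N f) j ≡ ∑ (subsets N) (λ S → seq (f S) j)
seq-ΣSubset zero    f j = sym (+-identityʳ _)
seq-ΣSubset (suc N) f j = trans (cong₂ _+_ (seq-ΣSubset N (λ S → f (inside ∷ S)) j) (seq-ΣSubset N (λ S → f (outside ∷ S)) j))
  (sym (∑-subsets-suc {N} (λ S → seq (f S) j)))

∑-weights : ∀ N q (f : Subset N → ℚ) → ∑ (subsets N) (λ S → f S * (q ^ ∥ S ∥ * (1ℚ - q) ^ (N ℕ.∸ ∥ S ∥))) ≡ expect q f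
∑-weights zero    q f = solve 1 (λ a → a :* (con 1ℚ :* con 1ℚ) :+ con 0ℚ := a) refl (f [])
∑-weights (suc N) q f = trans (∑-subsets-suc {N} (λ S → f S * (q ^ ∥ S ∥ * (1ℚ - q) ^ (suc N ℕ.∸ ∥ S ∥)))) (cong₂ _+_
  (trans (∑-cong (subsets N) (λ S → solve 4 (λ f q a b → f :* (q :* a :* b) := q :* (f :* (a :* b))) refl (f (inside ∷ S)) q (q ^ ∥ S ∥) ((1ℚ - q) ^ (N ℕ.∸ ∥ S ∥))))
    (trans (∑-*ˡ q (subsets N) (λ S → f (inside ∷ S) * (q ^ ∥ S ∥ * (1ℚ - q) ^ (N ℕ.∸ ∥ S ∥)))) (cong (q *_) (∑-weights N q (λ S → f (inside ∷ S))))))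
  (trans (∑-cong (subsets N) (λ S → trans (cong (λ z → f (outside ∷ S) * (q ^ ∥ S ∥ * (1ℚ - q) ^ z)) (ℕ.+-∸-assoc 1 (Subset.∣p∣≤n S)))
      (solve 4 (λ f r a b → f :* (a :* (r :* b)) := r :* (f :* (a :* b))) refl (f (outside ∷ S)) (1ℚ - q) (q ^ ∥ S ∥) ((1ℚ - q) ^ (N ℕ.∸ ∥ S ∥)))))
    (trans (∑-*ˡ (1ℚ - q) (subsets N) (λ S → f (outside ∷ S) * (q ^ ∥ S ∥ * (1ℚ - q) ^ (N ℕ.∸ ∥ S ∥)))) (cong ((1ℚ - q) *_) (∑-weights N q (λ S → f (outside ∷ S)))))))

-- The equality is exact for each j: real arithmetic acts termwise, so the j-th approximation of the
-- probability is the same polynomial at the j-th approximation of p.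
seq-Pr : ∀ p N {P : Subset N → Set} (P? : Decidable P) j → seq (Pr p N P P?) j ≡ expect (seq p j) (λ S → ⟦ does (P? S) ⟧)
seq-Pr p N P? j = trans (seq-ΣSubset N _ j) (trans (∑-cong (subsets N) (λ S → summand S (does (P? S)))) (∑-weights N (seq p j) (λ S → ⟦ does (P? S) ⟧)))
  where
  summand : ∀ (S : Subset N) b → seq (if b then p ^ℝ ∥ S ∥ *ℝ (1ℝ -ℝ p) ^ℝ (N ℕ.∸ ∥ S ∥) else 0ℝ) j ≡ ⟦ b ⟧ * (seq p j ^ ∥ S ∥ * (1ℚ - seq p j) ^ (N ℕ.∸ ∥ S ∥))
  summand S true  = trans (cong₂ _*_ (seq-^ℝ p ∥ S ∥ j) (seq-^ℝ (1ℝ -ℝ p) (N ℕ.∸ ∥ S ∥) j)) (sym (*-identityˡ _))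
  summand S false = sym (*-zeroˡ (seq p j ^ ∥ S ∥ * (1ℚ - seq p j) ^ (N ℕ.∸ ∥ S ∥)))

module _ (c n e : ℕ) .{{_ : ℕ.NonZero c}} where
  open Elementary n
  open RandomCayley (ℤ₂^ n) using (diameter≤?)
  open FiniteGroup (ℤ₂^ n) using (from)

  rational-diameter-bound : ∀ {ε λ′ q δ} → 0ℚ ≤ ε → 0ℚ ≤ λ′ → 0ℚ ≤ q → 0ℚ ≤ δ →
    2 ℕ.^ (64 ℕ.* (128 ℕ.* c) ℕ.+ 5) ℕ.≤ n →
    (n ℕ.* n) ℕ.^ (suc (suc e) ℕ.* suc (suc e)) ℕ.≤ 32 ℕ.^ (suc (suc e) ℕ.* suc (suc e)) ℕ.* 2 ℕ.^ n →
    E (length (subsets (2 ℕ.^ n)) ℕ.+ suc (suc n)) λ′ ≤ nat 2 * nat (2 ℕ.^ n) →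
    q ^ suc (suc e) * nat (2 ℕ.^ n) ^ suc e ≤ nat (suc (suc e) !) * ((1ℚ - ε) * λ′) →
    nat n ≤ nat 4 * λ′ → nat 10 ≤ ε * nat c → 4 ℕ.≤ c → nat 8 ≤ δ * nat c → nat 128 ≤ ε * δ * nat n →
    expect q (λ S → ⟦ does (diameter≤? (suc (suc e)) S) ⟧) ≤ δ
  rational-diameter-bound {ε} {λ′} {q} {δ} 0≤ε 0≤λ 0≤q 0≤δ big n²ᴰ≤ E≤2N q-small n≤4λ 10≤εc 4≤c 8≤δc 128≤εδn =
    RationalBound.covered-bound V _≟ⱽ_ _∙_ 0# ∙-assoc ∙-comm ∙-identityʳ ∙-self c n e from from-injective
      ε λ′ q 0≤ε 0≤λ 0≤q big n²ᴰ≤ E≤2N q-small n≤4λ 10≤εc 4≤c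
      δ 8≤δc 128≤εδn 0≤δ (λ S → does (diameter≤? (suc (suc e)) S)) (λ S h x _ → diameter⇒covered e S h x)

-- Properties of sequences that hold from some index on

Ev : (ℕ → Set) → Set
Ev P = ∃[ M ] ∀ n → M ℕ.≤ n → P n

Ev-map : ∀ {P Q : ℕ → Set} → (∀ n → P n → Q n) → Ev P → Ev Q
Ev-map f (M , h) = M , λ n M≤n → f n (h n M≤n)

infixr 4 _&_
_&_ : ∀ {P Q : ℕ → Set} → Ev P → Ev Q → Ev (λ n → P n × Q n)
(M , h) & (M′ , h′) = M ℕ.⊔ M′ , λ n M≤n → h n (ℕ.m⊔n≤o⇒m≤o M M′ M≤n) , h′ n (ℕ.m⊔n≤o⇒n≤o M M′ M≤n)

Ev-witness : ∀ {P : ℕ → Set} → Ev P → ∃[ n ] P n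
Ev-witness (M , h) = M , h M ℕ.≤-refl

infix 4 _~_
-- Equality of limits for bare sequences. It applies to sequences such as the absolute values of the
-- approximations of p without equipping them with a Cauchy modulus.
_~_ : (ℕ → ℚ) → (ℕ → ℚ) → Set
a ~ b = ∀ e → 0ℚ < e → Ev (λ n → ℚ.∣ a n - b n ∣ < e)

Bdd : (ℕ → ℚ) → Set
Bdd a = Σ[ B ∈ ℚ ] 0ℚ < B × Ev (λ n → ℚ.∣ a n ∣ ≤ B)

half<self : ∀ {e} → 0ℚ < e → ½ * e < e
half<self {e} 0<e = subst₂ _<_ (+-identityʳ (½ * e)) (half+half e) (ℚ.+-monoʳ-< (½ * e) (0<half e 0<e))

~-refl : ∀ a → a ~ a
~-refl a e 0<e = 0 , λ n _ → subst (λ z → ℚ.∣ z ∣ < e) (sym (ℚ.+-inverseʳ (a n))) 0<e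

~-add : ∀ {a b c d} → a ~ b → c ~ d → (λ n → a n + c n) ~ (λ n → b n + d n)
~-add {a} {b} {c} {d} a~b c~d e 0<e = Ev-map (λ n (h , h′) → subst (ℚ.∣ a n + c n - (b n + d n) ∣ <_) (half+half e)
    (ℚ.≤-<-trans (subst (λ z → ℚ.∣ z ∣ ≤ ℚ.∣ a n - b n ∣ + ℚ.∣ c n - d n ∣)
        (solve 4 (λ a b c d → (a :- b) :+ (c :- d) := a :+ c :- (b :+ d)) refl (a n) (b n) (c n) (d n))
        (ℚ.∣p+q∣≤∣p∣+∣q∣ (a n - b n) (c n - d n)))
      (ℚ.+-mono-< h h′)))
  (a~b (½ * e) (0<half e 0<e) & c~d (½ * e) (0<half e 0<e))

~-trans : ∀ {a b c} → a ~ b → b ~ c → a ~ c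
~-trans {a} {b} {c} a~b b~c e 0<e = Ev-map (λ n → subst (λ z → ℚ.∣ z ∣ < e)
    (solve 3 (λ a b c → (a :+ b) :- (b :+ c) := a :- c) refl (a n) (b n) (c n)))
  (~-add {a} {b} {b} {c} a~b b~c e 0<e)

~-mul : ∀ {a b c d} → Bdd a → Bdd d → a ~ b → c ~ d → (λ n → a n * c n) ~ (λ n → b n * d n)
~-mul {a} {b} {c} {d} (B , 0<B , hB) (C , 0<C , hC) a~b c~d e 0<e =
  let r , 0<r , Br≡ = shrink B (½ * e) 0<B (0<half e 0<e)
      s , 0<s , Cs≡ = shrink C (½ * e) 0<C (0<half e 0<e)
  in Ev-map (λ n (ha , hd , hab , hcd) → product-close (a n) (b n) (c n) (d n) 0<B ha hcd Br≡ 0<C hd hab Cs≡)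
       (hB & hC & a~b s 0<s & c~d r 0<r)

~-complement : ∀ {a b} → a ~ b → (λ n → 1ℚ - a n) ~ (λ n → 1ℚ - b n)
~-complement {a} {b} a~b e 0<e = Ev-map (λ n → subst (_< e)
    (trans (sym (ℚ.∣-p∣≡∣p∣ (a n - b n))) (cong ℚ.∣_∣ (solve 2 (λ a b → :- (a :- b) := con 1ℚ :- a :- (con 1ℚ :- b)) refl (a n) (b n)))))
  (a~b e 0<e)

Bdd-const : ∀ c → Bdd (λ _ → c)
Bdd-const c = 1ℚ + ℚ.∣ c ∣ , ℚ.<-≤-trans 0<1 (≤-by (0≤∣p∣ c) refl) , 0 , λ _ _ → ≤-by 0≤1 (+-comm 1ℚ ℚ.∣ c ∣)

Bdd-add : ∀ {a b} → Bdd a → Bdd b → Bdd (λ n → a n + b n)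
Bdd-add {a} {b} (B , 0<B , hB) (C , 0<C , hC) = B + C , ℚ.<-≤-trans 0<B (≤-by (<⇒≤ 0<C) refl) ,
  Ev-map (λ n (h , h′) → ≤-trans (ℚ.∣p+q∣≤∣p∣+∣q∣ (a n) (b n)) (+-mono-≤ h h′)) (hB & hC)

Bdd-mul : ∀ {a b} → Bdd a → Bdd b → Bdd (λ n → a n * b n)
Bdd-mul {a} {b} (B , 0<B , hB) (C , 0<C , hC) = B * C , *-pos 0<B 0<C ,
  Ev-map (λ n (h , h′) → subst (_≤ B * C) (sym (ℚ.∣p*q∣≡∣p∣*∣q∣ (a n) (b n))) (*-mono-≤ (0≤∣p∣ (a n)) h (0≤∣p∣ (b n)) h′)) (hB & hC)

Bdd-complement : ∀ {a} → Bdd a → Bdd (λ n → 1ℚ - a n)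
Bdd-complement {a} (B , 0<B , hB) = 1ℚ + B , ℚ.<-≤-trans 0<1 (≤-by (<⇒≤ 0<B) refl) ,
  Ev-map (λ n h → ≤-trans (ℚ.∣p-q∣≤∣p∣+∣q∣ 1ℚ (a n)) (ℚ.+-monoʳ-≤ 1ℚ h)) hB

Bdd-~ : ∀ {a b} → a ~ b → Bdd b → Bdd a
Bdd-~ {a} {b} a~b (B , 0<B , hB) = 1ℚ + B , ℚ.<-≤-trans 0<1 (≤-by (<⇒≤ 0<B) refl) ,
  Ev-map (λ n (h , h′) → ≤-trans (subst (λ z → ℚ.∣ z ∣ ≤ ℚ.∣ a n - b n ∣ + ℚ.∣ b n ∣) (solve 2 (λ a b → a :- b :+ b := a) refl (a n) (b n)) (ℚ.∣p+q∣≤∣p∣+∣q∣ (a n - b n) (b n)))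
    (+-mono-≤ (<⇒≤ h) h′)) (a~b 1ℚ 0<1 & hB)

Bdd-^ : ∀ {a} k → Bdd a → Bdd (λ n → a n ^ k)
Bdd-^ zero    ha = Bdd-const 1ℚ
Bdd-^ (suc k) ha = Bdd-mul ha (Bdd-^ k ha)

~-^ : ∀ {a b} k → Bdd a → Bdd b → a ~ b → (λ n → a n ^ k) ~ (λ n → b n ^ k)
~-^ zero    ha hb a~b = ~-refl (λ _ → 1ℚ)
~-^ (suc k) ha hb a~b = ~-mul ha (Bdd-^ k hb) a~b (~-^ k ha hb a~b)

Bdd-expect : ∀ {N} (f : Subset N → ℚ) {a} → Bdd a → Bdd (λ n → expect (a n) f)
Bdd-expect {zero}  f ha = Bdd-const (f [])
Bdd-expect {suc N} f ha = Bdd-add (Bdd-mul ha (Bdd-expect (λ S → f (inside ∷ S)) ha)) (Bdd-mul (Bdd-complement ha) (Bdd-expect (λ S → f (outside ∷ S)) ha))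

-- Continuity in the probability of a polynomial given by recursion over the coordinates.
~-expect : ∀ {N} (f : Subset N → ℚ) {a b} → Bdd a → Bdd b → a ~ b → (λ n → expect (a n) f) ~ (λ n → expect (b n) f)
~-expect {zero}  f ha hb a~b = ~-refl (λ _ → f [])
~-expect {suc N} f {a} {b} ha hb a~b = ~-add
  {λ n → a n * X a n} {λ n → b n * X b n} {λ n → (1ℚ - a n) * Y a n} {λ n → (1ℚ - b n) * Y b n}
  (~-mul {a} {b} {X a} {X b} ha (Bdd-expect (λ S → f (inside ∷ S)) hb) a~b (~-expect (λ S → f (inside ∷ S)) ha hb a~b))
  (~-mul {λ n → 1ℚ - a n} {λ n → 1ℚ - b n} {Y a} {Y b} (Bdd-complement {a} ha) (Bdd-expect (λ S → f (outside ∷ S)) hb)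
    (~-complement {a} {b} a~b) (~-expect (λ S → f (outside ∷ S)) ha hb a~b))
  where
  X Y : (ℕ → ℚ) → ℕ → ℚ
  X a n = expect (a n) (λ S → f (inside ∷ S))
  Y a n = expect (a n) (λ S → f (outside ∷ S))

~-of-bounds : ∀ {a b} → (∀ e → 0ℚ < e → Ev (λ n → a n ≤ b n + e)) → (∀ e → 0ℚ < e → Ev (λ n → b n ≤ a n + e)) → a ~ b
~-of-bounds {a} {b} a≤b b≤a e 0<e = Ev-map (λ n (h , h′) → ℚ.≤-<-trans (∣∣≤
    (≤-by (slack h) (solve 3 (λ a b e → e := a :- b :+ (b :+ e :- a)) refl (a n) (b n) (½ * e)))
    (≤-by (slack h′) (solve 3 (λ a b e → e := :- (a :- b) :+ (a :+ e :- b)) refl (a n) (b n) (½ * e)))) (half<self 0<e))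
  (a≤b (½ * e) (0<half e 0<e) & b≤a (½ * e) (0<half e 0<e))

≃⇒~ : ∀ {x y} → x ≃ℝ y → seq x ~ seq y
≃⇒~ (x≤y , y≤x) = ~-of-bounds x≤y y≤x

~⇒≤ : ∀ {a b} e → 0ℚ < e → a ~ b → Ev (λ n → a n ≤ b n + e)
~⇒≤ {a} {b} e 0<e a~b = Ev-map (λ n h → ≤-by (slack (≤-trans (≤∣∣ (a n - b n)) (<⇒≤ h)))
  (solve 3 (λ a b e → b :+ e := a :+ (e :- (a :- b))) refl (a n) (b n) e)) (a~b e 0<e)

-- Logarithms

seq-expSum : ∀ x m j → seq (expSum x m) j ≡ E m (seq x j)
seq-expSum x zero    j = refl
seq-expSum x (suc m) j = cong₂ _+_ (seq-expSum x m j) (cong (_* recip (m !) {{m ℕ.!≢0}}) (seq-^ℝ x m j))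

module _ {x y : ℝ} (exp : IsExp x y) where

  -- The fixed tolerance 1 is enough, as the later estimates have constant factors to spare.
  exp-bounds : ∃[ M ] ∀ m → M ℕ.≤ m → Ev (λ j → seq y j ≤ E m (seq x j) + 1ℚ × E m (seq x j) ≤ seq y j + 1ℚ)
  exp-bounds = let M , h = exp 1ℝ (1ℚ , 0<1 , 0 , λ _ _ → ≤-refl) in M , λ m M≤m →
    let (e , 0<e , lower) , (e′ , 0<e′ , upper) = h m M≤m in
    Ev-map (λ j (l , u) →
        ≤-by (slack l ⊞ <⇒≤ 0<e) (trans (cong (_+ 1ℚ) (sym (seq-expSum x m j)))
          (solve 3 (λ s y e → s :+ con 1ℚ := y :+ (s :- (y :- con 1ℚ :+ e) :+ e)) refl (seq (expSum x m) j) (seq y j) e))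
      , ≤-trans (≤-reflexive (sym (seq-expSum x m j))) (≤-by (slack u ⊞ <⇒≤ 0<e′)
          (solve 3 (λ s y e → y :+ con 1ℚ := s :+ (y :+ con 1ℚ :- (s :+ e) :+ e)) refl (seq (expSum x m) j) (seq y j) e′)))
      (lower & upper)

nonneg-of-E : ∀ M {x} → nat 3 ≤ E (suc (suc (M ℕ.+ M))) x → 0ℚ ≤ x
nonneg-of-E M {x} h = go (≤-total 0ℚ x)
  where
  go : 0ℚ ≤ x ⊎ x ≤ 0ℚ → 0ℚ ≤ x
  go (inj₁ 0≤x) = 0≤x
  go (inj₂ x≤0) = contradiction (nat-cancel-≤ {3} {2} (≤-trans h (subst (λ z → E (suc (suc (M ℕ.+ M))) z ≤ nat 2)
    (solve 1 (λ x → :- (con 0ℚ :- x) := x) refl x) (E-negative M (slack x≤0))))) λ { (s≤s (s≤s ())) }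

double-even : ∀ M → M ℕ.≤ suc (suc (M ℕ.+ M))
double-even M = ℕ.m≤n⇒m≤1+n (ℕ.m≤n⇒m≤1+n (ℕ.m≤m+n M M))

nat-pred : ∀ n .{{_ : ℕ.NonZero n}} → nat n ≡ 1ℚ + nat (ℕ.pred n)
nat-pred (suc n) = nat-suc n

2^-pred : ∀ n .{{_ : ℕ.NonZero n}} → 2 ℕ.^ n ≡ 2 ℕ.* 2 ℕ.^ ℕ.pred n
2^-pred (suc n) = refl

module Log (n : ℕ) (2≤n : 2 ℕ.≤ n) {L : ℝ} (isLog : IsLog (fromℕ (2 ℕ.^ n)) L) where

  -- Were the value at most (n - 1) / 2, `E-half` would bound the partial sum by 2^(n - 1), whereas
  -- it is within 1 of 2ⁿ.
  log-lower : Ev (λ j → 0ℚ ≤ seq L j × nat (ℕ.pred n) * ½ ≤ seq L j)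
  log-lower = let M , h = exp-bounds {L} {fromℕ (2 ℕ.^ n)} isLog in Ev-map (λ j (l , _) → bounds M (seq L j) l) (h (suc (suc (M ℕ.+ M))) (double-even M))
    where
    bounds : ∀ M x → nat (2 ℕ.^ n) ≤ E (suc (suc (M ℕ.+ M))) x + 1ℚ → 0ℚ ≤ x × nat (ℕ.pred n) * ½ ≤ x
    bounds M x h = 0≤x , go (≤-total (nat (ℕ.pred n) * ½) x)
      where
      m = suc (suc (M ℕ.+ M))
      0≤x : 0ℚ ≤ x
      0≤x = nonneg-of-E M (≤-by (slack h ⊞ slack (nat-mono-≤ (ℕ.^-monoʳ-≤ 2 2≤n)))
        (solve 2 (λ N s → s := con (nat 3) :+ ((s :+ con 1ℚ :- N) :+ (N :- con (nat 4)))) refl (nat (2 ℕ.^ n)) (E m x)))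
      go : nat (ℕ.pred n) * ½ ≤ x ⊎ x ≤ nat (ℕ.pred n) * ½ → nat (ℕ.pred n) * ½ ≤ x
      go (inj₁ le) = le
      go (inj₂ ge) = contradiction (nat-cancel-≤ {2} {1} (≤-trans (nat-mono-≤ (ℕ.^-monoʳ-≤ 2 {1} (ℕ.pred-mono-≤ 2≤n))) a≤1)) λ { (s≤s ()) }
        where
        a = nat (2 ℕ.^ ℕ.pred n)
        2a≤ : nat 2 * a ≤ a + 1ℚ
        2a≤ = ≤-trans (≤-reflexive (trans (sym (nat-* 2 (2 ℕ.^ ℕ.pred n))) (cong nat (sym (2^-pred n {{ℕ.>-nonZero (ℕ.<⇒≤ 2≤n)}})))))
          (≤-trans h (ℚ.+-monoˡ-≤ 1ℚ (≤-trans (E-mono m 0≤x ge) (E-half m (ℕ.pred n)))))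
        a≤1 : a ≤ 1ℚ
        a≤1 = ≤-by (slack 2a≤) (solve 1 (λ a → con 1ℚ := a :+ (a :+ con 1ℚ :- con (nat 2) :* a)) refl a)

  log-upper : ∀ m → Ev (λ j → E m (seq L j) ≤ nat 2 * nat (2 ℕ.^ n))
  log-upper m = let M , h = exp-bounds {L} {fromℕ (2 ℕ.^ n)} isLog in Ev-map
    (λ j ((_ , u) , (0≤L , _)) → ≤-trans (E-monoˡ 0≤L (ℕ.m≤m⊔n m M)) (≤-trans u
      (≤-by (slack (1≤nat (2 ℕ.^ n) {{ℕ.m^n≢0 2 n}})) (solve 1 (λ N → con (nat 2) :* N := N :+ con 1ℚ :+ (N :- con 1ℚ)) refl (nat (2 ℕ.^ n))))))
    (h (m ℕ.⊔ M) (ℕ.m≤n⊔m m M) & log-lower)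

-- The degree bound: d² ≤ log N / (2 log log N) means (log N)^(2d²) ≤ N

module _ (n e : ℕ) where
  private
    d K : ℕ
    d = suc (suc e)
    K = 2 ℕ.* (d ℕ.* d)

    N : ℕ
    N = 2 ℕ.^ n

  -- Here y approximates log log N and l approximates log N, so `E m y` is comparable to n and its
  -- K-th power to exp (K y) ≤ exp (l + ½). The losses add up to n^K ≤ 4^K · 8N; then 4^K = 16^D,
  -- and 8 ≤ 2^D because D ≥ 4, which gives the 32.
  K-bound : ∀ m k .{{_ : ℕ.NonZero k}} {y l} → 0ℚ ≤ y → 0ℚ ≤ l → y ≤ nat k → nat K * y * y ≤ ½ * nat k →
            nat n ≤ nat 4 * E m y → nat K * y ≤ l + ½ → E (suc (k ℕ.* K)) l ≤ nat 2 * nat N →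
            (n ℕ.* n) ℕ.^ (d ℕ.* d) ℕ.≤ 32 ℕ.^ (d ℕ.* d) ℕ.* N
  K-bound m k {y} {l} 0≤y 0≤l y≤k Kyy≤ n≤4A Ky≤ E≤ = begin
    (n ℕ.* n) ℕ.^ D ≡⟨ trans (cong (ℕ._^ D) (cong (n ℕ.*_) (sym (ℕ.*-identityʳ n)))) (ℕ.^-*-assoc n 2 D) ⟩
    n ℕ.^ K ≤⟨ nat-cancel-≤ rational ⟩
    4 ℕ.^ K ℕ.* (8 ℕ.* N) ≡⟨ cong (ℕ._* (8 ℕ.* N)) (sym (ℕ.^-*-assoc 4 2 D)) ⟩
    16 ℕ.^ D ℕ.* (8 ℕ.* N) ≤⟨ ℕ.*-monoʳ-≤ (16 ℕ.^ D) (ℕ.*-monoˡ-≤ N (ℕ.^-monoʳ-≤ 2 {3} {D} (ℕ.≤-trans (ℕ.≤ᵇ⇒≤ 3 4 _) (ℕ.*-mono-≤ {2} {d} {2} {d} (s≤s (s≤s z≤n)) (s≤s (s≤s z≤n)))))) ⟩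
    16 ℕ.^ D ℕ.* (2 ℕ.^ D ℕ.* N) ≡⟨ ℕ.*-assoc (16 ℕ.^ D) (2 ℕ.^ D) N ⟨
    16 ℕ.^ D ℕ.* 2 ℕ.^ D ℕ.* N ≡⟨ cong (ℕ._* N) (ℕ-^-distrib-* 16 2 D) ⟨
    32 ℕ.^ D ℕ.* N ∎
    where
    open ℕ.≤-Reasoning
    D = d ℕ.* d
    A = E m y
    m′ = suc (k ℕ.* K)
    0≤A : 0ℚ ≤ A
    0≤A = 0≤E m 0≤y
    Aᴷ≤ : A ^ K * ½ * ½ ≤ nat 2 * nat N
    Aᴷ≤ = ≤-trans (*-monoʳ 0≤½ (≤-trans (E-power m K k 0≤y y≤k Kyy≤) (E-mono m′ (0≤nat K ⊠ 0≤y) Ky≤))) (≤-trans (E-shift-upper m′ 0≤l 0≤½) E≤)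
    rational : nat (n ℕ.^ K) ≤ nat (4 ℕ.^ K ℕ.* (8 ℕ.* N))
    rational = ≤-trans (≤-reflexive (nat-^ n K)) (≤-trans (^-mono K (0≤nat n) n≤4A) (≤-trans (≤-reflexive (^-distrib-* (nat 4) A K))
      (≤-trans (*-monoˡ (0≤^ K (0≤nat 4)) (≤-by (0≤nat 4 ⊠ slack Aᴷ≤) (solve 2 (λ a N → con (nat 8) :* N := a :+ con (nat 4) :* (con (nat 2) :* N :- a :* con ½ :* con ½)) refl (A ^ K) (nat N))))
        (≤-reflexive (sym (trans (nat-* (4 ℕ.^ K) (8 ℕ.* N)) (cong₂ _*_ (nat-^ 4 K) (nat-* 8 N))))))))

  module _ (16≤n : 16 ℕ.≤ n) {γ D : ℝ} (0<γ : 0ℝ <ℝ γ) (γ<1 : γ <ℝ 1ℝ) (isDegreeBound : IsDegreeBound γ N D) (d≤D : fromℕ d ≤ℝ D) where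
    open IsDegreeBound isDegreeBound renaming (logN to L; loglogN to LL; quotient to Q; root to R)
    open Log n (ℕ.≤-trans (ℕ.≤ᵇ⇒≤ 2 16 _) 16≤n) isLogN

    -- The margin between (1 - γ) root and root absorbs the approximation errors: if the root fell
    -- below d, then γ d would be at most the total tolerance g, while γ d ≥ 2g.
    d≤root : Ev (λ j → nat d ≤ seq R j)
    d≤root = let g , 0<g , lo = 0<γ ; g′ , 0<g′ , hi = γ<1 ; h = ½ * g ; 0<h = 0<half g 0<g in
      Ev-map (λ j (γ≥ , γ≤ , d≤ , D≤) → go g 0<g (seq γ j) (seq R j) (seq D j)
          (≤-trans (≤-reflexive (sym (+-identityˡ g))) γ≥) (≤-trans (≤-by (<⇒≤ 0<g′) refl) γ≤) d≤ D≤)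
        (lo & hi & d≤D h 0<h & proj₁ isBound h 0<h)
      where
      go : ∀ g → 0ℚ < g → ∀ c r D → g ≤ c → c ≤ 1ℚ → nat d ≤ D + ½ * g → D ≤ (1ℚ - c) * r + ½ * g → nat d ≤ r
      go g 0<g c r D g≤c c≤1 d≤ D≤ = by (≤-total (nat d) r)
        where
        by : nat d ≤ r ⊎ r ≤ nat d → nat d ≤ r
        by (inj₁ h)   = h
        by (inj₂ r≤d) = contradiction 0<g (≤⇒≯ (≤-by (slack d≤ ⊞ slack D≤ ⊞ slack c≤1 ⊠ slack r≤d ⊞ slack g≤c ⊠ 0≤nat d ⊞ <⇒≤ 0<g ⊠ slack 2≤d)
          (solve 5 (λ d D g c r → con 0ℚ := g :+ (D :+ con ½ :* g :- d :+ ((con 1ℚ :- c) :* r :+ con ½ :* g :- D) :+ (con 1ℚ :- c) :* (d :- r) :+ (c :- g) :* d :+ g :* (d :- con (nat 2)))) refl (nat d) D g c r)))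
          where
          2≤d : nat 2 ≤ nat d
          2≤d = nat-mono-≤ {2} {d} (s≤s (s≤s z≤n))

    root-log : Ev (λ j → seq R j * (seq R j * 1ℚ) * (nat 2 * seq LL j) ≤ seq L j + ½)
    root-log = ~⇒≤ {λ j → seq R j * (seq R j * 1ℚ) * (nat 2 * seq LL j)} {seq L} ½ (ℚ.positive⁻¹ ½)
      (~-trans {λ j → seq R j * (seq R j * 1ℚ) * (nat 2 * seq LL j)} {λ j → seq Q j * (nat 2 * seq LL j)} {seq L}
        (~-mul {seq (R ^ℝ 2)} {seq Q} {seq (fromℕ 2 *ℝ LL)} {seq (fromℕ 2 *ℝ LL)} (bounded (R ^ℝ 2)) (bounded (fromℕ 2 *ℝ LL)) (≃⇒~ {R ^ℝ 2} {Q} (proj₂ isRoot)) (~-refl (seq (fromℕ 2 *ℝ LL))))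
        (≃⇒~ {Q *ℝ (fromℕ 2 *ℝ LL)} {L} (proj₂ isQuotient)))

    -- The conclusion concerns natural numbers only, so a single index j at which all the
    -- approximate estimates hold suffices.
    degree-estimate : (n ℕ.* n) ℕ.^ (d ℕ.* d) ℕ.≤ 32 ℕ.^ (d ℕ.* d) ℕ.* N
    degree-estimate =
      let M , h = exp-bounds {LL} {L} isLoglogN
          B , 0<B , LL≤B = bounded LL
          -- This k satisfies both side conditions of `K-bound`: it exceeds the bound B on log log
          -- N, and half of it exceeds K B².
          k-1 , B≤k = archimedean⁺ (B + nat 2 * (nat K * B * B))
          m = suc (suc (M ℕ.+ M))
          m′ = suc (suc k-1 ℕ.* K)
          j , (l , _) , (0≤L , L≥) , LL≤ , d≤R , rl , E≤ = Ev-witness (h m (double-even M) & log-lower & LL≤B & d≤root & root-log & log-upper m′)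
      in at M B (suc k-1) {seq LL j} {seq L j} {seq R j} (<⇒≤ 0<B) B≤k l 0≤L L≥ LL≤ d≤R rl E≤
      where
      at : ∀ M B k .{{_ : ℕ.NonZero k}} {y l r} → 0ℚ ≤ B → B + nat 2 * (nat K * B * B) ≤ nat k → l ≤ E (suc (suc (M ℕ.+ M))) y + 1ℚ → 0ℚ ≤ l → nat (ℕ.pred n) * ½ ≤ l →
           ℚ.∣ y ∣ ≤ B → nat d ≤ r → r * (r * 1ℚ) * (nat 2 * y) ≤ l + ½ → E (suc (k ℕ.* K)) l ≤ nat 2 * nat N →
           (n ℕ.* n) ℕ.^ (d ℕ.* d) ℕ.≤ 32 ℕ.^ (d ℕ.* d) ℕ.* N
      at M B k {y} {l} {r} 0≤B B≤k l≤ 0≤l L≥ ∣y∣≤B d≤r rl E≤ = K-bound m k 0≤y 0≤l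
        (≤-trans y≤B (≤-trans (≤-by (0≤nat 2 ⊠ 0≤KBB) refl) B≤k)) Kyy≤ n≤4A Ky≤ E≤
        where
        m = suc (suc (M ℕ.+ M))
        s = nat (ℕ.pred n)
        15≤s : nat 15 ≤ s
        15≤s = nat-mono-≤ (ℕ.pred-mono-≤ 16≤n)
        n≤4A : nat n ≤ nat 4 * E m y
        n≤4A = ≤-by (0≤nat 4 ⊠ slack l≤ ⊞ 0≤nat 4 ⊠ slack L≥ ⊞ (slack 15≤s ⊞ 0≤nat 10)) (trans
          (solve 3 (λ A l s → con (nat 4) :* A := (con 1ℚ :+ s) :+ (con (nat 4) :* (A :+ con 1ℚ :- l) :+ con (nat 4) :* (l :- s :* con ½) :+ ((s :- con (nat 15)) :+ con (nat 10)))) refl (E m y) l s)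
          (cong (_+ (nat 4 * (E m y + 1ℚ - l) + nat 4 * (l - s * ½) + ((s - nat 15) + nat 10))) (sym (nat-pred n {{ℕ.>-nonZero (ℕ.≤-trans (s≤s z≤n) 16≤n)}}))))
        0≤y : 0ℚ ≤ y
        0≤y = nonneg-of-E M (*-cancelˡ (0<nat 4) (≤-trans (nat-mono-≤ {12} {n} (ℕ.≤-trans (ℕ.≤ᵇ⇒≤ 12 16 _) 16≤n)) n≤4A))
        y≤B : y ≤ B
        y≤B = ≤-trans (≤∣∣ y) ∣y∣≤B
        0≤KBB : 0ℚ ≤ nat K * B * B
        0≤KBB = 0≤nat K ⊠ 0≤B ⊠ 0≤B
        Kyy≤ : nat K * y * y ≤ ½ * nat k
        Kyy≤ = ≤-trans (*-mono-≤ (0≤nat K ⊠ 0≤y) (*-monoˡ (0≤nat K) y≤B) 0≤y y≤B)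
          (≤-by (0≤½ ⊠ slack B≤k ⊞ 0≤½ ⊠ 0≤B) (solve 3 (λ w B k → con ½ :* k := w :+ (con ½ :* (k :- (B :+ con (nat 2) :* w)) :+ con ½ :* B)) refl (nat K * B * B) B (nat k)))
        Ky≤ : nat K * y ≤ l + ½
        Ky≤ = ≤-trans (≤-reflexive (trans (cong (_* y) (trans (nat-* 2 (d ℕ.* d)) (cong (nat 2 *_) (nat-* d d)))) (solve 3 (λ t d y → t :* (d :* d) :* y := d :* d :* (t :* y)) refl (nat 2) (nat d) y)))
          (≤-trans (*-monoʳ (0≤nat 2 ⊠ 0≤y) (≤-trans (*-mono-≤ (0≤nat d) d≤r (0≤nat d) d≤r) (≤-reflexive (cong (r *_) (sym (*-identityʳ r)))))) rl)

-- The threshold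

-- Approximations of a nonnegative real may be negative; their absolute values have the same limit
-- and are admissible in the rational bound.
∣∣~ : ∀ {p} → 0ℝ ≤ℝ p → seq p ~ (λ j → ℚ.∣ seq p j ∣)
∣∣~ {p} 0≤p = ~-of-bounds {seq p} {λ j → ℚ.∣ seq p j ∣}
  (λ e 0<e → 0 , λ j _ → ≤-trans (≤∣∣ (seq p j)) (≤-by (<⇒≤ 0<e) refl))
  (λ e 0<e → Ev-map (λ j h → ∣∣≤ (≤-by (<⇒≤ 0<e) refl) (≤-by (0≤nat 2 ⊠ slack h)
      (trans (cong (seq p j +_) (sym (half+half e))) (solve 2 (λ p h → p :+ (h :+ h) := :- p :+ con (nat 2) :* (p :+ h :- con 0ℚ)) refl (seq p j) (½ * e)))))
    (0≤p (½ * e) (0<half e 0<e)))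

module _ (n e : ℕ) where
  private
    d N : ℕ
    d = suc (suc e)
    N = 2 ℕ.^ n

    P : ℕ
    P = N ℕ.^ suc e

    instance
      N≢0 : ℕ.NonZero N
      N≢0 = ℕ.m^n≢0 2 n

    P≢0 : ℕ.NonZero P
    P≢0 = ℕ.m^n≢0 N (suc e)

  module _ {ε T p : ℝ} (isThreshold : IsThreshold ε N d T) (0≤p : 0ℝ ≤ℝ p) (p≤T : p ≤ℝ T) where
    open IsThreshold isThreshold renaming (logN to L)

    private
      q v : ℕ → ℚ
      q j = ℚ.∣ seq p j ∣
      -- An upper bound of `q j` that still converges to `T`. This passes from p ≤ T to d-th powers
      -- by monotonicity, without exact comparison of approximations.
      v j = q j ℚ.⊔ seq T j

    q≤T : ∀ e → 0ℚ < e → Ev (λ j → q j ≤ seq T j + e)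
    q≤T e 0<e = Ev-map (λ j (p≥ , T≥ , p≤) → ∣∣≤ (≤-by (slack p≤ ⊞ <⇒≤ 0<h) (trans (cong (seq T j +_) (sym (half+half e))) (solve 3 (λ t h p → t :+ (h :+ h) := p :+ (t :+ h :- p :+ h)) refl (seq T j) h (seq p j))))
        (≤-by (slack p≥ ⊞ slack T≥) (trans (cong (seq T j +_) (sym (half+half e))) (solve 3 (λ t h p → t :+ (h :+ h) := :- p :+ (p :+ h :- con 0ℚ :+ (t :+ h :- con 0ℚ))) refl (seq T j) h (seq p j)))))
      (0≤p h 0<h & proj₁ isRoot h 0<h & p≤T h 0<h)
      where
      h = ½ * e
      0<h = 0<half e 0<e

    v~T : v ~ seq T
    v~T = ~-of-bounds {v} {seq T}
      (λ e 0<e → Ev-map (λ j h → ℚ.⊔-lub h (≤-by (<⇒≤ 0<e) refl)) (q≤T e 0<e))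
      (λ e 0<e → 0 , λ j _ → ≤-trans (ℚ.p≤q⊔p (q j) (seq T j)) (≤-by (<⇒≤ 0<e) refl))

    power-bound : ∀ e₂ → 0ℚ < e₂ → Ev (λ j → q j ^ d ≤ nat (d !) * (1ℚ - seq ε j) * (seq L j * recip P {{P≢0}}) + (e₂ + e₂))
    power-bound e₂ 0<e₂ = Ev-map (λ j (h , h′) → ≤-trans (^-mono d (0≤∣p∣ (seq p j)) (ℚ.p≤p⊔q (q j) (seq T j)))
        (≤-by (slack h ⊞ slack h′) (trans (solve 4 (λ r e v t → r :+ (e :+ e) := v :+ (t :+ e :- v :+ (r :+ e :- t))) refl (nat (d !) * (1ℚ - seq ε j) * (seq L j * recip P {{P≢0}})) e₂ (v j ^ d) (seq (T ^ℝ d) j))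
          (cong (λ z → v j ^ d + (z + e₂ - v j ^ d + (nat (d !) * (1ℚ - seq ε j) * (seq L j * recip P {{P≢0}}) + e₂ - seq (T ^ℝ d) j))) (seq-^ℝ T d j)))))
      (~⇒≤ {λ j → v j ^ d} {λ j → seq T j ^ d} e₂ 0<e₂ (~-^ {v} {seq T} d (Bdd-~ {v} {seq T} v~T (bounded T)) (bounded T) v~T) & proj₁ (proj₂ isRoot) e₂ 0<e₂)

    threshold-estimate : ∀ {ε₁} → 0ℚ < ε₁ → Ev (λ j → ε₁ ≤ seq ε j) → Ev (λ j → 1ℚ ≤ seq L j) →
      Ev (λ j → q j ^ d * nat N ^ suc e ≤ nat (d !) * ((1ℚ - ½ * ε₁) * seq L j))
    threshold-estimate {ε₁} 0<ε₁ ε≥ L≥ = Ev-map (λ j (h , ε₁≤ , 1≤L) → at (q j ^ d) (seq ε j) (seq L j) h ε₁≤ 1≤L)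
        (power-bound e₂ 0<e₂ & ε≥ & L≥)
      where
      -- The tolerance depends on N and d: after multiplication by N^(d - 1) the total error is ½ε₁,
      -- which fits into half of ε since d! and log N are at least 1.
      e₂ = ½ * (½ * ε₁ * recip P {{P≢0}})
      0<e₂ : 0ℚ < e₂
      0<e₂ = 0<half (½ * ε₁ * recip P {{P≢0}}) (*-pos (0<half ε₁ 0<ε₁) (0<recip P {{P≢0}}))
      f = nat (d !)
      ρ = recip P {{P≢0}}
      π = nat N ^ suc e
      ρπ≡1 : ρ * π ≡ 1ℚ
      ρπ≡1 = trans (cong (ρ *_) (sym (nat-^ N (suc e)))) (recip-inverse P {{P≢0}})
      at : ∀ x ε l → x ≤ f * (1ℚ - ε) * (l * ρ) + (e₂ + e₂) → ε₁ ≤ ε → 1ℚ ≤ l → x * π ≤ f * ((1ℚ - ½ * ε₁) * l)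
      at x ε l h ε₁≤ 1≤l = begin
        x * π
          ≤⟨ *-monoʳ (0≤^ (suc e) (0≤nat N)) h ⟩
        (f * (1ℚ - ε) * (l * ρ) + (e₂ + e₂)) * π
          ≡⟨ cong (λ z → (f * (1ℚ - ε) * (l * ρ) + z) * π) (half+half (½ * ε₁ * ρ)) ⟩
        (f * (1ℚ - ε) * (l * ρ) + ½ * ε₁ * ρ) * π
          ≡⟨ solve 6 (λ f ε l ρ a π → (f :* (con 1ℚ :- ε) :* (l :* ρ) :+ a :* ρ) :* π := (f :* (con 1ℚ :- ε) :* l :+ a) :* (ρ :* π)) refl f ε l ρ (½ * ε₁) π ⟩
        (f * (1ℚ - ε) * l + ½ * ε₁) * (ρ * π)
          ≡⟨ trans (cong ((f * (1ℚ - ε) * l + ½ * ε₁) *_) ρπ≡1) (*-identityʳ _) ⟩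
        f * (1ℚ - ε) * l + ½ * ε₁
          ≤⟨ ≤-by (0≤f ⊠ (slack ε₁≤ ⊠ 0≤l) ⊞ (0≤a ⊠ (slack 1≤f ⊠ 0≤l) ⊞ 0≤a ⊠ slack 1≤l))
               (solve 4 (λ f ε l a → f :* ((con 1ℚ :- con ½ :* a) :* l) :=
                 f :* (con 1ℚ :- ε) :* l :+ con ½ :* a :+ (f :* ((ε :- a) :* l) :+ (con ½ :* a :* ((f :- con 1ℚ) :* l) :+ con ½ :* a :* (l :- con 1ℚ)))) refl f ε l ε₁) ⟩
        f * ((1ℚ - ½ * ε₁) * l) ∎
        where
        open ℚ.≤-Reasoning
        0≤f = 0≤nat (d !)
        1≤f = 1≤nat (d !) {{d ℕ.!≢0}}
        0≤l = ≤-trans 0≤1 1≤l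
        0≤a : 0ℚ ≤ ½ * ε₁
        0≤a = <⇒≤ (0<half ε₁ 0<ε₁)

-- Passage to real probabilities and choice of constants

multiple : ∀ {x} A → 0ℚ < x → ∃[ k ] nat (suc A) ≤ x * nat k
multiple {x} A 0<x =
  let r , _ , xr≡A = shrink x (nat (suc A)) 0<x (0<nat (suc A))
      k , r≤k = archimedean r
  in k , subst (_≤ x * nat k) xr≡A (*-monoˡ (<⇒≤ 0<x) r≤k)

module _ {ε γ δ : ℝ} (0<γ : 0ℝ <ℝ γ) (γ<1 : γ <ℝ 1ℝ)
         {ε₁ δ₁ : ℚ} (0<ε₁ : 0ℚ < ε₁) (0<δ₁ : 0ℚ < δ₁) (ε≥ : Ev (λ j → ε₁ ≤ seq ε j)) (δ≥ : Ev (λ j → δ₁ ≤ seq δ j))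
         (c : ℕ) .{{_ : ℕ.NonZero c}} (4≤c : 4 ℕ.≤ c) (10≤εc : nat 10 ≤ ½ * ε₁ * nat c) (8≤δc : nat 8 ≤ ½ * δ₁ * nat c) where

  diameter-bound : ∀ n → 16 ℕ.≤ n → 2 ℕ.^ (64 ℕ.* (128 ℕ.* c) ℕ.+ 5) ℕ.≤ n → nat 128 ≤ ½ * ε₁ * (½ * δ₁) * nat n →
    ∀ e D → IsDegreeBound γ (2 ℕ.^ n) D → fromℕ (suc (suc e)) ≤ℝ D →
    ∀ T → IsThreshold ε (2 ℕ.^ n) (suc (suc e)) {{ℕ.m^n≢0 2 n}} T →
    ∀ p → 0ℝ ≤ℝ p → p ≤ℝ T → RandomCayley.Pr[diameter≤_] (ℤ₂^ n) (suc (suc e)) p <ℝ δ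
  diameter-bound n 16≤n big 128≤ e D isD d≤D T isT p 0≤p p≤T =
    -- Of δ₁, one half bounds the rational probability, one quarter pays for replacing the
    -- approximations of p by their absolute values, and the last quarter is the gap required by
    -- strict inequality.
    ½ * (½ * δ₁) , 0<half (½ * δ₁) (0<half δ₁ 0<δ₁) , Ev-map final (rational & close & δ≥)
    where
    N = 2 ℕ.^ n
    d = suc (suc e)
    instance
      N≢0 : ℕ.NonZero N
      N≢0 = ℕ.m^n≢0 2 n
    open IsThreshold isT using () renaming (logN to L; isLogN to isLog)
    open Log n (ℕ.≤-trans (ℕ.≤ᵇ⇒≤ 2 16 _) 16≤n) isLog using (log-lower; log-upper)
    open RandomCayley (ℤ₂^ n) using (diameter≤?)

    covered : Subset N → Bool
    covered S = does (diameter≤? d S)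

    q : ℕ → ℚ
    q j = ℚ.∣ seq p j ∣

    n²ᴰ≤ : (n ℕ.* n) ℕ.^ (d ℕ.* d) ℕ.≤ 32 ℕ.^ (d ℕ.* d) ℕ.* N
    n²ᴰ≤ = degree-estimate n e 16≤n {γ} {D} 0<γ γ<1 isD d≤D

    s : ℚ
    s = nat (ℕ.pred n)

    15≤s : nat 15 ≤ s
    15≤s = nat-mono-≤ (ℕ.pred-mono-≤ 16≤n)

    1≤L : ∀ {l} → s * ½ ≤ l → 1ℚ ≤ l
    1≤L {l} h = ≤-by (slack h ⊞ 0≤½ ⊠ slack 15≤s ⊞ ℚ.nonNegative⁻¹ (nat 13 * ½))
      (solve 2 (λ l s → l := con 1ℚ :+ ((l :- s :* con ½) :+ con ½ :* (s :- con (nat 15)) :+ con (nat 13 * ½))) refl l s)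

    n≤4L : ∀ {l} → s * ½ ≤ l → nat n ≤ nat 4 * l
    n≤4L {l} h = ≤-by (0≤nat 4 ⊠ slack h ⊞ (slack 15≤s ⊞ 0≤nat 14)) (trans
      (solve 2 (λ l s → con (nat 4) :* l := con 1ℚ :+ s :+ (con (nat 4) :* (l :- s :* con ½) :+ ((s :- con (nat 15)) :+ con (nat 14)))) refl l s)
      (cong (_+ (nat 4 * (l - s * ½) + ((s - nat 15) + nat 14))) (sym (nat-pred n {{ℕ.>-nonZero (ℕ.≤-trans (s≤s z≤n) 16≤n)}}))))

    rational : Ev (λ j → expect (q j) (λ S → ⟦ covered S ⟧) ≤ ½ * δ₁)
    rational = Ev-map (λ j (q-small , (0≤L , L≥) , E≤) →
        rational-diameter-bound c n e {½ * ε₁} {seq L j} {q j} {½ * δ₁} (<⇒≤ (0<half ε₁ 0<ε₁)) 0≤L (0≤∣p∣ (seq p j)) (<⇒≤ (0<half δ₁ 0<δ₁))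
          big n²ᴰ≤ E≤ q-small (n≤4L L≥) 10≤εc 4≤c 8≤δc 128≤)
      (threshold-estimate n e {ε} {T} {p} isT 0≤p p≤T 0<ε₁ ε≥ (Ev-map (λ j (_ , L≥) → 1≤L L≥) log-lower)
        & log-lower & log-upper (length (subsets N) ℕ.+ suc (suc n)))

    close : Ev (λ j → expect (seq p j) (λ S → ⟦ covered S ⟧) ≤ expect (q j) (λ S → ⟦ covered S ⟧) + ½ * (½ * δ₁))
    close = ~⇒≤ {λ j → expect (seq p j) (λ S → ⟦ covered S ⟧)} {λ j → expect (q j) (λ S → ⟦ covered S ⟧)} (½ * (½ * δ₁)) (0<half (½ * δ₁) (0<half δ₁ 0<δ₁))
      (~-expect (λ S → ⟦ covered S ⟧) (bounded p) (abs-bounded (bounded p)) (∣∣~ {p} 0≤p))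
      where
      abs-bounded : Bdd (seq p) → Bdd q
      abs-bounded (B , 0<B , h) = B , 0<B , Ev-map (λ j → subst (_≤ B) (sym (ℚ.∣∣p∣∣≡∣p∣ (seq p j)))) h

    final : ∀ j → expect (q j) (λ S → ⟦ covered S ⟧) ≤ ½ * δ₁ × expect (seq p j) (λ S → ⟦ covered S ⟧) ≤ expect (q j) (λ S → ⟦ covered S ⟧) + ½ * (½ * δ₁) × δ₁ ≤ seq δ j →
            seq (RandomCayley.Pr[diameter≤_] (ℤ₂^ n) d p) j + ½ * (½ * δ₁) ≤ seq δ j
    final j (h₁ , h₂ , h₃) = ≤-trans (≤-reflexive (cong (_+ ½ * (½ * δ₁)) (seq-Pr p N (diameter≤? d) j)))
      (≤-by (slack h₁ ⊞ slack h₂ ⊞ slack h₃)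
        (solve 4 (λ x y D s → s := x :+ con ½ :* (con ½ :* D) :+ (con ½ :* D :- y :+ (y :+ con ½ :* (con ½ :* D) :- x) :+ (s :- D))) refl
          (expect (seq p j) (λ S → ⟦ covered S ⟧)) (expect (q j) (λ S → ⟦ covered S ⟧)) δ₁ (seq δ j)))

  uniform-bound : ∀ {n₁} → nat 128 ≤ ½ * ε₁ * (½ * δ₁) * nat n₁ → ∀ {W} → 2 ℕ.^ (64 ℕ.* (128 ℕ.* c) ℕ.+ 5) ℕ.≤ W →
    ∀ n → 16 ℕ.+ (n₁ ℕ.+ W) ℕ.≤ n → ∀ d → 2 ℕ.≤ d →
    ∀ D → IsDegreeBound γ (2 ℕ.^ n) D → fromℕ d ≤ℝ D →
    ∀ T → IsThreshold ε (2 ℕ.^ n) d {{ℕ.m^n≢0 2 n}} T →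
    ∀ p → 0ℝ ≤ℝ p → p ≤ℝ 1ℝ → p ≤ℝ T → RandomCayley.Pr[diameter≤_] (ℤ₂^ n) d p <ℝ δ
  uniform-bound _ _ _ _ (suc zero) (s≤s ())
  uniform-bound {n₁} 128≤ {W} big n n₀≤n (suc (suc e)) _ D isD d≤D T isT p 0≤p _ p≤T =
    diameter-bound n (ℕ.≤-trans (ℕ.m≤m+n 16 (n₁ ℕ.+ W)) n₀≤n) (ℕ.≤-trans big (ℕ.≤-trans (ℕ.m≤n+m W n₁) rest))
      (≤-trans 128≤ (*-monoˡ (<⇒≤ (*-pos (0<half ε₁ 0<ε₁) (0<half δ₁ 0<δ₁))) (nat-mono-≤ (ℕ.≤-trans (ℕ.m≤m+n n₁ W) rest))))
      e D isD d≤D T isT p 0≤p p≤T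
    where
    rest : n₁ ℕ.+ W ℕ.≤ n
    rest = ℕ.≤-trans (ℕ.m≤n+m (n₁ ℕ.+ W) 16) n₀≤n

constant : ∀ {x y} A B → 0ℚ < x → 0ℚ < y → ∃[ c ] 4 ℕ.≤ c × nat (suc A) ≤ x * nat c × nat (suc B) ≤ y * nat c
constant A B 0<x 0<y =
  let k , hk = multiple A 0<x
      l , hl = multiple B 0<y
  in 4 ℕ.+ (k ℕ.+ l) , ℕ.m≤m+n 4 (k ℕ.+ l)
   , ≤-trans hk (*-monoˡ (<⇒≤ 0<x) (nat-mono-≤ (ℕ.≤-trans (ℕ.m≤m+n k l) (ℕ.m≤n+m (k ℕ.+ l) 4))))
   , ≤-trans hl (*-monoˡ (<⇒≤ 0<y) (nat-mono-≤ (ℕ.≤-trans (ℕ.m≤n+m l k) (ℕ.m≤n+m (k ℕ.+ l) 4))))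

theorem4 : (ε γ : ℝ) → 0ℝ <ℝ ε → 0ℝ <ℝ γ → γ <ℝ 1ℝ →
    (δ : ℝ) → 0ℝ <ℝ δ →
    ∃[ n₀ ] ((n : ℕ) → n₀ ℕ.≤ n →
      (d : ℕ) → 2 ℕ.≤ d →
      (D : ℝ) → IsDegreeBound γ (2 ℕ.^ n) D → fromℕ d ≤ℝ D →
      (T : ℝ) → IsThreshold ε (2 ℕ.^ n) d {{ℕ.m^n≢0 2 n}} T →
      (p : ℝ) → 0ℝ ≤ℝ p → p ≤ℝ 1ℝ → p ≤ℝ T →
      RandomCayley.Pr[diameter≤_] (ℤ₂^ n) d p <ℝ δ)
theorem4 ε γ (ε₁ , 0<ε₁ , ε≥) 0<γ γ<1 δ (δ₁ , 0<δ₁ , δ≥) =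
  conclude (constant 9 7 0<ε′ 0<δ′) (multiple 127 (*-pos 0<ε′ 0<δ′))
  where
  0<ε′ = 0<half ε₁ 0<ε₁
  0<δ′ = 0<half δ₁ 0<δ₁
  drop-0 : ∀ {a b} → 0ℚ + a ≤ b → a ≤ b
  drop-0 {a} {b} = subst (_≤ b) (+-identityˡ a)
  conclude : (∃[ c ] 4 ℕ.≤ c × nat 10 ≤ ½ * ε₁ * nat c × nat 8 ≤ ½ * δ₁ * nat c) → (∃[ k ] nat 128 ≤ ½ * ε₁ * (½ * δ₁) * nat k) → _
  -- The three summands of the bound on n serve the crude logarithm estimates, the size of the mean,
  -- and the size estimates governed by c.
  conclude (c , 4≤c , 10≤ , 8≤) (n₁ , 128≤) = 16 ℕ.+ (n₁ ℕ.+ 2 ℕ.^ (64 ℕ.* (128 ℕ.* c) ℕ.+ 5)) ,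
    uniform-bound {ε} {γ} {δ} 0<γ γ<1 0<ε₁ 0<δ₁ (Ev-map (λ _ → drop-0) ε≥) (Ev-map (λ _ → drop-0) δ≥)
      c {{ℕ.>-nonZero (ℕ.≤-trans (s≤s z≤n) 4≤c)}} 4≤c 10≤ 8≤ 128≤ ℕ.≤-refl
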